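{- (i) Let $S\equiv\pm\{1, 6, 7, 8, 11, 13, 18, 19, 20, 21, 23, 25\}\pmod{60}$ and $T\equiv\pm\{1, 5, 6, 7, 13, 17, 18, 19, 20, 21, 28, 29\}\pmod{60}$. Then $p(S,n)=p(T,n-1)$ for all $n\geq 1$. (ii) Let $S\equiv\pm\{4, 5, 6, 7, 11, 13, 17, 18, 19, 20, 27, 29\}\pmod{60}$ and $T\equiv\pm\{1, 6, 7, 11, 13, 16, 18, 20, 23, 25, 27, 29\}\pmod{60}$. Then $p(S,n)=p(T,n-4)$ for all $n\geq 4$. (iii) Let $S\equiv\pm\{5, 6, 7, 8, 9, 11, 17, 18, 19, 20, 23, 29\}\pmod{60}$ and $T\equiv\pm\{1, 6, 9, 11, 13, 17, 18, 20, 23, 25, 28, 29\}\pmod{60}$. Then $p(S,n)=p(T,n-5)$ for all $n\geq 5$. (iv) Let $S\equiv\pm\{1, 3, 4, 6, 11, 13, 17, 18, 19, 20, 23, 25\}\pmod{60}$ and $T\equiv\pm\{1, 3, 5, 6, 7, 16, 17, 18, 19, 20, 23, 29\}\pmod{60}$. Then $p(S,n)=p(T,n)$ for all integers $n\ge0$ with $n\neq 4$.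
   Context: For a set $S$ of positive integers and an integer $n\ge 0$, $p(S,n)$ denotes the number of partitions of $n$ into parts belonging to $S$ (so $p(S,0)=1$). The notation $S\equiv\pm\{r_1,\dots,r_k\}\pmod M$ means that $S$ is the set of all positive integers $n$ such that $n\equiv r_i$ or $n\equiv -r_i\pmod M$ for some $i$. -}

module Defs where

open import Data.Nat using (ℕ; zero; suc; _+_; _∸_; _≤ᵇ_; _≡ᵇ_; _%_)
open import Data.Bool using (Bool; true; false; _∨_; _∧_; if_then_else_)
open import Data.List using (List; []; _∷_; map; _++_; length)
open import Data.Bool.ListAction using (any)

PosSet : Set
PosSet = ℕ → Bool

-- S ≡ ± {r₁,…,r_k} (mod M): the set of all positive n with n ≡ rᵢ or
-- n ≡ −rᵢ (mod M) for some i.  (n ≡ −r (mod M)  ⇔  M ∣ n + r.)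
pmResidues : (M : ℕ) → List ℕ → PosSet
pmResidues M rs zero = false
pmResidues zero rs (suc n) = false
pmResidues (suc m) rs (suc n) =
  any (λ r → ((suc n % suc m) ≡ᵇ (r % suc m)) ∨ (((suc n + r) % suc m) ≡ᵇ 0)) rs

-- partsF S f k n : explicit list of all partitions of n into parts belonging
-- to S, every part ≤ k, each written as a non-increasing list of parts.
-- f is fuel (≥ number of parts equal to k needed, e.g. f = n suffices).
-- Either no part equals k, or the largest part is k and the remainder is a
-- partition of n − k with parts ≤ k.
partsF : PosSet → (f k n : ℕ) → List (List ℕ)
partsF S f zero zero = [] ∷ []
partsF S f zero (suc n) = []
partsF S zero (suc k) n = partsF S n k n
partsF S (suc f) (suc k) n =
  partsF S n k n ++
  (if S (suc k) ∧ (suc k ≤ᵇ n)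
     then map (suc k ∷_) (partsF S f (suc k) (n ∸ suc k))
     else [])

partitions : PosSet → ℕ → List (List ℕ)
partitions S n = partsF S n n n

p : PosSet → ℕ → ℕ
p S n = length (partitions S n)

{-# OPTIONS --safe #-}
-- Write [r] = ∏ (1 - q^(60n+r)) (1 - q^(60n+60-r)) and let [X] be the product of the [r] over the
-- residues r of X.  Each assertion says that [T] - q^a [S] = q^e [S] [T], where (a , e) is (1 , 0),
-- (4 , 0), (5 , 0), (0 , 4).  The four cases are the transforms of a single identity under
-- multiplication of all residues by k = 1, 7, 29, 23.  Write θ(z) = ∏ (1 - z Q^n) (1 - Q^(n+1) / z).
-- For k = 1, Weierstrass' relation between the products θ(xy) θ(x/y) θ(uv) θ(u/v) with Q = q^60,
-- applied to the points q^6, q^10, q^11, q^14 and to q^6, q^14, q^17, q^22, reduces the identity to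
--   [1] [28] [29] - q^4 [4] [5] [25] = [1] [4] [5] [6] [7] [11] [13] [17] [18] [19] [23] [24] [25] [28] [29],
-- which is Weierstrass' relation with Q = q^30 at the points q^2, -q^4, -q^8, q^9.  By the triple
-- product identity θ(xy) θ(x/y) is, up to a factor that depends only on Q, a 2 × 2 determinant whose
-- rows are functions of x and of y; Weierstrass' relation is the Plücker relation for these rows.
-- All of this takes place modulo q^N, where finite products and sums suffice.
module Submission where

open import Defs
open import Algebra.Bundles using (CommutativeMonoid; CommutativeRing)
open import Data.Bool using (true; false; T; if_then_else_; _∧_; _∨_)
open import Data.Bool.ListAction using (all)
open import Data.Bool.Properties using (T-∧)
open import Data.Integer.Base as ℤ using (ℤ; +_; -[1+_]; 0ℤ; 1ℤ; ∣_∣)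
import Data.Integer.Properties as ℤₚ
open import Data.Integer.Solver using (module +-*-Solver)
open import Data.Integer.Tactic.RingSolver using (solve-∀)
open import Data.List using (List; []; _∷_; map; _++_; length)
open import Data.List.Properties using (length-++; length-map; ++-identityʳ)
open import Data.Maybe.Base using (Maybe; just; nothing)
open import Data.Nat using (ℕ; zero; suc; _<_; _≤_; _∸_; z≤n; s≤s; _≤ᵇ_; _<ᵇ_; _≡ᵇ_; _%_)
import Data.Nat.Base as ℕ
open import Data.Nat.DivMod using ([m+kn]%n≡m%n)
import Data.Nat.Properties as ℕₚ
open import Data.Product using (_×_; _,_; ∃-syntax)
open import Data.Sign.Base as Sign using (Sign)
import Data.Sign.Properties as Signₚ
open import Data.Sum.Base using (_⊎_; inj₁; inj₂)
open import Function.Base using (_∘_)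
open import Function.Bundles using (Equivalence)
open import Level using (0ℓ)
open import Relation.Binary.Definitions using (tri<; tri≈; tri>)
import Relation.Binary.PropositionalEquality as ≡
open import Relation.Binary.PropositionalEquality using (_≡_; _≢_)
open import Relation.Nullary.Decidable using (yes; no)
open import Relation.Nullary.Negation using (contradiction)

-- Division by [S] [T] turns the identity into 1/[S] - q^a / [T] = q^e, an equation between the
-- generating functions of the partition numbers. Multiplying all residues by k is no substitution
-- in power series, so the other cases do not follow formally from k = 1. What survives is the
-- shape: the points of each Weierstrass relation are multiplied by k and brought back to exponents
-- at most H by z ↦ 1/z and z ↦ Q z, which permutes the terms and changes their coefficients by
-- signs and powers of q. The elimination is therefore done once, with undetermined coefficients,
-- subject to one compatibility condition, expressed by `μ`. The reduction has to cancel brackets.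
-- Over a ring in which q is nilpotent this is legitimate, because 1 - q^m is a unit for m ≥ 1; all
-- series are then finite as well, and the triple product follows from an identity for Gaussian
-- binomials without any limit.

-- Polynomial identities with integer coefficients in an arbitrary commutative ring

module IntegerSolver {c ℓ} (R : CommutativeRing c ℓ) where
  open import Algebra.Solver.Ring.AlmostCommutativeRing
    using (fromCommutativeRing; _-Raw-AlmostCommutative⟶_)
  open CommutativeRing R
  open import Algebra.Properties.Ring ring
  open import Algebra.Properties.AbelianGroup +-abelianGroup using (⁻¹-∙-comm)
  open import Algebra.Properties.Semiring.Mult.TCOptimised semiring
    using (1+×; ×-homo-+; ×1-homo-*) renaming (_×_ to _·_)
  open import Relation.Binary.Reasoning.Setoid setoid

  fromℤ : ℤ → Carrier
  fromℤ (+ n)    = n · 1#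
  fromℤ -[1+ n ] = - (suc n · 1#)

  fromℤ-⊖ : ∀ m n → fromℤ (m ℤ.⊖ n) ≈ m · 1# - n · 1#
  fromℤ-⊖ zero    zero    = sym (-‿inverseʳ 0#)
  fromℤ-⊖ zero    (suc n) = sym (+-identityˡ _)
  fromℤ-⊖ (suc m) zero    = sym (trans (+-congˡ -0#≈0#) (+-identityʳ _))
  fromℤ-⊖ (suc m) (suc n) = begin
    fromℤ (suc m ℤ.⊖ suc n)                    ≡⟨ ≡.cong fromℤ (ℤₚ.[1+m]⊖[1+n]≡m⊖n m n) ⟩
    fromℤ (m ℤ.⊖ n)                            ≈⟨ fromℤ-⊖ m n ⟩
    m · 1# - n · 1#                          ≈⟨ +-congˡ (+-identityˡ _) ⟨
    m · 1# + (0# - n · 1#)                   ≈⟨ +-congˡ (+-congʳ (-‿inverseʳ 1#)) ⟨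
    m · 1# + ((1# - 1#) - n · 1#)            ≈⟨ +-congˡ (+-assoc _ _ _) ⟩
    m · 1# + (1# + (- 1# - n · 1#))          ≈⟨ +-assoc _ _ _ ⟨
    (m · 1# + 1#) + (- 1# - n · 1#)          ≈⟨ +-cong (+-comm _ _) (⁻¹-∙-comm _ _) ⟩
    (1# + m · 1#) - (1# + n · 1#)            ≈⟨ +-cong (1+× m 1#) (-‿cong (1+× n 1#)) ⟨
    suc m · 1# - suc n · 1#                  ∎

  fromℤ-neg : ∀ i → fromℤ (ℤ.- i) ≈ - fromℤ i
  fromℤ-neg (+ zero)  = sym -0#≈0#
  fromℤ-neg (+ suc n) = refl
  fromℤ-neg -[1+ n ]  = sym (-‿involutive _)

  fromℤ-+ : ∀ i j → fromℤ (i ℤ.+ j) ≈ fromℤ i + fromℤ j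
  fromℤ-+ (+ m)    (+ n)    = ×-homo-+ 1# m n
  fromℤ-+ (+ m)    -[1+ n ] = fromℤ-⊖ m (suc n)
  fromℤ-+ -[1+ m ] (+ n)    = trans (fromℤ-⊖ n (suc m)) (+-comm _ _)
  fromℤ-+ -[1+ m ] -[1+ n ] = begin
    - (suc (suc (m ℕ.+ n)) · 1#)     ≡⟨ ≡.cong (λ k → - (suc k · 1#)) (ℕₚ.+-suc m n) ⟨
    - ((suc m ℕ.+ suc n) · 1#)       ≈⟨ -‿cong (×-homo-+ 1# (suc m) (suc n)) ⟩
    - (suc m · 1# + suc n · 1#)      ≈⟨ ⁻¹-∙-comm _ _ ⟨
    - (suc m · 1#) - suc n · 1#      ∎

  private
    fromℤ-*⁺ : ∀ m j → fromℤ (+ m ℤ.* j) ≈ m · 1# * fromℤ j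
    fromℤ-*⁺ m (+ n) = begin
      fromℤ (+ m ℤ.* + n)      ≡⟨ ≡.cong fromℤ (ℤₚ.pos-* m n) ⟨
      (m ℕ.* n) · 1#           ≈⟨ ×1-homo-* m n ⟩
      (m · 1#) * (n · 1#)      ∎
    fromℤ-*⁺ m -[1+ n ] = begin
      fromℤ (+ m ℤ.* -[1+ n ])               ≡⟨ ≡.cong fromℤ (ℤₚ.neg-distribʳ-* (+ m) (+ suc n)) ⟨
      fromℤ (ℤ.- (+ m ℤ.* + suc n))          ≈⟨ fromℤ-neg (+ m ℤ.* + suc n) ⟩
      - fromℤ (+ m ℤ.* + suc n)              ≈⟨ -‿cong (fromℤ-*⁺ m (+ suc n)) ⟩
      - (m · 1# * suc n · 1#)                ≈⟨ -‿distribʳ-* _ _ ⟩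
      m · 1# * - (suc n · 1#)                ∎

  fromℤ-* : ∀ i j → fromℤ (i ℤ.* j) ≈ fromℤ i * fromℤ j
  fromℤ-* (+ m)    j = fromℤ-*⁺ m j
  fromℤ-* -[1+ m ] j = begin
    fromℤ (-[1+ m ] ℤ.* j)                 ≡⟨ ≡.cong fromℤ (ℤₚ.neg-distribˡ-* (+ suc m) j) ⟨
    fromℤ (ℤ.- (+ suc m ℤ.* j))            ≈⟨ fromℤ-neg (+ suc m ℤ.* j) ⟩
    - fromℤ (+ suc m ℤ.* j)                ≈⟨ -‿cong (fromℤ-*⁺ (suc m) j) ⟩
    - (suc m · 1# * fromℤ j)               ≈⟨ -‿distribˡ-* _ _ ⟩
    - (suc m · 1#) * fromℤ j               ∎

  -- Equality in the ring is not decidable, but equality of integers is; through this map the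
  -- normaliser can collect like monomials and drop those with coefficient 0.
  fromℤ-morphism : ℤ.+-*-rawRing -Raw-AlmostCommutative⟶ fromCommutativeRing R
  fromℤ-morphism = record
    { ⟦_⟧    = fromℤ
    ; +-homo = fromℤ-+
    ; *-homo = fromℤ-*
    ; -‿homo = fromℤ-neg
    ; 0-homo = refl
    ; 1-homo = refl
    }

  private
    _≟_ : ∀ i j → Maybe (fromℤ i ≈ fromℤ j)
    i ≟ j with i ℤₚ.≟ j
    ... | yes i≡j = just (reflexive (≡.cong fromℤ i≡j))
    ... | no _    = nothing

  open import Algebra.Solver.Ring ℤ.+-*-rawRing (fromCommutativeRing R) fromℤ-morphism _≟_ public
    using (Polynomial; solve; _:=_; _:+_; _:*_; _:-_; :-_; con; _:^_)

-- Finite folds over ranges of ℕ and ℤ, for sums and products alike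

module RangeFold {c ℓ} (M : CommutativeMonoid c ℓ) where
  open CommutativeMonoid M
  open import Algebra.Properties.CommutativeSemigroup commutativeSemigroup using (interchange)
  open import Relation.Binary.Reasoning.Setoid setoid

  fold : (ℕ → Carrier) → ℕ → Carrier
  fold f zero    = ε
  fold f (suc n) = fold f n ∙ f n

  fold-cong< : ∀ {f g} n → (∀ k → k < n → f k ≈ g k) → fold f n ≈ fold g n
  fold-cong< zero    f≈g = refl
  fold-cong< (suc n) f≈g =
    ∙-cong (fold-cong< n λ k k<n → f≈g k (ℕₚ.m<n⇒m<1+n k<n)) (f≈g n (ℕₚ.n<1+n n))

  fold-cong : ∀ {f g} n → (∀ k → f k ≈ g k) → fold f n ≈ fold g n
  fold-cong n f≈g = fold-cong< n λ k _ → f≈g k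

  fold-ε : ∀ {f} n → (∀ k → k < n → f k ≈ ε) → fold f n ≈ ε
  fold-ε zero    f≈ε = refl
  fold-ε (suc n) f≈ε = trans
    (∙-cong (fold-ε n λ k k<n → f≈ε k (ℕₚ.m<n⇒m<1+n k<n)) (f≈ε n (ℕₚ.n<1+n n)))
    (identityˡ ε)

  fold-∙ : ∀ f g n → fold (λ k → f k ∙ g k) n ≈ fold f n ∙ fold g n
  fold-∙ f g zero    = sym (identityˡ ε)
  fold-∙ f g (suc n) = trans (∙-congʳ (fold-∙ f g n)) (interchange _ _ _ _)

  fold-swap : ∀ (f : ℕ → ℕ → Carrier) m n →
              fold (λ i → fold (f i) n) m ≈ fold (λ j → fold (λ i → f i j) m) n
  fold-swap f zero    n = sym (fold-ε n λ _ _ → refl)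
  fold-swap f (suc m) n = trans (∙-congʳ (fold-swap f m n)) (sym (fold-∙ _ _ n))

  fold-suc : ∀ f n → fold f (suc n) ≈ f 0 ∙ fold (f ∘ suc) n
  fold-suc f zero    = comm _ _
  fold-suc f (suc n) = trans (∙-congʳ (fold-suc f n)) (assoc _ _ _)

  fold-+ : ∀ f m n → fold f (m ℕ.+ n) ≈ fold f m ∙ fold (λ k → f (m ℕ.+ k)) n
  fold-+ f m zero    rewrite ℕₚ.+-identityʳ m = sym (identityʳ _)
  fold-+ f m (suc n) rewrite ℕₚ.+-suc m n = trans (∙-congʳ (fold-+ f m n)) (assoc _ _ _)

  fold-blocks : ∀ f n b → fold f (n ℕ.* b) ≈ fold (λ i → fold (λ j → f (i ℕ.* b ℕ.+ j)) b) n
  fold-blocks f zero    b = refl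
  fold-blocks f (suc n) b rewrite ℕₚ.+-comm b (n ℕ.* b) =
    trans (fold-+ f (n ℕ.* b) b) (∙-congʳ (fold-blocks f n b))

  fold-pairs : ∀ f n → fold f (n ℕ.* 2) ≈ fold (λ i → f (i ℕ.* 2) ∙ f (suc (i ℕ.* 2))) n
  fold-pairs f zero    = refl
  fold-pairs f (suc n) = trans (assoc _ _ _) (∙-congʳ (fold-pairs f n))

  fold-stable : ∀ f {m n} → m ≤ n → (∀ k → m ≤ k → f k ≈ ε) → fold f n ≈ fold f m
  fold-stable f {m} {n} m≤n f≈ε = begin
    fold f n                                        ≡⟨ ≡.cong (fold f) (ℕₚ.m+[n∸m]≡n m≤n) ⟨
    fold f (m ℕ.+ (n ℕ.∸ m))                        ≈⟨ fold-+ f m (n ℕ.∸ m) ⟩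
    fold f m ∙ fold (λ k → f (m ℕ.+ k)) (n ℕ.∸ m)   ≈⟨ ∙-congˡ (fold-ε (n ℕ.∸ m) λ k _ → f≈ε (m ℕ.+ k) (ℕₚ.m≤m+n m k)) ⟩
    fold f m ∙ ε                                    ≈⟨ identityʳ _ ⟩
    fold f m                                        ∎

  -- over -L ≤ i < L
  foldℤ : ℕ → (ℤ → Carrier) → Carrier
  foldℤ L f = fold (λ k → f (+ k) ∙ f -[1+ k ]) L

  Supported : ℕ → (ℤ → Carrier) → Set ℓ
  Supported L f = ∀ i → L ≤ ∣ i ∣ → f i ≈ ε

  translate : ℤ → (ℤ → Carrier) → ℤ → Carrier
  translate c f i = f (c ℤ.+ i)

  foldℤ-cong : ∀ {f g} L → (∀ i → f i ≈ g i) → foldℤ L f ≈ foldℤ L g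
  foldℤ-cong L f≈g = fold-cong L λ k → ∙-cong (f≈g _) (f≈g _)

  foldℤ-∙ : ∀ L f g → foldℤ L (λ i → f i ∙ g i) ≈ foldℤ L f ∙ foldℤ L g
  foldℤ-∙ L f g = trans (fold-cong L λ k → interchange _ _ _ _) (fold-∙ _ _ L)

  foldℤ-fold : ∀ L f → foldℤ L f ≈ fold (f ∘ +_) L ∙ fold (f ∘ -[1+_]) L
  foldℤ-fold L f = fold-∙ _ _ L

  foldℤ-swap : ∀ L (f : ℤ → ℤ → Carrier) →
               foldℤ L (λ i → foldℤ L (f i)) ≈ foldℤ L (λ j → foldℤ L (λ i → f i j))
  foldℤ-swap L f = begin
    foldℤ L (λ i → foldℤ L (f i))
      ≈⟨ fold-cong L (λ k → fold-∙ _ _ L) ⟨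
    fold (λ k → fold (λ l → (f (+ k) (+ l) ∙ f (+ k) -[1+ l ]) ∙ (f -[1+ k ] (+ l) ∙ f -[1+ k ] -[1+ l ])) L) L
      ≈⟨ fold-swap _ L L ⟩
    fold (λ l → fold (λ k → (f (+ k) (+ l) ∙ f (+ k) -[1+ l ]) ∙ (f -[1+ k ] (+ l) ∙ f -[1+ k ] -[1+ l ])) L) L
      ≈⟨ fold-cong L (λ l → trans (fold-cong L λ k → interchange _ _ _ _) (fold-∙ _ _ L)) ⟩
    foldℤ L (λ j → foldℤ L (λ i → f i j)) ∎

  foldℤ-stable : ∀ {f L M} → L ≤ M → Supported L f → foldℤ M f ≈ foldℤ L f
  foldℤ-stable {f} L≤M supp = fold-stable _ L≤M λ k L≤k →
    trans (∙-cong (supp _ L≤k) (supp _ (ℕₚ.m≤n⇒m≤1+n L≤k))) (identityˡ ε)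

  private
    -- The range moves from -L ≤ i < L to -L < i ≤ L; the term lost, f (-L), and the term gained, f
    -- L, both vanish by `supp`.
    foldℤ-step : ∀ {f} L → Supported L f → foldℤ L (f ∘ ℤ.suc) ≈ foldℤ L f
    foldℤ-step {f} L supp = begin
      foldℤ L (f ∘ ℤ.suc)                                ≈⟨ foldℤ-fold L (f ∘ ℤ.suc) ⟩
      fold (f ∘ +_ ∘ suc) L ∙ fold (f ∘ ℤ.suc ∘ -[1+_]) L ≈⟨ ∙-congˡ (fold-cong L λ k → reflexive (≡.cong f (suc-neg k))) ⟩
      fold (f ∘ +_ ∘ suc) L ∙ fold neg L                 ≈⟨ ∙-congˡ (identityʳ _) ⟨
      fold (f ∘ +_ ∘ suc) L ∙ (fold neg L ∙ ε)           ≈⟨ ∙-congˡ (∙-congˡ (supp (ℤ.- (+ L)) (ℕₚ.≤-reflexive (≡.sym (ℤₚ.∣-i∣≡∣i∣ (+ L)))))) ⟨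
      fold (f ∘ +_ ∘ suc) L ∙ fold neg (suc L)           ≈⟨ ∙-congˡ (fold-suc neg L) ⟩
      fold (f ∘ +_ ∘ suc) L ∙ (f 0ℤ ∙ fold (f ∘ -[1+_]) L) ≈⟨ assoc _ _ _ ⟨
      (fold (f ∘ +_ ∘ suc) L ∙ f 0ℤ) ∙ fold (f ∘ -[1+_]) L ≈⟨ ∙-congʳ (comm _ _) ⟩
      (f 0ℤ ∙ fold (f ∘ +_ ∘ suc) L) ∙ fold (f ∘ -[1+_]) L ≈⟨ ∙-congʳ (fold-suc (f ∘ +_) L) ⟨
      (fold (f ∘ +_) L ∙ f (+ L)) ∙ fold (f ∘ -[1+_]) L  ≈⟨ ∙-congʳ (∙-congˡ (supp (+ L) ℕₚ.≤-refl)) ⟩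
      (fold (f ∘ +_) L ∙ ε) ∙ fold (f ∘ -[1+_]) L        ≈⟨ ∙-congʳ (identityʳ _) ⟩
      fold (f ∘ +_) L ∙ fold (f ∘ -[1+_]) L              ≈⟨ foldℤ-fold L f ⟨
      foldℤ L f                                          ∎
      where
      neg : ℕ → Carrier
      neg k = f (ℤ.- (+ k))
      suc-neg : ∀ k → ℤ.suc -[1+ k ] ≡ ℤ.- (+ k)
      suc-neg zero    = ≡.refl
      suc-neg (suc k) = ≡.refl

    -- A unit step enlarges the support by at most one, so the window n + L contains all the
    -- intermediate translates.
    foldℤ-shift⁺ : ∀ {f} L n → Supported L f → foldℤ (n ℕ.+ L) (translate (+ n) f) ≈ foldℤ (n ℕ.+ L) f
    foldℤ-shift⁺ {f} L zero supp = foldℤ-cong L λ i → reflexive (≡.cong f (ℤₚ.+-identityˡ i))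
    foldℤ-shift⁺ {f} L (suc n) supp = begin
      foldℤ (suc (n ℕ.+ L)) (translate (+ suc n) f)
        ≈⟨ foldℤ-cong (suc (n ℕ.+ L)) (λ i → reflexive (≡.cong f (rearrange (+ n) i))) ⟩
      foldℤ (suc (n ℕ.+ L)) (translate (+ n) f ∘ ℤ.suc)
        ≈⟨ foldℤ-step (suc (n ℕ.+ L)) (λ i le → supp′ i (ℕₚ.≤-trans (ℕₚ.n≤1+n _) le)) ⟩
      foldℤ (suc (n ℕ.+ L)) (translate (+ n) f)
        ≈⟨ foldℤ-stable (ℕₚ.n≤1+n _) supp′ ⟩
      foldℤ (n ℕ.+ L) (translate (+ n) f)
        ≈⟨ foldℤ-shift⁺ L n supp ⟩
      foldℤ (n ℕ.+ L) f
        ≈⟨ foldℤ-stable (ℕₚ.n≤1+n _) (λ i le → supp i (ℕₚ.≤-trans (ℕₚ.m≤n+m L n) le)) ⟨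
      foldℤ (suc (n ℕ.+ L)) f ∎
      where
      rearrange : ∀ m i → (1ℤ ℤ.+ m) ℤ.+ i ≡ m ℤ.+ (1ℤ ℤ.+ i)
      rearrange = solve-∀
      cancel : ∀ m i → (m ℤ.+ i) ℤ.- m ≡ i
      cancel = solve-∀
      supp′ : Supported (n ℕ.+ L) (translate (+ n) f)
      supp′ i le = supp (+ n ℤ.+ i) (ℕₚ.+-cancelˡ-≤ n _ _ (ℕₚ.≤-trans le
        (≡.subst (λ j → ∣ j ∣ ≤ n ℕ.+ ∣ + n ℤ.+ i ∣) (cancel (+ n) i)
          (ℕₚ.≤-trans (ℤₚ.∣i-j∣≤∣i∣+∣j∣ (+ n ℤ.+ i) (+ n)) (ℕₚ.≤-reflexive (ℕₚ.+-comm _ n))))))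

  -- Only the two end functions have to fit into the window: it is widened for the shift and
  -- narrowed afterwards. For negative c the roles of f and its translate are exchanged.
  foldℤ-shift : ∀ {f} L c → Supported L f → Supported L (translate c f) →
                foldℤ L (translate c f) ≈ foldℤ L f
  foldℤ-shift {f} L (+ n) supp supp′ = begin
    foldℤ L (translate (+ n) f)         ≈⟨ foldℤ-stable (ℕₚ.m≤n+m L n) supp′ ⟨
    foldℤ (n ℕ.+ L) (translate (+ n) f) ≈⟨ foldℤ-shift⁺ L n supp ⟩
    foldℤ (n ℕ.+ L) f                ≈⟨ foldℤ-stable (ℕₚ.m≤n+m L n) supp ⟩
    foldℤ L f                        ∎
  foldℤ-shift {f} L c@(-[1+ m ]) supp supp′ = begin
    foldℤ L g                        ≈⟨ foldℤ-stable (ℕₚ.m≤n+m L n) supp′ ⟨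
    foldℤ (n ℕ.+ L) g                ≈⟨ foldℤ-shift⁺ L n supp′ ⟨
    foldℤ (n ℕ.+ L) (translate (+ n) g) ≈⟨ foldℤ-cong (n ℕ.+ L) (λ i → reflexive (≡.cong f (cancel (+ n) i))) ⟩
    foldℤ (n ℕ.+ L) f                ≈⟨ foldℤ-stable (ℕₚ.m≤n+m L n) supp ⟩
    foldℤ L f                        ∎
    where
    n = suc m
    g = translate c f
    cancel : ∀ m i → ℤ.- m ℤ.+ (m ℤ.+ i) ≡ i
    cancel = solve-∀

  foldℤ-pairs : ∀ L f → foldℤ (L ℕ.* 2) f ≈ foldℤ L (λ i → f (+ 2 ℤ.* i) ∙ f (1ℤ ℤ.+ + 2 ℤ.* i))
  foldℤ-pairs L f = begin
    foldℤ (L ℕ.* 2) f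
      ≈⟨ fold-pairs _ L ⟩
    fold (λ k → (f (+ (k ℕ.* 2)) ∙ f -[1+ k ℕ.* 2 ]) ∙ (f (+ suc (k ℕ.* 2)) ∙ f -[1+ suc (k ℕ.* 2) ])) L
      -- On the negative half the order of the parities is reversed: `-[1+ 2k ]` is odd and the next
      -- index is even, hence the use of `comm`.
      ≈⟨ fold-cong L (λ k → trans (interchange _ _ _ _) (∙-cong (∙-cong (even k) (odd k)) (trans (comm _ _) (∙-cong (even⁻ k) (odd⁻ k))))) ⟩
    foldℤ L (λ i → f (+ 2 ℤ.* i) ∙ f (1ℤ ℤ.+ + 2 ℤ.* i)) ∎
    where
    double : ∀ k → + (k ℕ.* 2) ≡ + 2 ℤ.* + k
    double k = ≡.trans (≡.cong +_ (ℕₚ.*-comm k 2)) (ℤₚ.pos-* 2 k)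
    even : ∀ k → f (+ (k ℕ.* 2)) ≈ f (+ 2 ℤ.* + k)
    even k = reflexive (≡.cong f (double k))
    odd : ∀ k → f (+ suc (k ℕ.* 2)) ≈ f (1ℤ ℤ.+ + 2 ℤ.* + k)
    odd k = reflexive (≡.cong (f ∘ ℤ.suc) (double k))
    double⁻ : ∀ k → -[1+ suc (k ℕ.* 2) ] ≡ + 2 ℤ.* -[1+ k ]
    double⁻ k = ≡.cong -[1+_] (≡.trans (≡.cong suc (≡.trans (ℕₚ.*-comm k 2) ≡.refl)) (≡.sym (ℕₚ.+-suc k (k ℕ.+ 0))))
    even⁻ : ∀ k → f -[1+ suc (k ℕ.* 2) ] ≈ f (+ 2 ℤ.* -[1+ k ])
    even⁻ k = reflexive (≡.cong f (double⁻ k))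
    odd⁻ : ∀ k → f -[1+ k ℕ.* 2 ] ≈ f (1ℤ ℤ.+ + 2 ℤ.* -[1+ k ])
    odd⁻ k = reflexive (≡.cong (f ∘ ℤ.suc) (double⁻ k))

  private
    -- If x and y were both below L, then 1 + x + y would be at most 2L - 1. The spare unit is
    -- needed for the odd class, where 2j = 1 + (m - n).
    *2-split : ∀ L x y → L ℕ.* 2 ≤ suc (x ℕ.+ y) → L ≤ x ⊎ L ≤ y
    *2-split L x y le with L ℕₚ.≤? x | L ℕₚ.≤? y
    ... | yes L≤x | _       = inj₁ L≤x
    ... | no _    | yes L≤y = inj₂ L≤y
    ... | no L≰x  | no L≰y  = contradiction le (ℕₚ.<⇒≱ (ℕₚ.≤-trans
      (ℕₚ.≤-reflexive (≡.cong suc (≡.sym (ℕₚ.+-suc x y))))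
      (ℕₚ.≤-trans (ℕₚ.+-mono-≤ (ℕₚ.≰⇒> L≰x) (ℕₚ.≰⇒> L≰y))
        (ℕₚ.≤-reflexive (≡.trans (≡.cong (L ℕ.+_) (≡.sym (ℕₚ.+-identityʳ L))) (ℕₚ.*-comm 2 L))))))

    ∣2j∣ : ∀ j → ∣ j ∣ ℕ.* 2 ≡ ∣ j ℤ.+ j ∣
    ∣2j∣ j = ≡.trans (≡.sym (ℤₚ.∣i*j∣≡∣i∣*∣j∣ j (+ 2))) (≡.cong ∣_∣ (eq j))
      where
      eq : ∀ j → j ℤ.* + 2 ≡ j ℤ.+ j
      eq = solve-∀

  -- The lattice of pairs (m , n) splits into m + n even, where (m , n) = (i + j , i - j),
  -- and m + n odd, where (m , n) = (i + j , 1 + i - j).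
  module _ {L} (g : ℤ → ℤ → Carrier)
           (suppˡ : ∀ m n → L ≤ ∣ m ∣ → g m n ≈ ε) (suppʳ : ∀ m n → L ≤ ∣ n ∣ → g m n ≈ ε) where

    private
      zero-if : ∀ m n → L ≤ ∣ m ∣ ⊎ L ≤ ∣ n ∣ → g m n ≈ ε
      zero-if m n (inj₁ le) = suppˡ m n le
      zero-if m n (inj₂ le) = suppʳ m n le

      even odd : ℤ → ℤ → Carrier
      even i j = g (i ℤ.+ j) (i ℤ.- j)
      odd i j  = g (i ℤ.+ j) (1ℤ ℤ.+ (i ℤ.- j))

      diagonal : ℤ → ℤ → Carrier
      diagonal j s = g j (s ℤ.- j)

      even-diagonal : ∀ i j → even i j ≈ diagonal (i ℤ.+ j) (+ 2 ℤ.* i)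
      even-diagonal i j = reflexive (≡.cong (g (i ℤ.+ j)) (eq i j))
        where
        eq : ∀ i j → i ℤ.- j ≡ + 2 ℤ.* i ℤ.- (i ℤ.+ j)
        eq = solve-∀

      odd-diagonal : ∀ i j → odd i j ≈ diagonal (i ℤ.+ j) (1ℤ ℤ.+ + 2 ℤ.* i)
      odd-diagonal i j = reflexive (≡.cong (g (i ℤ.+ j)) (eq i j))
        where
        eq : ∀ i j → 1ℤ ℤ.+ (i ℤ.- j) ≡ (1ℤ ℤ.+ + 2 ℤ.* i) ℤ.- (i ℤ.+ j)
        eq = solve-∀

      even-supp : ∀ i → Supported L (even i)
      even-supp i j L≤j = zero-if (i ℤ.+ j) (i ℤ.- j) (*2-split L ∣ i ℤ.+ j ∣ ∣ i ℤ.- j ∣ (ℕₚ.m≤n⇒m≤1+n (ℕₚ.≤-trans (ℕₚ.*-monoˡ-≤ 2 L≤j)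
        (≡.subst (_≤ ∣ i ℤ.+ j ∣ ℕ.+ ∣ i ℤ.- j ∣) (≡.trans (≡.cong ∣_∣ (eq i j)) (≡.sym (∣2j∣ j)))
          (ℤₚ.∣i-j∣≤∣i∣+∣j∣ (i ℤ.+ j) (i ℤ.- j))))))
        where
        eq : ∀ i j → (i ℤ.+ j) ℤ.- (i ℤ.- j) ≡ j ℤ.+ j
        eq = solve-∀

      odd-supp : ∀ i → Supported L (odd i)
      odd-supp i j L≤j = zero-if (i ℤ.+ j) (1ℤ ℤ.+ (i ℤ.- j))
        (*2-split L ∣ i ℤ.+ j ∣ ∣ 1ℤ ℤ.+ (i ℤ.- j) ∣ (ℕₚ.≤-trans (ℕₚ.*-monoˡ-≤ 2 L≤j)
        (≡.subst (_≤ suc (∣ i ℤ.+ j ∣ ℕ.+ ∣ 1ℤ ℤ.+ (i ℤ.- j) ∣)) (≡.trans (≡.cong ∣_∣ (eq i j)) (≡.sym (∣2j∣ j)))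
          (ℕₚ.≤-trans (ℤₚ.∣i+j∣≤∣i∣+∣j∣ 1ℤ ((i ℤ.+ j) ℤ.- (1ℤ ℤ.+ (i ℤ.- j)))) (s≤s (ℤₚ.∣i-j∣≤∣i∣+∣j∣ (i ℤ.+ j) (1ℤ ℤ.+ (i ℤ.- j))))))))
        where
        eq : ∀ i j → 1ℤ ℤ.+ ((i ℤ.+ j) ℤ.- (1ℤ ℤ.+ (i ℤ.- j))) ≡ j ℤ.+ j
        eq = solve-∀

      row : ∀ (f : ℤ → ℤ → Carrier) c i → (∀ j → f i j ≈ diagonal (i ℤ.+ j) c) → Supported L (f i) →
            foldℤ L (f i) ≈ foldℤ L (λ j → diagonal j c)
      row f c i f≈ supp = trans (foldℤ-cong {f i} {translate i (λ j → diagonal j c)} L f≈)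
        (foldℤ-shift {λ j → diagonal j c} L i (λ j L≤j → suppˡ j (c ℤ.- j) L≤j) (λ j L≤j → trans (sym (f≈ j)) (supp j L≤j)))

      column : ∀ j → foldℤ (L ℕ.* 2) (diagonal j) ≈ foldℤ L (g j)
      column j = begin
        foldℤ (L ℕ.* 2) (diagonal j)                 ≈⟨ foldℤ-cong
            {diagonal j} {translate (ℤ.- j) (g j)} (L ℕ.* 2) (λ s → reflexive (≡.cong (g j) (ℤₚ.+-comm s (ℤ.- j)))) ⟩
        foldℤ (L ℕ.* 2) (translate (ℤ.- j) (g j))    ≈⟨ foldℤ-shift (L ℕ.* 2) (ℤ.- j) (λ n le → suppʳ j n (ℕₚ.≤-trans L≤2L le)) supp ⟩
        foldℤ (L ℕ.* 2) (g j)                        ≈⟨ foldℤ-stable L≤2L (λ n → suppʳ j n) ⟩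
        foldℤ L (g j)                                ∎
        where
        L≤2L : L ≤ L ℕ.* 2
        L≤2L = ℕₚ.m≤m*n L 2
        eq : ∀ j s → j ℤ.+ (ℤ.- j ℤ.+ s) ≡ s
        eq = solve-∀
        supp : Supported (L ℕ.* 2) (translate (ℤ.- j) (g j))
        supp s le = zero-if j (ℤ.- j ℤ.+ s) (*2-split L ∣ j ∣ ∣ ℤ.- j ℤ.+ s ∣ (ℕₚ.m≤n⇒m≤1+n (ℕₚ.≤-trans le
          (≡.subst (λ k → ∣ k ∣ ≤ ∣ j ∣ ℕ.+ ∣ ℤ.- j ℤ.+ s ∣) (eq j s) (ℤₚ.∣i+j∣≤∣i∣+∣j∣ j (ℤ.- j ℤ.+ s))))))

    -- Each class is summed along antidiagonals m + n = s, with s = 2i or s = 1 + 2i: a shift makes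
    -- the first coordinate the summation variable. After exchanging the sums, both parities of s
    -- join in one window of twice the length, and a second shift turns the sum over s into the sum
    -- over n.
    foldℤ²-parity : foldℤ L (λ m → foldℤ L (g m)) ≈
      foldℤ L (λ i → foldℤ L (λ j → g (i ℤ.+ j) (i ℤ.- j))) ∙
      foldℤ L (λ i → foldℤ L (λ j → g (i ℤ.+ j) (1ℤ ℤ.+ (i ℤ.- j))))
    foldℤ²-parity = sym (begin
      foldℤ L (λ i → foldℤ L (even i)) ∙ foldℤ L (λ i → foldℤ L (odd i))
        ≈⟨ ∙-cong (foldℤ-cong L λ i → row even (+ 2 ℤ.* i) i (even-diagonal i) (even-supp i))
                  (foldℤ-cong L λ i → row odd (1ℤ ℤ.+ + 2 ℤ.* i) i (odd-diagonal i) (odd-supp i)) ⟩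
      foldℤ L (λ i → foldℤ L (λ j → diagonal j (+ 2 ℤ.* i))) ∙
      foldℤ L (λ i → foldℤ L (λ j → diagonal j (1ℤ ℤ.+ + 2 ℤ.* i)))
        ≈⟨ ∙-cong (foldℤ-swap L λ i j → diagonal j (+ 2 ℤ.* i)) (foldℤ-swap L λ i j → diagonal j (1ℤ ℤ.+ + 2 ℤ.* i)) ⟩
      foldℤ L (λ j → foldℤ L (λ i → diagonal j (+ 2 ℤ.* i))) ∙
      foldℤ L (λ j → foldℤ L (λ i → diagonal j (1ℤ ℤ.+ + 2 ℤ.* i)))
        ≈⟨ foldℤ-∙ L (λ j → foldℤ L (λ i → diagonal j (+ 2 ℤ.* i)))
             (λ j → foldℤ L (λ i → diagonal j (1ℤ ℤ.+ + 2 ℤ.* i))) ⟨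
      foldℤ L (λ j → foldℤ L (λ i → diagonal j (+ 2 ℤ.* i)) ∙ foldℤ L (λ i → diagonal j (1ℤ ℤ.+ + 2 ℤ.* i)))
        ≈⟨ foldℤ-cong L (λ j → trans
             (sym (foldℤ-∙ L (λ i → diagonal j (+ 2 ℤ.* i)) (λ i → diagonal j (1ℤ ℤ.+ + 2 ℤ.* i)))) (sym (foldℤ-pairs L (diagonal j)))) ⟩
      foldℤ L (λ j → foldℤ (L ℕ.* 2) (diagonal j))
        ≈⟨ foldℤ-cong L column ⟩
      foldℤ L (λ j → foldℤ L (g j)) ∎)

module Summation {c ℓ} (R : CommutativeRing c ℓ) where
  open CommutativeRing R
  module Sum = RangeFold +-commutativeMonoid
  module Product = RangeFold *-commutativeMonoid
  open Sum using (foldℤ) renaming (fold to sum)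

  sum-*ˡ : ∀ x f n → x * sum f n ≈ sum (λ k → x * f k) n
  sum-*ˡ x f zero    = zeroʳ x
  sum-*ˡ x f (suc n) = trans (distribˡ _ _ _) (+-congʳ (sum-*ˡ x f n))

  sumℤ-*ˡ : ∀ x f L → x * foldℤ L f ≈ foldℤ L (λ i → x * f i)
  sumℤ-*ˡ x f L = trans (sum-*ˡ x _ L) (Sum.fold-cong L λ k → distribˡ _ _ _)

  sumℤ-product : ∀ f g L → foldℤ L f * foldℤ L g ≈ foldℤ L (λ i → foldℤ L (λ j → f i * g j))
  sumℤ-product f g L = trans (*-comm _ _) (trans (sumℤ-*ˡ _ f L)
    (Sum.foldℤ-cong L λ i → trans (*-comm _ _) (sumℤ-*ˡ (f i) g L)))

-- A finite Jacobi triple product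

module TripleProduct {c ℓ} (R : CommutativeRing c ℓ) (Q : CommutativeRing.Carrier R) where
  open CommutativeRing R
  open import Algebra.Properties.Ring ring using (-0#≈0#)
  open import Algebra.Properties.Semiring.Exp semiring using (_^_; ^-homo-*; ^-congʳ)
  open import Relation.Binary.Reasoning.Setoid setoid
  open IntegerSolver R
  open Summation R
  open Sum using () renaming (fold to sum)
  open Product using () renaming (fold to product)

  -- The Gaussian binomial coefficient [2K choose K+k].
  coeff : ℕ → ℕ → Carrier
  coeff zero    zero    = 1#
  coeff zero    (suc k) = 0#
  coeff (suc K) zero    =
    (1# + Q * (Q ^ K * Q ^ K)) * coeff K 0 + Q * Q ^ K * coeff K 1 + Q * Q ^ K * coeff K 1
  coeff (suc K) (suc k) =
    (1# + Q * (Q ^ K * Q ^ K)) * coeff K (suc k) + Q ^ (K ∸ k) * coeff K k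
    + Q * Q * Q ^ (K ℕ.+ k) * coeff K (suc (suc k))

  coeff-zero : ∀ {K k} → K < k → coeff K k ≈ 0#
  coeff-zero {zero}  {suc k} _         = refl
  coeff-zero {suc K} {suc k} (s≤s K<k) = trans
    (+-cong (+-cong (*-congˡ (coeff-zero (ℕₚ.m<n⇒m<1+n K<k))) (*-congˡ (coeff-zero K<k)))
            (*-congˡ (coeff-zero (ℕₚ.m<n⇒m<1+n (ℕₚ.m<n⇒m<1+n K<k)))))
    (trans (+-cong (+-cong (zeroʳ _) (zeroʳ _)) (zeroʳ _))
           (trans (+-congʳ (+-identityˡ _)) (+-identityˡ _)))

  private
    ratio-step : ∀ a b x₀ x₁ x₂ x₃ →
      (1# - b) * x₁ ≈ (1# - Q * a) * x₀ →
      (1# - Q * b) * x₂ ≈ (1# - a) * x₁ →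
      Q * ((1# - Q * Q * b) * x₃) ≈ (Q - a) * x₂ →
      (1# - Q * Q * b) * ((1# + Q * (a * b)) * x₂ + a * x₁ + Q * Q * b * x₃)
        ≈ (1# - Q * a) * ((1# + Q * (a * b)) * x₁ + Q * a * x₀ + Q * b * x₂)
    ratio-step a b x₀ x₁ x₂ x₃ h₁ h₂ h₃ = begin
      (1# - Q * Q * b) * ((1# + Q * (a * b)) * x₂ + a * x₁ + Q * Q * b * x₃)
        ≈⟨ solve 6 (λ Q a b x₁ x₂ x₃ → let 𝟙 = con 1ℤ in
             (𝟙 :- Q :* Q :* b) :* ((𝟙 :+ Q :* (a :* b)) :* x₂ :+ a :* x₁ :+ Q :* Q :* b :* x₃)
             := (𝟙 :- Q :* Q :* b) :* ((𝟙 :+ Q :* (a :* b)) :* x₂ :+ a :* x₁)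
                :+ Q :* b :* (Q :* ((𝟙 :- Q :* Q :* b) :* x₃)))
             refl Q a b x₁ x₂ x₃ ⟩
      (1# - Q * Q * b) * ((1# + Q * (a * b)) * x₂ + a * x₁) + Q * b * (Q * ((1# - Q * Q * b) * x₃))
        ≈⟨ +-congˡ (*-congˡ h₃) ⟩
      (1# - Q * Q * b) * ((1# + Q * (a * b)) * x₂ + a * x₁) + Q * b * ((Q - a) * x₂)
        ≈⟨ solve 5 (λ Q a b x₁ x₂ → let 𝟙 = con 1ℤ in
             (𝟙 :- Q :* Q :* b) :* ((𝟙 :+ Q :* (a :* b)) :* x₂ :+ a :* x₁) :+ Q :* b :* ((Q :- a) :* x₂)
             := (𝟙 :- Q :* Q :* b) :* (a :* x₁) :+ Q :* b :* (𝟙 :- Q :* a) :* x₂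
                :+ (𝟙 :+ Q :* Q :* (a :* b)) :* ((𝟙 :- Q :* b) :* x₂))
             refl Q a b x₁ x₂ ⟩
      (1# - Q * Q * b) * (a * x₁) + Q * b * (1# - Q * a) * x₂
        + (1# + Q * Q * (a * b)) * ((1# - Q * b) * x₂)
        ≈⟨ +-congˡ (*-congˡ h₂) ⟩
      (1# - Q * Q * b) * (a * x₁) + Q * b * (1# - Q * a) * x₂
        + (1# + Q * Q * (a * b)) * ((1# - a) * x₁)
        ≈⟨ solve 5 (λ Q a b x₁ x₂ → let 𝟙 = con 1ℤ in
             (𝟙 :- Q :* Q :* b) :* (a :* x₁) :+ Q :* b :* (𝟙 :- Q :* a) :* x₂
                :+ (𝟙 :+ Q :* Q :* (a :* b)) :* ((𝟙 :- a) :* x₁)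
             := (𝟙 :- Q :* a) :* ((𝟙 :+ Q :* (a :* b)) :* x₁ :+ Q :* b :* x₂)
                :+ Q :* a :* ((𝟙 :- b) :* x₁))
             refl Q a b x₁ x₂ ⟩
      (1# - Q * a) * ((1# + Q * (a * b)) * x₁ + Q * b * x₂) + Q * a * ((1# - b) * x₁)
        ≈⟨ +-congˡ (*-congˡ h₁) ⟩
      (1# - Q * a) * ((1# + Q * (a * b)) * x₁ + Q * b * x₂) + Q * a * ((1# - Q * a) * x₀)
        ≈⟨ solve 6 (λ Q a b x₀ x₁ x₂ → let 𝟙 = con 1ℤ in
             (𝟙 :- Q :* a) :* ((𝟙 :+ Q :* (a :* b)) :* x₁ :+ Q :* b :* x₂)
                :+ Q :* a :* ((𝟙 :- Q :* a) :* x₀)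
             := (𝟙 :- Q :* a) :* ((𝟙 :+ Q :* (a :* b)) :* x₁ :+ Q :* a :* x₀ :+ Q :* b :* x₂))
             refl Q a b x₀ x₁ x₂ ⟩
      (1# - Q * a) * ((1# + Q * (a * b)) * x₁ + Q * a * x₀ + Q * b * x₂) ∎

    ^-∸ : ∀ {K k} → k < K → Q ^ (K ∸ k) ≈ Q * Q ^ (K ∸ suc k)
    ^-∸ {K} {k} k<K = ^-congʳ Q (ℕₚ.+-∸-assoc 1 k<K)

    ^-∸-+ : ∀ {K k} → k ≤ K → Q ^ (K ∸ k) * Q ^ (K ℕ.+ k) ≈ Q ^ K * Q ^ K
    ^-∸-+ {K} {k} k≤K = begin
      Q ^ (K ∸ k) * Q ^ (K ℕ.+ k)       ≈⟨ *-congˡ (^-homo-* Q K k) ⟩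
      Q ^ (K ∸ k) * (Q ^ K * Q ^ k)     ≈⟨ solve 3 (λ x y z → x :* (y :* z) := y :* (x :* z)) refl _ _ _ ⟩
      Q ^ K * (Q ^ (K ∸ k) * Q ^ k)     ≈⟨ *-congˡ (^-homo-* Q (K ∸ k) k) ⟨
      Q ^ K * Q ^ (K ∸ k ℕ.+ k)         ≡⟨ ≡.cong (λ n → Q ^ K * Q ^ n) (ℕₚ.m∸n+n≡m k≤K) ⟩
      Q ^ K * Q ^ K                     ∎

    -- The factor Q replaces a division: Q^(K ∸ k) is Q times Q^(K ∸ suc k) only for k < K. At k = K
    -- both sides vanish, since the coefficients lie outside the range.
    Q*coeff : ∀ K k → Q * ((1# - Q * Q ^ (K ℕ.+ suc k)) * coeff K (suc (suc k)))
              ≈ Q * ((1# - Q ^ (K ∸ suc k)) * coeff K (suc k)) →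
              k ≤ K →
              Q * ((1# - Q * Q * Q ^ (K ℕ.+ k)) * coeff K (suc (suc k)))
              ≈ (Q - Q ^ (K ∸ k)) * coeff K (suc k)
    Q*coeff K k h k≤K with ℕₚ.m≤n⇒m<n∨m≡n k≤K
    ... | inj₁ k<K = begin
      Q * ((1# - Q * Q * Q ^ (K ℕ.+ k)) * coeff K (suc (suc k)))
        ≈⟨ *-congˡ (*-congʳ (+-congˡ (-‿cong (trans (*-assoc _ _ _) (*-congˡ (^-congʳ Q (≡.sym (ℕₚ.+-suc K k)))))))) ⟩
      Q * ((1# - Q * Q ^ (K ℕ.+ suc k)) * coeff K (suc (suc k)))
        ≈⟨ h ⟩
      Q * ((1# - Q ^ (K ∸ suc k)) * coeff K (suc k))
        ≈⟨ solve 3 (λ Q x y → Q :* ((con 1ℤ :- x) :* y) := (Q :- Q :* x) :* y) refl Q _ _ ⟩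
      (Q - Q * Q ^ (K ∸ suc k)) * coeff K (suc k)
        ≈⟨ *-congʳ (+-congˡ (-‿cong (^-∸ k<K))) ⟨
      (Q - Q ^ (K ∸ k)) * coeff K (suc k) ∎
    ... | inj₂ ≡.refl = trans
      (*-congˡ (trans (*-congˡ (coeff-zero (ℕₚ.m<n⇒m<1+n (ℕₚ.n<1+n k)))) (zeroʳ _)))
      (trans (zeroʳ Q) (sym (trans (*-congˡ (coeff-zero (ℕₚ.n<1+n k))) (zeroʳ _))))

  -- The quotient of neighbouring Gaussian binomials in cross-multiplied form. `coeff` is defined by
  -- a recurrence free of division, so the ratio has to be recovered by induction on K.
  coeff-ratio : ∀ K k → (1# - Q * Q ^ (K ℕ.+ k)) * coeff K (suc k) ≈ (1# - Q ^ (K ∸ k)) * coeff K k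
  coeff-ratio K k with k ℕₚ.<? K
  coeff-ratio K k | no k≮K = trans
    (trans (*-congˡ (coeff-zero (s≤s (ℕₚ.≮⇒≥ k≮K)))) (zeroʳ _))
    (sym (trans (*-congʳ (trans (+-congˡ (-‿cong (^-congʳ Q (ℕₚ.m≤n⇒m∸n≡0 (ℕₚ.≮⇒≥ k≮K))))) (-‿inverseʳ 1#))) (zeroˡ _)))
  coeff-ratio (suc K) zero | yes _ = begin
    (1# - Q * Q ^ (suc K ℕ.+ 0)) * coeff (suc K) 1
      ≈⟨ *-cong (+-congˡ (-‿cong Qb)) (+-cong (+-congʳ (*-congʳ (+-congˡ (*-congˡ refl)))) (*-congʳ (*-congˡ b≈))) ⟩
    (1# - Q * Q * Q ^ K) * ((1# + Q * (Q ^ K * Q ^ K)) * coeff K 1 + Q ^ K * coeff K 0 + Q * Q * Q ^ K * coeff K 2)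
      -- The coefficients are symmetric about the centre: the left neighbour of `coeff K 0` is
      -- `coeff K 1` again, and h read backwards is the first ratio.
      ≈⟨ ratio-step (Q ^ K) (Q ^ K) (coeff K 1) (coeff K 0) (coeff K 1) (coeff K 2)
           (sym h) h (trans (*-congˡ (*-congʳ (+-congˡ (-‿cong (*-congˡ (sym b≈)))))) (Q*coeff K 0 (*-congˡ (coeff-ratio K 1)) z≤n)) ⟩
    (1# - Q * Q ^ K) * ((1# + Q * (Q ^ K * Q ^ K)) * coeff K 0 + Q * Q ^ K * coeff K 1 + Q * Q ^ K * coeff K 1) ∎
    where
    b≈ : Q ^ (K ℕ.+ 0) ≈ Q ^ K
    b≈ = ^-congʳ Q (ℕₚ.+-identityʳ K)
    Qb : Q * (Q * Q ^ (K ℕ.+ 0)) ≈ Q * Q * Q ^ K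
    Qb = trans (sym (*-assoc _ _ _)) (*-congˡ b≈)
    h : (1# - Q * Q ^ K) * coeff K 1 ≈ (1# - Q ^ K) * coeff K 0
    h = trans (*-congʳ (+-congˡ (-‿cong (*-congˡ (sym b≈))))) (coeff-ratio K 0)
  coeff-ratio (suc K) (suc k) | yes (s≤s k<K) = begin
    (1# - Q * (Q * Q ^ (K ℕ.+ suc k))) * coeff (suc K) (suc (suc k))
      ≈⟨ *-cong (+-congˡ (-‿cong (sym (*-assoc _ _ _)))) (+-congʳ (+-congʳ (*-congʳ (+-congˡ (*-congˡ (sym (^-∸-+ k<K))))))) ⟩
    (1# - Q * Q * b) * ((1# + Q * (a * b)) * coeff K (suc (suc k)) + a * coeff K (suc k) + Q * Q * b * coeff K (suc (suc (suc k))))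
      ≈⟨ ratio-step a b (coeff K k) (coeff K (suc k)) (coeff K (suc (suc k))) (coeff K (suc (suc (suc k))))
           h₁ (coeff-ratio K (suc k)) (Q*coeff K (suc k) (*-congˡ (coeff-ratio K (suc (suc k)))) k<K) ⟩
    (1# - Q * a) * ((1# + Q * (a * b)) * coeff K (suc k) + Q * a * coeff K k + Q * b * coeff K (suc (suc k)))
      ≈⟨ *-cong (+-congˡ (-‿cong (sym (^-∸ k<K))))
           (+-cong (+-cong (*-congʳ (+-congˡ (*-congˡ (^-∸-+ k<K)))) (*-congʳ (sym (^-∸ k<K))))
                   (*-congʳ (trans (*-congˡ (^-congʳ Q (ℕₚ.+-suc K k))) (sym (*-assoc _ _ _))))) ⟩
    (1# - Q ^ (K ∸ k)) * coeff (suc K) (suc k) ∎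
    where
    a = Q ^ (K ∸ suc k)
    b = Q ^ (K ℕ.+ suc k)
    h₁ : (1# - b) * coeff K (suc k) ≈ (1# - Q * a) * coeff K k
    h₁ = trans (*-congʳ (+-congˡ (-‿cong (^-congʳ Q (ℕₚ.+-suc K k)))))
           (trans (coeff-ratio K k) (*-congʳ (+-congˡ (-‿cong (^-∸ k<K)))))

  module _ {N} (Q^-zero : ∀ m → N ≤ m → Q ^ m ≈ 0#) where

    -- Both factors in `coeff-ratio` are 1 here, because their exponents K + k + 1 and K - k are at
    -- least N.
    coeff-constant : ∀ {K} k → k ℕ.+ N ≤ K → coeff K k ≈ coeff K 0
    coeff-constant zero    _  = refl
    coeff-constant {K} (suc k) le = begin
      coeff K (suc k)                             ≈⟨ unit (ℕₚ.≤-trans N≤ (ℕₚ.≤-trans (ℕₚ.m≤m+n K k) (ℕₚ.n≤1+n _))) ⟨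
      (1# - Q ^ suc (K ℕ.+ k)) * coeff K (suc k)  ≈⟨ coeff-ratio K k ⟩
      (1# - Q ^ (K ∸ k)) * coeff K k              ≈⟨ unit (ℕₚ.m+n≤o⇒m≤o∸n N (≡.subst (_≤ K) (ℕₚ.+-comm k N) k+N≤K)) ⟩
      coeff K k                                   ≈⟨ coeff-constant k k+N≤K ⟩
      coeff K 0                                   ∎
      where
      k+N≤K = ℕₚ.≤-trans (ℕₚ.n≤1+n _) le
      N≤ : N ≤ K
      N≤ = ℕₚ.≤-trans (ℕₚ.m≤n+m N (suc k)) le
      unit : ∀ {m x} → N ≤ m → (1# - Q ^ m) * x ≈ x
      unit {m} {x} N≤m = trans (*-congʳ (trans (+-congˡ (trans (-‿cong (Q^-zero m N≤m)) -0#≈0#)) (+-identityʳ 1#))) (*-identityˡ x)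

  module _ (z w : Carrier) (zw≈Q : z * w ≈ Q) where

    -- These are (-1)^k Q^(k(k-1)/2) times z^k and w^k. With w in the role of Q / z, `neg k` is the
    -- term of index -k of the bilateral series, and z need not be invertible.
    pos neg : ℕ → Carrier
    pos zero    = 1#
    pos (suc k) = - (z * Q ^ k) * pos k
    neg zero    = 1#
    neg (suc k) = - (w * Q ^ k) * neg k

    -- The terms of index k and -k taken together; the central term counts once, hence the separate
    -- value at 0.
    pair : ℕ → Carrier
    pair zero    = 1#
    pair (suc k) = pos (suc k) + neg (suc k)

    finiteTriple : ℕ → Carrier
    finiteTriple = product (λ n → (1# - z * Q ^ n) * (1# - w * Q ^ n))

    private
      -- Multiplication by z + w moves an index up by one and, through z w = Q, down by one. For k =
      -- 0 the indices 1 and -1 both arrive at the centre, so `pos k + neg k`, with value 2 there,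
      -- stands in place of `pair k`.
      pair-rec : ∀ k → Q ^ suc k * (z + w) * pair (suc k)
                 ≈ - (pair (suc (suc k)) + Q ^ suc k * Q ^ suc k * (pos k + neg k))
      pair-rec k = begin
        Q * q * (z + w) * (- (z * q) * pos k + - (w * q) * neg k)
          ≈⟨ solve 6 (λ Q q z w u v →
               Q :* q :* (z :+ w) :* (:- (z :* q) :* u :+ :- (w :* q) :* v)
               := :- ((:- (z :* (Q :* q)) :* (:- (z :* q) :* u) :+ :- (w :* (Q :* q)) :* (:- (w :* q) :* v))
                      :+ (z :* w) :* Q :* q :* q :* (u :+ v)))
               refl Q q z w (pos k) (neg k) ⟩
        - (pair (suc (suc k)) + z * w * Q * q * q * (pos k + neg k))
          ≈⟨ -‿cong (+-congˡ (*-congʳ (trans (*-congʳ (*-congʳ (*-congʳ zw≈Q)))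
               (solve 2 (λ Q q → Q :* Q :* q :* q := Q :* q :* (Q :* q)) refl Q q)))) ⟩
        - (pair (suc (suc k)) + Q * q * (Q * q) * (pos k + neg k)) ∎
        where q = Q ^ k

      Q^∸ : ∀ K k → Q ^ K * coeff K k ≈ Q ^ (K ∸ k) * Q ^ k * coeff K k
      Q^∸ K k with k ℕₚ.≤? K
      ... | yes k≤K = *-congʳ (trans (^-congʳ Q (≡.sym (ℕₚ.m∸n+n≡m k≤K))) (^-homo-* Q (K ∸ k) k))
      ... | no k≰K  = trans (*-congˡ c≈0) (trans (zeroʳ _) (sym (trans (*-congˡ c≈0) (zeroʳ _))))
        where c≈0 = coeff-zero {K} {k} (ℕₚ.≰⇒> k≰K)

      -- In the product of the expansion for K with -Q^K (z + w), `up` and `down` are what reaches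
      -- `pair (suc k)` from the smaller and from the larger index, and `down₀` is what reaches the
      -- centre. They match the summands in the recurrence of `coeff`.
      up : ℕ → ℕ → Carrier
      up K k = Q ^ (K ∸ k) * coeff K k * pair (suc k)

      down : ℕ → ℕ → Carrier
      down K k = Q * Q * Q ^ (K ℕ.+ k) * coeff K (suc (suc k)) * pair (suc k)

      down₀ : ℕ → Carrier
      down₀ K = Q * Q ^ K * coeff K 1 + Q * Q ^ K * coeff K 1

      cross : ℕ → ℕ → Carrier
      cross K k = - (Q ^ K * (z + w)) * (coeff K k * pair k)

      cross-suc : ∀ K k → cross K (suc k) ≈ up K (suc k) + Q ^ K * Q ^ suc k * coeff K (suc k) * (pos k + neg k)
      cross-suc K k = begin
        - (Q ^ K * (z + w)) * (coeff K (suc k) * pair (suc k))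
          ≈⟨ solve 4 (λ x y c h → :- (x :* y) :* (c :* h) := :- (x :* c :* (y :* h))) refl _ _ _ _ ⟩
        - (Q ^ K * coeff K (suc k) * ((z + w) * pair (suc k)))
          ≈⟨ -‿cong (*-congʳ (Q^∸ K (suc k))) ⟩
        - (a * Q ^ suc k * coeff K (suc k) * ((z + w) * pair (suc k)))
          ≈⟨ solve 5 (λ a q c y h → :- (a :* q :* c :* (y :* h)) := :- (a :* c) :* (q :* y :* h)) refl _ _ _ _ _ ⟩
        - (a * coeff K (suc k)) * (Q ^ suc k * (z + w) * pair (suc k))
          ≈⟨ *-congˡ (pair-rec k) ⟩
        - (a * coeff K (suc k)) * - (pair (suc (suc k)) + Q ^ suc k * Q ^ suc k * (pos k + neg k))
          ≈⟨ solve 5 (λ a c h q s → :- (a :* c) :* :- (h :+ q :* q :* s) := a :* c :* h :+ a :* q :* c :* (q :* s)) refl _ _ _ _ _ ⟩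
        up K (suc k) + a * Q ^ suc k * coeff K (suc k) * (Q ^ suc k * (pos k + neg k))
          ≈⟨ +-congˡ (*-congʳ (Q^∸ K (suc k))) ⟨
        up K (suc k) + Q ^ K * coeff K (suc k) * (Q ^ suc k * (pos k + neg k))
          ≈⟨ +-congˡ (solve 4 (λ x c q s → x :* c :* (q :* s) := x :* q :* c :* s) refl _ _ _ _) ⟩
        up K (suc k) + Q ^ K * Q ^ suc k * coeff K (suc k) * (pos k + neg k) ∎
        where a = Q ^ (K ∸ suc k)

      cross-0 : ∀ K → cross K 0 ≈ up K 0
      cross-0 K = solve 4 (λ x z w c → let 𝟙 = con 1ℤ in
        :- (x :* (z :+ w)) :* (c :* 𝟙) := x :* c :* (:- (z :* 𝟙) :* 𝟙 :+ :- (w :* 𝟙) :* 𝟙)) refl _ z w _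

      cross-1 : ∀ K → cross K 1 ≈ up K 1 + down₀ K
      cross-1 K = trans (cross-suc K 0) (+-congˡ (solve 3 (λ x Q c → let 𝟙 = con 1ℤ in
        x :* (Q :* 𝟙) :* c :* (𝟙 :+ 𝟙) := Q :* x :* c :+ Q :* x :* c) refl _ Q _))

      cross-2+ : ∀ K k → cross K (suc (suc k)) ≈ up K (suc (suc k)) + down K k
      cross-2+ K k = trans (cross-suc K (suc k)) (+-congˡ (*-congʳ (*-congʳ (begin
        Q ^ K * (Q * (Q * Q ^ k))   ≈⟨ solve 3 (λ x Q y → x :* (Q :* (Q :* y)) := Q :* Q :* (x :* y)) refl _ Q _ ⟩
        Q * Q * (Q ^ K * Q ^ k)     ≈⟨ *-congˡ (^-homo-* Q K k) ⟨
        Q * Q * Q ^ (K ℕ.+ k)       ∎))))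

      up-zero : ∀ {K k} → K < k → up K k ≈ 0#
      up-zero K<k = trans (*-congʳ (trans (*-congˡ (coeff-zero K<k)) (zeroʳ _))) (zeroˡ _)

      sum-cross : ∀ {K n} → K < n → sum (cross K) (suc (suc n)) ≈ down₀ K + sum (λ k → up K k + down K k) n
      sum-cross {K} {n} K<n = begin
        sum (cross K) (suc (suc n))
          ≈⟨ Sum.fold-suc (cross K) (suc n) ⟩
        cross K 0 + sum (cross K ∘ suc) (suc n)
          ≈⟨ +-cong (cross-0 K) (Sum.fold-suc (cross K ∘ suc) n) ⟩
        up K 0 + (cross K 1 + sum (cross K ∘ suc ∘ suc) n)
          ≈⟨ +-congˡ (+-cong (cross-1 K) (trans (Sum.fold-cong n (cross-2+ K)) (Sum.fold-∙ _ _ n))) ⟩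
        up K 0 + (up K 1 + down₀ K + (sum (up K ∘ suc ∘ suc) n + sum (down K) n))
          ≈⟨ solve 5 (λ a b c d e → a :+ (b :+ c :+ (d :+ e)) := c :+ ((a :+ (b :+ d)) :+ e)) refl _ _ _ _ _ ⟩
        down₀ K + (up K 0 + (up K 1 + sum (up K ∘ suc ∘ suc) n) + sum (down K) n)
          ≈⟨ +-congˡ (+-congʳ (trans (Sum.fold-suc (up K) (suc n)) (+-congˡ (Sum.fold-suc (up K ∘ suc) n)))) ⟨
        down₀ K + (sum (up K) (suc (suc n)) + sum (down K) n)
          ≈⟨ +-congˡ (+-congʳ (Sum.fold-stable (up K) {n} {suc (suc n)} (ℕₚ.m≤n+m n 2)
               λ k n≤k → up-zero (ℕₚ.≤-trans K<n n≤k))) ⟩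
        down₀ K + (sum (up K) n + sum (down K) n)
          ≈⟨ +-congˡ (Sum.fold-∙ _ _ n) ⟨
        down₀ K + sum (λ k → up K k + down K k) n ∎

    -- The factor added in passing to K + 1 equals (1 + Q^(2K+1)) - Q^K (z + w) by z w = Q, and
    -- `coeff` satisfies precisely the recurrence that this produces. The length n is free because
    -- the coefficients vanish beyond K; the induction uses two different lengths.
    finiteTriple-expansion : ∀ K {n} → K < n → finiteTriple K ≈ sum (λ k → coeff K k * pair k) n
    finiteTriple-expansion zero {n} 0<n = sym (trans
      (Sum.fold-stable _ 0<n λ { (suc k) _ → zeroˡ _ })
      (trans (+-identityˡ _) (*-identityˡ 1#)))
    finiteTriple-expansion (suc K) {suc n} (s≤s K<n) = begin
      finiteTriple K * ((1# - z * Q ^ K) * (1# - w * Q ^ K))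
        ≈⟨ *-congˡ (trans
             (solve 3 (λ z w q → let 𝟙 = con 1ℤ in
               (𝟙 :- z :* q) :* (𝟙 :- w :* q) := (𝟙 :+ (z :* w) :* (q :* q)) :+ :- (q :* (z :+ w))) refl z w (Q ^ K))
             (+-congʳ (+-congˡ (*-congʳ zw≈Q)))) ⟩
      finiteTriple K * (D + - (Q ^ K * (z + w)))
        ≈⟨ trans (distribˡ _ _ _) (+-cong (*-comm _ _) (*-comm _ _)) ⟩
      D * finiteTriple K + - (Q ^ K * (z + w)) * finiteTriple K
        ≈⟨ +-cong (*-congˡ (finiteTriple-expansion K (ℕₚ.m<n⇒m<1+n K<n)))
                  (*-congˡ (finiteTriple-expansion K (ℕₚ.m<n⇒m<1+n (ℕₚ.m<n⇒m<1+n K<n)))) ⟩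
      D * sum term (suc n) + - (Q ^ K * (z + w)) * sum term (suc (suc n))
        ≈⟨ +-cong (trans (sum-*ˡ D term (suc n)) (Sum.fold-suc _ n)) (trans (sum-*ˡ _ term (suc (suc n))) (sum-cross K<n)) ⟩
      D * term 0 + sum (λ k → D * term (suc k)) n + (down₀ K + sum (λ k → up K k + down K k) n)
        ≈⟨ solve 4 (λ a b c d → a :+ b :+ (c :+ d) := (a :+ c) :+ (b :+ d)) refl _ _ _ _ ⟩
      D * term 0 + down₀ K + (sum (λ k → D * term (suc k)) n + sum (λ k → up K k + down K k) n)
        ≈⟨ +-cong (solve 3 (λ d c r → let 𝟙 = con 1ℤ in d :* (c :* 𝟙) :+ (r :+ r) := (d :* c :+ r :+ r) :* 𝟙) refl D (coeff K 0) _)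
             (sym (trans (Sum.fold-cong n λ k →
               solve 6 (λ d c a c′ b h → (d :* c :+ a :* c′ :+ b) :* h := d :* (c :* h) :+ (a :* c′ :* h :+ b :* h))
                 refl D (coeff K (suc k)) (Q ^ (K ∸ k)) (coeff K k) _ (pair (suc k)))
               (Sum.fold-∙ _ _ n))) ⟩
      coeff (suc K) 0 * pair 0 + sum (λ k → coeff (suc K) (suc k) * pair (suc k)) n
        ≈⟨ Sum.fold-suc (λ k → coeff (suc K) k * pair k) n ⟨
      sum (λ k → coeff (suc K) k * pair k) (suc n) ∎
      where
      D = 1# + Q * (Q ^ K * Q ^ K)
      term : ℕ → Carrier
      term k = coeff K k * pair k

    module _ {N} (Q^-zero : ∀ m → N ≤ m → Q ^ m ≈ 0#)
             (pos-zero : ∀ k → N < k → pos k ≈ 0#) (neg-zero : ∀ k → N < k → neg k ≈ 0#) where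

      bilateral : ℤ → Carrier
      bilateral (+ k)    = pos k
      bilateral -[1+ k ] = neg (suc k)

      private
        pair-zero : ∀ k → N < k → pair k ≈ 0#
        pair-zero (suc k) N<k = trans (+-cong (pos-zero _ N<k) (neg-zero _ N<k)) (+-identityˡ 0#)

        sum-pair : ∀ L → N < L → sum pair (suc L) ≈ Sum.foldℤ L bilateral
        sum-pair L N<L = begin
          sum pair (suc L)
            ≈⟨ Sum.fold-suc pair L ⟩
          1# + sum (λ k → pos (suc k) + neg (suc k)) L
            ≈⟨ +-congˡ (Sum.fold-∙ _ _ L) ⟩
          1# + (sum (pos ∘ suc) L + sum (neg ∘ suc) L)
            ≈⟨ +-assoc _ _ _ ⟨
          1# + sum (pos ∘ suc) L + sum (neg ∘ suc) L
            ≈⟨ +-congʳ (Sum.fold-suc pos L) ⟨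
          sum pos L + pos L + sum (neg ∘ suc) L
            ≈⟨ +-congʳ (trans (+-congˡ (pos-zero L N<L)) (+-identityʳ _)) ⟩
          sum pos L + sum (neg ∘ suc) L
            ≈⟨ Sum.foldℤ-fold L bilateral ⟨
          Sum.foldℤ L bilateral ∎

      -- The factor coeff K 0 tends to 1/(Q;Q)∞; only its independence of z and w matters.
      tripleProduct : ∀ {K L} → N ℕ.+ N ≤ K → N < L →
                      finiteTriple K ≈ coeff K 0 * Sum.foldℤ L bilateral
      tripleProduct {K} {L} 2N≤K N<L = begin
        finiteTriple K
          ≈⟨ finiteTriple-expansion K (ℕₚ.n<1+n K) ⟩
        sum (λ k → coeff K k * pair k) (suc K)
          ≈⟨ Sum.fold-cong (suc K) constant ⟩
        sum (λ k → coeff K 0 * pair k) (suc K)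
          ≈⟨ Sum.fold-stable _ (s≤s (ℕₚ.≤-trans (ℕₚ.m≤m+n N N) 2N≤K)) small ⟩
        sum (λ k → coeff K 0 * pair k) (suc N)
          ≈⟨ Sum.fold-stable _ {n = suc L} (ℕₚ.m≤n⇒m≤1+n N<L) small ⟨
        sum (λ k → coeff K 0 * pair k) (suc L)
          ≈⟨ sum-*ˡ (coeff K 0) pair (suc L) ⟨
        coeff K 0 * sum pair (suc L)
          ≈⟨ *-congˡ (sum-pair L N<L) ⟩
        coeff K 0 * Sum.foldℤ L bilateral ∎
        where
        small : ∀ k → N < k → coeff K 0 * pair k ≈ 0#
        small k N<k = trans (*-congˡ (pair-zero k N<k)) (zeroʳ _)
        constant : ∀ k → coeff K k * pair k ≈ coeff K 0 * pair k
        -- For k ≤ N the bound 2N ≤ K gives the k + N ≤ K that `coeff-constant` asks for; for larger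
        -- k the pair itself is zero.
        constant k with k ℕₚ.≤? N
        ... | yes k≤N = *-congʳ (coeff-constant Q^-zero k (ℕₚ.≤-trans (ℕₚ.+-monoˡ-≤ N k≤N) 2N≤K))
        ... | no k≰N = trans (trans (*-congˡ h≈0) (zeroʳ _)) (sym (trans (*-congˡ h≈0) (zeroʳ _)))
          where h≈0 = pair-zero k (ℕₚ.≰⇒> k≰N)

-- Exponents of theta series

-- H k (k - 1) + r k
exponent⁺ : ℕ → ℕ → ℕ → ℕ
exponent⁺ H r zero    = 0
exponent⁺ H r (suc k) = exponent⁺ H r k ℕ.+ ((H ℕ.+ H) ℕ.* k ℕ.+ r)

-- The second residue r′ stands for 2H - r. Using it for negative indices keeps the exponent a
-- natural number without subtraction; `exponent-quadratic` shows that both branches are one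
-- quadratic polynomial.
exponent : ℕ → ℕ → ℕ → ℤ → ℕ
exponent H r r′ (+ k)    = exponent⁺ H r k
exponent H r r′ -[1+ k ] = exponent⁺ H r′ (suc k)

quadratic : ℤ → ℤ → ℤ → ℤ
quadratic h r m = h ℤ.* (m ℤ.* m ℤ.- m) ℤ.+ r ℤ.* m

private
  module ℤ-Solver = +-*-Solver

  :quadratic : ∀ {n} (h r m : ℤ-Solver.Polynomial n) → ℤ-Solver.Polynomial n
  :quadratic h r m = h :* (m :* m :- m) :+ r :* m
    where open ℤ-Solver

  exponent⁺-quadratic : ∀ H r k → + exponent⁺ H r k ≡ quadratic (+ H) (+ r) (+ k)
  exponent⁺-quadratic H r zero    = eq (+ H) (+ r)
    where
    open ℤ-Solver
    eq : ∀ h r → 0ℤ ≡ quadratic h r 0ℤ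
    eq = solve 2 (λ h r → con 0ℤ := :quadratic h r (con 0ℤ)) ≡.refl
  exponent⁺-quadratic H r (suc k) = ≡.trans
    (≡.cong₂ ℤ._+_ (exponent⁺-quadratic H r k) (≡.cong (ℤ._+ + r) (ℤₚ.pos-* (H ℕ.+ H) k)))
    (eq (+ H) (+ r) (+ k))
    where
    open ℤ-Solver
    eq : ∀ h r k → quadratic h r k ℤ.+ ((h ℤ.+ h) ℤ.* k ℤ.+ r) ≡ quadratic h r (1ℤ ℤ.+ k)
    eq = solve 3 (λ h r k → :quadratic h r k :+ ((h :+ h) :* k :+ r) := :quadratic h r (con 1ℤ :+ k)) ≡.refl

exponent-quadratic : ∀ H {r r′} → r ℕ.+ r′ ≡ H ℕ.+ H → ∀ m →
                     + exponent H r r′ m ≡ quadratic (+ H) (+ r) m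
exponent-quadratic H {r} {r′} _  (+ k)    = exponent⁺-quadratic H r k
exponent-quadratic H {r} {r′} eq -[1+ k ] = ≡.trans (exponent⁺-quadratic H r′ (suc k))
  (reflect (+ H) (+ r) (+ r′) (+ suc k) (≡.cong +_ eq))
  where
  open ℤ-Solver
  move : ∀ h r k → quadratic h (h ℤ.+ h ℤ.- r) k ≡ quadratic h r (ℤ.- k)
  move = solve 3 (λ h r k → :quadratic h (h :+ h :- r) k := :quadratic h r (:- k)) ≡.refl
  cancel : ∀ r r′ → r′ ≡ (r ℤ.+ r′) ℤ.- r
  cancel = solve-∀
  reflect : ∀ h r r′ k → r ℤ.+ r′ ≡ h ℤ.+ h → quadratic h r′ k ≡ quadratic h r (ℤ.- k)
  reflect h r r′ k e = ≡.trans
    (≡.cong (λ s → quadratic h s k) (≡.trans (cancel r r′) (≡.cong (ℤ._- r) e)))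
    (move h r k)

private module Exponents where
  open ℤ-Solver

  -- With m = i + j and n = i - j the form m² + n² becomes 2i² + 2j², without mixed term, so a
  -- product of two theta series separates into series with doubled modulus.
  even-exponent : ∀ h g b i j →
    quadratic h (g ℤ.+ b ℤ.+ b) (i ℤ.+ j) ℤ.+ quadratic h g (i ℤ.- j)
    ≡ quadratic (h ℤ.+ h) (g ℤ.+ b ℤ.+ (g ℤ.+ b)) i ℤ.+ quadratic (h ℤ.+ h) (h ℤ.+ h ℤ.+ (b ℤ.+ b)) j
  even-exponent = solve 5 (λ h g b i j →
    :quadratic h (g :+ b :+ b) (i :+ j) :+ :quadratic h g (i :- j)
    := :quadratic (h :+ h) (g :+ b :+ (g :+ b)) i :+ :quadratic (h :+ h) (h :+ h :+ (b :+ b)) j) ≡.refl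
  odd-exponent : ∀ h g b i j →
    quadratic h (g ℤ.+ b ℤ.+ b) (i ℤ.+ j) ℤ.+ quadratic h g (1ℤ ℤ.+ (i ℤ.- j))
    ≡ g ℤ.+ (quadratic (h ℤ.+ h) (h ℤ.+ h ℤ.+ (g ℤ.+ b ℤ.+ (g ℤ.+ b))) i ℤ.+ quadratic (h ℤ.+ h) (b ℤ.+ b) j)
  odd-exponent = solve 5 (λ h g b i j →
    :quadratic h (g :+ b :+ b) (i :+ j) :+ :quadratic h g (con 1ℤ :+ (i :- j))
    := g :+ (:quadratic (h :+ h) (h :+ h :+ (g :+ b :+ (g :+ b))) i :+ :quadratic (h :+ h) (b :+ b) j)) ≡.refl

exponent⁺-≥ : ∀ H r k → 1 ≤ H → k ≤ exponent⁺ H r (suc k)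
exponent⁺-≥ H r k 1≤H = ℕₚ.≤-trans
  (ℕₚ.≤-trans (ℕₚ.≤-reflexive (≡.sym (ℕₚ.*-identityˡ k))) (ℕₚ.*-monoˡ-≤ k (ℕₚ.≤-trans 1≤H (ℕₚ.m≤m+n H H))))
  (ℕₚ.≤-trans (ℕₚ.m≤m+n _ r) (ℕₚ.m≤n+m _ (exponent⁺ H r k)))

exponent-≥ : ∀ {H N} r r′ → 1 ≤ H → ∀ m → N < ∣ m ∣ → N ≤ exponent H r r′ m
exponent-≥ r r′ 1≤H (+ suc k)  (s≤s N≤k) = ℕₚ.≤-trans N≤k (exponent⁺-≥ _ r k 1≤H)
exponent-≥ r r′ 1≤H -[1+ k ]   (s≤s N≤k) = ℕₚ.≤-trans N≤k (exponent⁺-≥ _ r′ k 1≤H)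

-- Theta functions for nilpotent q and Weierstrass' relation

module ThetaFunctions {κ ℓ} (R : CommutativeRing κ ℓ) where
  open CommutativeRing R
  open import Algebra.Properties.Semiring.Exp semiring using (_^_; ^-homo-*; ^-congʳ; ^-assocʳ)
  open import Relation.Binary.Reasoning.Setoid setoid
  open import Algebra.Properties.Ring ring using (-‿distribˡ-*)
  open import Algebra.Properties.CommutativeSemigroup *-commutativeSemigroup using (interchange)
  open IntegerSolver R
  open Summation R
  open Sum using (foldℤ)
  open Product using () renaming (fold to product)

  module Truncated (q : Carrier) (N : ℕ) (q^-zero : ∀ m → N ≤ m → q ^ m ≈ 0#) (K : ℕ) (2N≤K : N ℕ.+ N ≤ K) where

    IsSign : Carrier → Set ℓ
    IsSign ε = ε * ε ≈ 1#

    -- This is θ(z) cut off after K factors, with z = ε q^r and Q = q^(2H); since ε is a sign, Q / z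
    -- = ε q^(2H - r). Writing the modulus as 2H gives Q^(k(k-1)/2) the exponent H k (k - 1), free
    -- of halves.
    θ : Carrier → ℕ → ℕ → Carrier
    θ ε H r = product (λ n → (1# - ε * q ^ r * (q ^ (H ℕ.+ H)) ^ n)
                           * (1# - ε * q ^ (H ℕ.+ H ∸ r) * (q ^ (H ℕ.+ H)) ^ n)) K

    term : Carrier → ℕ → ℕ → ℤ → Carrier
    term δ H r m = δ ^ ∣ m ∣ * q ^ exponent H r (H ℕ.+ H ∸ r) m

    Θ : Carrier → ℕ → ℕ → Carrier
    Θ δ H r = foldℤ (suc N) (term δ H r)

    private
      term-supported : ∀ δ {H} r → 1 ≤ H → Sum.Supported (suc N) (term δ H r)
      term-supported δ {H} r 1≤H m N<m = trans
        (*-congˡ (q^-zero _ (exponent-≥ r (H ℕ.+ H ∸ r) 1≤H m N<m))) (zeroʳ _)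

      Q^-zero : ∀ {H} → 1 ≤ H → ∀ m → N ≤ m → (q ^ (H ℕ.+ H)) ^ m ≈ 0#
      Q^-zero {H} 1≤H m N≤m = trans (^-assocʳ q (H ℕ.+ H) m) (q^-zero _ (ℕₚ.≤-trans N≤m
        (ℕₚ.≤-trans (ℕₚ.≤-reflexive (≡.sym (ℕₚ.*-identityˡ m))) (ℕₚ.*-monoˡ-≤ m (ℕₚ.≤-trans 1≤H (ℕₚ.m≤m+n H H))))))

    constant : ℕ → Carrier
    constant H = TripleProduct.coeff R (q ^ (H ℕ.+ H)) K 0

    θ-series : ∀ {ε} H r → IsSign ε → 1 ≤ H → r ≤ H ℕ.+ H → θ ε H r ≈ constant H * Θ (- ε) H r
    θ-series {ε} H r ε²≈1 1≤H r≤2H = trans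
      (tripleProduct z w zw≈Q (Q^-zero 1≤H) (zero-of r pos≈) (zero-of r′ neg≈) 2N≤K (ℕₚ.n<1+n N))
      (*-congˡ (Sum.foldℤ-cong (suc N) bilateral≈))
      where
      r′ = H ℕ.+ H ∸ r
      Q = q ^ (H ℕ.+ H)
      z = ε * q ^ r
      w = ε * q ^ r′
      open TripleProduct R Q
      zw≈Q : z * w ≈ Q
      zw≈Q = trans (interchange ε _ ε _) (trans (*-congʳ ε²≈1) (trans (*-identityˡ _)
        (trans (sym (^-homo-* q r r′)) (^-congʳ q (ℕₚ.m+[n∸m]≡n r≤2H)))))
      monomial : ℕ → ℕ → Carrier
      monomial s k = (- ε) ^ k * q ^ exponent⁺ H s k
      step : ∀ s k {x} → x ≈ monomial s k → - (ε * q ^ s * Q ^ k) * x ≈ monomial s (suc k)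
      step s k {x} x≈ = begin
        - (ε * q ^ s * Q ^ k) * x
          ≈⟨ *-cong (-‿cong (*-congˡ (^-assocʳ q (H ℕ.+ H) k))) x≈ ⟩
        - (ε * q ^ s * q ^ ((H ℕ.+ H) ℕ.* k)) * monomial s k
          ≈⟨ solve 5 (λ ε a b d e → :- (ε :* a :* b) :* (d :* e) := :- ε :* d :* (e :* (b :* a))) refl ε _ _ _ _ ⟩
        - ε * (- ε) ^ k * (q ^ exponent⁺ H s k * (q ^ ((H ℕ.+ H) ℕ.* k) * q ^ s))
          ≈⟨ *-congˡ (*-congˡ (^-homo-* q ((H ℕ.+ H) ℕ.* k) s)) ⟨
        - ε * (- ε) ^ k * (q ^ exponent⁺ H s k * q ^ ((H ℕ.+ H) ℕ.* k ℕ.+ s))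
          ≈⟨ *-congˡ (^-homo-* q (exponent⁺ H s k) _) ⟨
        monomial s (suc k) ∎
      pos≈ : ∀ k → pos z w zw≈Q k ≈ monomial r k
      pos≈ zero    = sym (*-identityˡ 1#)
      pos≈ (suc k) = step r k (pos≈ k)
      neg≈ : ∀ k → neg z w zw≈Q k ≈ monomial r′ k
      neg≈ zero    = sym (*-identityˡ 1#)
      neg≈ (suc k) = step r′ k (neg≈ k)
      zero-of : ∀ s {f : ℕ → Carrier} → (∀ k → f k ≈ monomial s k) → ∀ k → N < k → f k ≈ 0#
      zero-of s f≈ (suc k) (s≤s N≤k) = trans (f≈ (suc k))
        (trans (*-congˡ (q^-zero _ (ℕₚ.≤-trans N≤k (exponent⁺-≥ H s k 1≤H)))) (zeroʳ _))
      bilateral≈ : ∀ m → bilateral z w zw≈Q (Q^-zero 1≤H) (zero-of r pos≈) (zero-of r′ neg≈) m ≈ term (- ε) H r m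
      bilateral≈ (+ k)    = pos≈ k
      bilateral≈ -[1+ k ] = neg≈ (suc k)

    private
      module Signs {δ} (δ²≈1 : IsSign δ) where
        -- As δ is its own inverse, this is δ^m for every integer m.
        power : ℤ → Carrier
        power m = δ ^ ∣ m ∣

        power-suc : ∀ m → power (1ℤ ℤ.+ m) ≈ δ * power m
        power-suc (+ k)        = refl
        power-suc -[1+ zero ]  = sym (trans (*-congˡ (*-identityʳ δ)) δ²≈1)
        power-suc -[1+ suc k ] = sym (trans (sym (*-assoc _ _ _)) (trans (*-congʳ δ²≈1) (*-identityˡ _)))

        power-+⁺ : ∀ n m → power (+ n ℤ.+ m) ≈ power (+ n) * power m
        power-+⁺ zero    m = trans (reflexive (≡.cong power (ℤₚ.+-identityˡ m))) (sym (*-identityˡ _))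
        power-+⁺ (suc n) m = begin
          power (+ suc n ℤ.+ m)          ≡⟨ ≡.cong power (ℤₚ.+-assoc 1ℤ (+ n) m) ⟩
          power (1ℤ ℤ.+ (+ n ℤ.+ m))     ≈⟨ power-suc (+ n ℤ.+ m) ⟩
          δ * power (+ n ℤ.+ m)          ≈⟨ *-congˡ (power-+⁺ n m) ⟩
          δ * (power (+ n) * power m)    ≈⟨ *-assoc _ _ _ ⟨
          power (+ suc n) * power m      ∎

        power-square : ∀ m → power m * power m ≈ 1#
        power-square m = go ∣ m ∣
          where
          go : ∀ k → δ ^ k * δ ^ k ≈ 1#
          go zero    = *-identityˡ 1#
          go (suc k) = trans (interchange _ _ _ _) (trans (*-cong δ²≈1 (go k)) (*-identityˡ 1#))

        power-+ : ∀ m n → power (m ℤ.+ n) ≈ power m * power n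
        power-+ (+ k)        n = power-+⁺ k n
        power-+ m@(-[1+ k ]) n = begin
          power (m ℤ.+ n)
            ≈⟨ trans (sym (*-identityˡ _)) (*-congʳ (sym (power-square m))) ⟩
          power m * power m * power (m ℤ.+ n)
            ≈⟨ trans (*-assoc _ _ _) (*-congˡ (sym (power-+⁺ (suc k) (m ℤ.+ n)))) ⟩
          power m * power (+ suc k ℤ.+ (m ℤ.+ n))
            ≡⟨ ≡.cong (λ j → power m * power j) (eq (+ suc k) n) ⟩
          power m * power n ∎
          where
          eq : ∀ k n → k ℤ.+ (ℤ.- k ℤ.+ n) ≡ n
          eq = solve-∀

        power-even : ∀ i j → power (i ℤ.+ j) * power (i ℤ.- j) ≈ 1#
        power-even i j = begin
          power (i ℤ.+ j) * power (i ℤ.- j)                  ≈⟨ *-cong (power-+ i j) (power-+ i (ℤ.- j)) ⟩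
          power i * power j * (power i * power (ℤ.- j))      ≡⟨ ≡.cong (λ n → power i * power j * (power i * δ ^ n)) (ℤₚ.∣-i∣≡∣i∣ j) ⟩
          power i * power j * (power i * power j)            ≈⟨ interchange _ _ _ _ ⟩
          power i * power i * (power j * power j)            ≈⟨ *-cong (power-square i) (power-square j) ⟩
          1# * 1#                                            ≈⟨ *-identityˡ 1# ⟩
          1#                                                 ∎

        power-odd : ∀ i j → power (i ℤ.+ j) * power (1ℤ ℤ.+ (i ℤ.- j)) ≈ δ
        power-odd i j = begin
          power (i ℤ.+ j) * power (1ℤ ℤ.+ (i ℤ.- j))   ≈⟨ *-congˡ (power-suc (i ℤ.- j)) ⟩
          power (i ℤ.+ j) * (δ * power (i ℤ.- j))      ≈⟨ solve 3 (λ x y z → x :* (y :* z) := y :* (x :* z)) refl _ _ _ ⟩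
          δ * (power (i ℤ.+ j) * power (i ℤ.- j))      ≈⟨ *-congˡ (power-even i j) ⟩
          δ * 1#                                       ≈⟨ *-identityʳ δ ⟩
          δ                                            ∎

      1^ : ∀ n → 1# ^ n ≈ 1#
      1^ zero    = refl
      1^ (suc n) = trans (*-identityˡ _) (1^ n)

    -- For x = q^b these are the sums over m of q^(2H m²) x^(2m) and of q^(2H (m² - m)) x^(2m).
    -- Symmetry would require dividing the second by x; leaving this out avoids negative exponents
    -- and accounts for the factor q^g in `Θ-product`, which is x / y.
    α β : ℕ → ℕ → Carrier
    α H b = Θ 1# (H ℕ.+ H) (H ℕ.+ H ℕ.+ (b ℕ.+ b))
    β H b = Θ 1# (H ℕ.+ H) (b ℕ.+ b)

    -- θ(xy) θ(x/y) for x = q^(g+b) and y = q^b, up to the common factor of θ-series.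
    Θ-product : ∀ {δ} H g b → IsSign δ → 1 ≤ H → g ℕ.+ b ≤ H →
                Θ δ H (g ℕ.+ b ℕ.+ b) * Θ δ H g ≈
                β H (g ℕ.+ b) * α H b + δ * q ^ g * (α H (g ℕ.+ b) * β H b)
    Θ-product {δ} H g b δ²≈1 1≤H a≤H = begin
      Θ δ H s * Θ δ H g
        ≈⟨ sumℤ-product T₁ T₂ L ⟩
      foldℤ L (λ m → foldℤ L (λ n → T₁ m * T₂ n))
        ≈⟨ Sum.foldℤ²-parity (λ m n → T₁ m * T₂ n)
             (λ m n le → trans (*-congʳ (term-supported δ s 1≤H m le)) (zeroˡ _))
             (λ m n le → trans (*-congˡ (term-supported δ g 1≤H n le)) (zeroʳ _)) ⟩
      foldℤ L (λ i → foldℤ L (λ j → T₁ (i ℤ.+ j) * T₂ (i ℤ.- j))) +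
      foldℤ L (λ i → foldℤ L (λ j → T₁ (i ℤ.+ j) * T₂ (1ℤ ℤ.+ (i ℤ.- j))))
        ≈⟨ +-cong (Sum.foldℤ-cong L λ i → Sum.foldℤ-cong L λ j → even i j)
                  (Sum.foldℤ-cong L λ i → trans (Sum.foldℤ-cong L λ j → odd i j) (sym (sumℤ-*ˡ (δ * q ^ g) (λ j → Tαa i * Tβb j) L))) ⟩
      foldℤ L (λ i → foldℤ L (λ j → Tβa i * Tαb j)) +
      foldℤ L (λ i → δ * q ^ g * foldℤ L (λ j → Tαa i * Tβb j))
        ≈⟨ +-cong (sym (sumℤ-product Tβa Tαb L))
                  (trans (sym (sumℤ-*ˡ (δ * q ^ g) (λ i → foldℤ L (λ j → Tαa i * Tβb j)) L)) (*-congˡ (sym (sumℤ-product Tαa Tβb L)))) ⟩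
      β H a * α H b + δ * q ^ g * (α H a * β H b) ∎
      where
      L = suc N
      M = H ℕ.+ H
      a = g ℕ.+ b
      s = g ℕ.+ b ℕ.+ b
      open Signs δ²≈1
      T₁ T₂ Tβa Tαb Tαa Tβb : ℤ → Carrier
      T₁ = term δ H s
      T₂ = term δ H g
      Tβa = term 1# M (a ℕ.+ a)
      Tαb = term 1# M (M ℕ.+ (b ℕ.+ b))
      Tαa = term 1# M (M ℕ.+ (a ℕ.+ a))
      Tβb = term 1# M (b ℕ.+ b)

      b≤H : b ≤ H
      b≤H = ℕₚ.≤-trans (ℕₚ.m≤n+m b g) a≤H
      g≤H : g ≤ H
      g≤H = ℕₚ.≤-trans (ℕₚ.m≤m+n g b) a≤H
      E₁ : ∀ m → + exponent H s (M ∸ s) m ≡ quadratic (+ H) (+ g ℤ.+ + b ℤ.+ + b) m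
      E₁ = exponent-quadratic H (ℕₚ.m+[n∸m]≡n (ℕₚ.+-mono-≤ a≤H b≤H))
      E₂ : ∀ m → + exponent H g (M ∸ g) m ≡ quadratic (+ H) (+ g) m
      E₂ = exponent-quadratic H (ℕₚ.m+[n∸m]≡n (ℕₚ.≤-trans g≤H (ℕₚ.m≤m+n H H)))
      Eβ : ∀ {x} → x ≤ H → ∀ m → + exponent M (x ℕ.+ x) (M ℕ.+ M ∸ (x ℕ.+ x)) m ≡ quadratic (+ H ℤ.+ + H) (+ x ℤ.+ + x) m
      Eβ x≤H = exponent-quadratic M (ℕₚ.m+[n∸m]≡n (ℕₚ.≤-trans (ℕₚ.+-mono-≤ x≤H x≤H) (ℕₚ.m≤m+n M M)))
      Eα : ∀ {x} → x ≤ H → ∀ m → + exponent M (M ℕ.+ (x ℕ.+ x)) (M ℕ.+ M ∸ (M ℕ.+ (x ℕ.+ x))) m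
                                ≡ quadratic (+ H ℤ.+ + H) (+ H ℤ.+ + H ℤ.+ (+ x ℤ.+ + x)) m
      Eα x≤H = exponent-quadratic M (ℕₚ.m+[n∸m]≡n (ℕₚ.+-monoʳ-≤ M (ℕₚ.+-mono-≤ x≤H x≤H)))

      combine : ∀ m n → T₁ m * T₂ n ≈ power m * power n * q ^ (exponent H s (M ∸ s) m ℕ.+ exponent H g (M ∸ g) n)
      combine m n = trans (interchange _ _ _ _) (*-congˡ (sym (^-homo-* q (exponent H s (M ∸ s) m) (exponent H g (M ∸ g) n))))

      unsigned : ∀ x y m n → 1# ^ ∣ m ∣ * q ^ x * (1# ^ ∣ n ∣ * q ^ y) ≈ q ^ (x ℕ.+ y)
      unsigned x y m n = trans (*-cong (trans (*-congʳ (1^ ∣ m ∣)) (*-identityˡ _)) (trans (*-congʳ (1^ ∣ n ∣)) (*-identityˡ _)))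
        (sym (^-homo-* q x y))

      even : ∀ i j → T₁ (i ℤ.+ j) * T₂ (i ℤ.- j) ≈ Tβa i * Tαb j
      even i j = trans (combine (i ℤ.+ j) (i ℤ.- j)) (trans (*-congʳ (power-even i j)) (trans (*-identityˡ _)
        (trans (^-congʳ q (ℤₚ.+-injective (≡.trans (≡.cong₂ ℤ._+_ (E₁ (i ℤ.+ j)) (E₂ (i ℤ.- j)))
          (≡.trans (Exponents.even-exponent (+ H) (+ g) (+ b) i j) (≡.sym (≡.cong₂ ℤ._+_ (Eβ a≤H i) (Eα b≤H j)))))))
          (sym (unsigned (exponent M (a ℕ.+ a) (M ℕ.+ M ∸ (a ℕ.+ a)) i)
          (exponent M (M ℕ.+ (b ℕ.+ b)) (M ℕ.+ M ∸ (M ℕ.+ (b ℕ.+ b))) j) i j)))))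

      odd : ∀ i j → T₁ (i ℤ.+ j) * T₂ (1ℤ ℤ.+ (i ℤ.- j)) ≈ δ * q ^ g * (Tαa i * Tβb j)
      odd i j = trans (combine (i ℤ.+ j) (1ℤ ℤ.+ (i ℤ.- j))) (trans (*-congʳ (power-odd i j))
        (trans (*-congˡ (trans (^-congʳ q (ℤₚ.+-injective
          (≡.trans (≡.cong₂ ℤ._+_ (E₁ (i ℤ.+ j)) (E₂ (1ℤ ℤ.+ (i ℤ.- j))))
            (≡.trans (Exponents.odd-exponent (+ H) (+ g) (+ b) i j)
              (≡.cong (λ x → + g ℤ.+ x) (≡.sym (≡.cong₂ ℤ._+_ (Eα a≤H i) (Eβ b≤H j))))))))
          (^-homo-* q g _)))
        (trans (sym (*-assoc _ _ _)) (*-congˡ (sym (unsigned (exponent M (M ℕ.+ (a ℕ.+ a)) (M ℕ.+ M ∸ (M ℕ.+ (a ℕ.+ a))) i)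
          (exponent M (b ℕ.+ b) (M ℕ.+ M ∸ (b ℕ.+ b)) j) i j))))))

    -- Since θ(xy) θ(x/y) is alternating in the vectors (α, β) of x and y, this is a Plücker relation.
    weierstrass : ∀ {εa εb εc εd} H u v w d → IsSign εa → IsSign εb → IsSign εc → IsSign εd →
                  1 ≤ H → u ℕ.+ (v ℕ.+ (w ℕ.+ d)) ≤ H →
                  let c = w ℕ.+ d
                      b = v ℕ.+ c
                  in
                  εb * εc * q ^ v
                    * ((θ (εa * εb) H (u ℕ.+ b ℕ.+ b) * θ (εa * εb) H u)
                       * (θ (εc * εd) H (w ℕ.+ d ℕ.+ d) * θ (εc * εd) H w))
                  - (θ (εa * εc) H (u ℕ.+ v ℕ.+ c ℕ.+ c) * θ (εa * εc) H (u ℕ.+ v))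
                    * (θ (εb * εd) H (v ℕ.+ w ℕ.+ d ℕ.+ d) * θ (εb * εd) H (v ℕ.+ w))
                  + (θ (εa * εd) H (u ℕ.+ v ℕ.+ w ℕ.+ d ℕ.+ d) * θ (εa * εd) H (u ℕ.+ v ℕ.+ w))
                    * (θ (εb * εc) H (v ℕ.+ c ℕ.+ c) * θ (εb * εc) H v) ≈ 0#
    weierstrass {εa} {εb} {εc} {εd} H u v w d a² b² c² d² 1≤H a≤H = begin
      t * ((θ (εa * εb) H (u ℕ.+ b ℕ.+ b) * θ (εa * εb) H u) * (θ (εc * εd) H (w ℕ.+ d ℕ.+ d) * θ (εc * εd) H w))
      - (θ (εa * εc) H (u ℕ.+ v ℕ.+ c ℕ.+ c) * θ (εa * εc) H (u ℕ.+ v))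
        * (θ (εb * εd) H (v ℕ.+ w ℕ.+ d ℕ.+ d) * θ (εb * εd) H (v ℕ.+ w))
      + (θ (εa * εd) H (u ℕ.+ v ℕ.+ w ℕ.+ d ℕ.+ d) * θ (εa * εd) H (u ℕ.+ v ℕ.+ w))
        * (θ (εb * εc) H (v ℕ.+ c ℕ.+ c) * θ (εb * εc) H v)
        ≈⟨ +-cong (+-cong (*-congˡ (*-cong Fab Fcd)) (-‿cong (*-cong Fac Fbd))) (*-cong Fad Fbc) ⟩
      t * (C * C * (B a * A b - s * (A a * B b)) * (C * C * (B c * A d - r * (A c * B d))))
      - C * C * (B a * A c - s * t * (A a * B c)) * (C * C * (B b * A d - t * r * (A b * B d)))
      + C * C * (B a * A d - s * t * r * (A a * B d)) * (C * C * (B b * A c - t * (A b * B c)))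
        ≈⟨ solve 12 (λ C αa βa αb βb αc βc αd βd s t w →
             t :* (C :* C :* (βa :* αb :- s :* (αa :* βb)) :* (C :* C :* (βc :* αd :- w :* (αc :* βd))))
             :- C :* C :* (βa :* αc :- s :* t :* (αa :* βc)) :* (C :* C :* (βb :* αd :- t :* w :* (αb :* βd)))
             :+ C :* C :* (βa :* αd :- s :* t :* w :* (αa :* βd)) :* (C :* C :* (βb :* αc :- t :* (αb :* βc))) := con 0ℤ)
             refl C (A a) (B a) (A b) (B b) (A c) (B c) (A d) (B d) s t r ⟩
      0# ∎
      where
      c = w ℕ.+ d
      b = v ℕ.+ c
      a = u ℕ.+ b
      A = α H
      B = β H
      C = constant H
      -- The four points are given by the gaps u, v, w of their exponents and the least exponent d.
      -- Here s, t, r are the quotients of neighbouring points, signs included; all other quotients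
      -- are products of these, so the relation becomes a polynomial identity.
      s = εa * εb * q ^ u
      t = εb * εc * q ^ v
      r = εc * εd * q ^ w

      F : ∀ {ε ε′} g y x → IsSign ε → IsSign ε′ → g ℕ.+ y ≤ H → g ℕ.+ y ≡ x → ∀ {k} → ε * ε′ * q ^ g ≈ k →
          θ (ε * ε′) H (g ℕ.+ y ℕ.+ y) * θ (ε * ε′) H g ≈ C * C * (B x * A y - k * (A x * B y))
      F {ε} {ε′} g y x ε² ε′² x≤H ≡.refl {k} k≈ = begin
        θ η H (g ℕ.+ y ℕ.+ y) * θ η H g
          ≈⟨ *-cong (θ-series H (g ℕ.+ y ℕ.+ y) η² 1≤H (ℕₚ.+-mono-≤ x≤H (ℕₚ.≤-trans (ℕₚ.m≤n+m y g) x≤H)))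
                    (θ-series H g η² 1≤H (ℕₚ.≤-trans (ℕₚ.≤-trans (ℕₚ.m≤m+n g y) x≤H) (ℕₚ.m≤m+n H H))) ⟩
        C * Θ (- η) H (g ℕ.+ y ℕ.+ y) * (C * Θ (- η) H g)
          ≈⟨ interchange _ _ _ _ ⟩
        C * C * (Θ (- η) H (g ℕ.+ y ℕ.+ y) * Θ (- η) H g)
          ≈⟨ *-congˡ (Θ-product H g y -η² 1≤H x≤H) ⟩
        C * C * (B x * A y + - η * q ^ g * (A x * B y))
          ≈⟨ *-congˡ (+-congˡ (trans (*-congʳ (trans (sym (-‿distribˡ-* _ _)) (-‿cong k≈))) (sym (-‿distribˡ-* _ _)))) ⟩
        C * C * (B x * A y - k * (A x * B y)) ∎
        where
        η = ε * ε′
        η² : IsSign η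
        η² = trans (interchange _ _ _ _) (trans (*-cong ε² ε′²) (*-identityˡ 1#))
        -η² : IsSign (- η)
        -η² = trans (solve 1 (λ x → :- x :* :- x := x :* x) refl η) η²

      join : ∀ {ε ε′ ε″} g h → IsSign ε′ → ε * ε″ * q ^ (g ℕ.+ h) ≈ ε * ε′ * q ^ g * (ε′ * ε″ * q ^ h)
      join {ε} {ε′} {ε″} g h ε′² = begin
        ε * ε″ * q ^ (g ℕ.+ h)                       ≈⟨ *-cong (sym (*-identityˡ _)) (^-homo-* q g h) ⟩
        1# * (ε * ε″) * (q ^ g * q ^ h)              ≈⟨ *-congʳ (*-congʳ (sym ε′²)) ⟩
        ε′ * ε′ * (ε * ε″) * (q ^ g * q ^ h)
          ≈⟨ solve 5 (λ e e′ e″ x y → e′ :* e′ :* (e :* e″) :* (x :* y) := e :* e′ :* x :* (e′ :* e″ :* y)) refl ε ε′ ε″ _ _ ⟩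
        ε * ε′ * q ^ g * (ε′ * ε″ * q ^ h)           ∎

      b≤H : b ≤ H
      b≤H = ℕₚ.≤-trans (ℕₚ.m≤n+m b u) a≤H
      c≤H : c ≤ H
      c≤H = ℕₚ.≤-trans (ℕₚ.m≤n+m c v) b≤H
      u+v+c : u ℕ.+ v ℕ.+ c ≡ a
      u+v+c = ℕₚ.+-assoc u v c
      v+w+d : v ℕ.+ w ℕ.+ d ≡ b
      v+w+d = ℕₚ.+-assoc v w d
      u+v+w+d : u ℕ.+ v ℕ.+ w ℕ.+ d ≡ a
      u+v+w+d = ≡.trans (ℕₚ.+-assoc (u ℕ.+ v) w d) u+v+c

      Fab = F u b a a² b² a≤H ≡.refl refl
      Fcd = F w d c c² d² c≤H ≡.refl refl
      Fbc = F v c b b² c² b≤H ≡.refl refl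
      Fac = F (u ℕ.+ v) c a a² c² (≡.subst (_≤ H) (≡.sym u+v+c) a≤H) u+v+c (join u v b²)
      Fbd = F (v ℕ.+ w) d b b² d² (≡.subst (_≤ H) (≡.sym v+w+d) b≤H) v+w+d (join v w c²)
      Fad = F (u ℕ.+ v ℕ.+ w) d a a² d² (≡.subst (_≤ H) (≡.sym u+v+w+d) a≤H) u+v+w+d
              (trans (join (u ℕ.+ v) w c²) (*-congʳ (join u v b²)))

-- Elimination between three Weierstrass relations

module Elimination {κ ℓ} (R : CommutativeRing κ ℓ) where
  open CommutativeRing R
  open import Relation.Binary.Reasoning.Setoid setoid
  open IntegerSolver R

  IsUnit : Carrier → Set _
  IsUnit x = ∃[ y ] y * x ≈ 1#

  unit-cancel : ∀ {x y z} → IsUnit x → x * y ≈ x * z → y ≈ z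
  unit-cancel {x} {y} {z} (x⁻¹ , inv) eq = begin
    y               ≈⟨ trans (sym (*-identityˡ y)) (*-congʳ (sym inv)) ⟩
    x⁻¹ * x * y     ≈⟨ trans (*-assoc _ _ _) (trans (*-congˡ eq) (sym (*-assoc _ _ _))) ⟩
    x⁻¹ * x * z     ≈⟨ trans (*-congʳ inv) (*-identityˡ z) ⟩
    z               ∎

  -- Here b j stands for [jk] and s j for [jk]₃₀ twisted by -1, where k is a fixed unit modulo 60.
  module _ (b s : ℕ → Carrier) {p₁ p₂ p₃ r₁ r₂ r₃ c₁ c₂ c₃ μ : Carrier}
    (units : IsUnit (b 4 * b 24))
    (units′ : IsUnit (b 26 * b 12))
    (unit₂₀ : IsUnit (b 20))
    (relation₁ : p₁ * (b 4 * b 5 * b 17 * b 24) + p₂ * (b 3 * b 4 * b 16 * b 25) + p₃ * (b 1 * b 8 * b 20 * b 21) ≈ 0#)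
    (relation₂ : r₁ * (b 8 * b 11 * b 23 * b 24) + r₂ * (b 3 * b 16 * b 28 * b 29) + r₃ * (b 5 * b 8 * b 20 * b 21) ≈ 0#)
    (relation₃ : c₁ * (s 13 * s 1 * s 6 * s 2) + c₂ * (s 13 * s 5 * s 10 * s 6)
                 + c₃ * ((b 4 * b 26) * (b 7 * b 23) * (b 11 * b 19) * (b 12 * b 18)) ≈ 0#)
    (s₁  : s 1 * (b 1 * b 29) ≈ b 2) (s₂ : s 2 * (b 2 * b 28) ≈ b 4) (s₅ : s 5 * (b 5 * b 25) ≈ b 10)
    (s₆  : s 6 * (b 6 * b 24) ≈ b 12) (s₁₀ : s 10 * (b 10 * b 20) ≈ b 20) (s₁₃ : s 13 * (b 13 * b 17) ≈ b 26)
    (μc₁ : p₂ * r₃ ≈ μ * c₁) (μc₂ : r₂ * p₃ ≈ - (μ * c₂))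
    where

    private
      -- Together with [4] [24] this is the product on the right of the reduced identity.
      rest : Carrier
      rest = (b 7 * b 23) * (b 11 * b 19) * b 18 * (b 5 * b 25) * (b 1 * b 29) * b 28 * (b 6) * (b 13 * b 17)

      s₁₀′ : s 10 * b 10 ≈ 1#
      s₁₀′ = unit-cancel unit₂₀ (trans (solve 3 (λ x y z → z :* (x :* y) := x :* (y :* z)) refl (s 10) (b 10) (b 20))
        (trans s₁₀ (sym (*-identityʳ _))))

      -- The duplications 1 → 2 → 4, 6 → 12 and 13 → 26 introduce the twisted brackets of the first
      -- term of `relation₃`.
      first : b 26 * b 12 * (c₁ * (b 4 * (b 5 * b 25)))
              ≈ (s 13 * (b 13 * b 17)) * (s 6 * (b 6 * b 24)) * (c₁ * (s 2 * ((s 1 * (b 1 * b 29)) * b 28) * (b 5 * b 25)))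
      first = *-cong (*-cong (sym s₁₃) (sym s₆)) (*-congˡ (*-congʳ (trans (sym s₂) (*-congˡ (*-congʳ (sym s₁))))))

      -- The inserted factor is 1: `s 5` turns [5] [25] into [10], and s 10 · [10] = 1 because 2 ·
      -- 10 = 30 - 10, so that [20] cancels in `s₁₀`.
      second : b 26 * b 12 * (c₂ * (b 1 * b 29 * b 28))
               ≈ (s 13 * (b 13 * b 17)) * (s 6 * (b 6 * b 24)) * (c₂ * ((s 10 * (s 5 * (b 5 * b 25))) * (b 1 * b 29 * b 28)))
      second = *-cong (*-cong (sym s₁₃) (sym s₆)) (*-congˡ (trans (sym (*-identityˡ _))
        (*-congʳ (sym (trans (*-congˡ s₅) s₁₀′)))))

      -- The reduced identity with general coefficients: `relation₃` times the common factor m,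
      -- after cancellation of [26] [12].
      relation₃′ : c₁ * (b 4 * (b 5 * b 25)) + c₂ * (b 1 * b 29 * b 28) + c₃ * (b 4 * b 24 * rest) ≈ 0#
      relation₃′ = unit-cancel units′ (begin
        b 26 * b 12 * (c₁ * (b 4 * (b 5 * b 25)) + c₂ * (b 1 * b 29 * b 28) + c₃ * (b 4 * b 24 * rest))
          ≈⟨ trans (distribˡ _ _ _) (+-congʳ (distribˡ _ _ _)) ⟩
        b 26 * b 12 * (c₁ * (b 4 * (b 5 * b 25))) + b 26 * b 12 * (c₂ * (b 1 * b 29 * b 28))
          + b 26 * b 12 * (c₃ * (b 4 * b 24 * rest))
          ≈⟨ +-congʳ (+-cong first second) ⟩
        (s 13 * (b 13 * b 17)) * (s 6 * (b 6 * b 24)) * (c₁ * (s 2 * ((s 1 * (b 1 * b 29)) * b 28) * (b 5 * b 25)))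
          + (s 13 * (b 13 * b 17)) * (s 6 * (b 6 * b 24)) * (c₂ * ((s 10 * (s 5 * (b 5 * b 25))) * (b 1 * b 29 * b 28)))
          + b 26 * b 12 * (c₃ * (b 4 * b 24 * rest))
          ≈⟨ +-cong
               (+-cong
                 (solve 11 (λ c s₁ s₂ s₆ s₁₃ x₁ x₅ b₂₈ b₆ b₂₄ x₁₃ →
                   (s₁₃ :* x₁₃) :* (s₆ :* (b₆ :* b₂₄)) :* (c :* (s₂ :* ((s₁ :* x₁) :* b₂₈) :* x₅))
                   := (x₁₃ :* (b₆ :* b₂₄) :* x₁ :* b₂₈ :* x₅) :* (c :* (s₁₃ :* s₁ :* s₆ :* s₂)))
                   refl c₁ (s 1) (s 2) (s 6) (s 13) (b 1 * b 29) (b 5 * b 25) (b 28) (b 6) (b 24) (b 13 * b 17))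
                 (solve 11 (λ c s₅ s₁₀ s₆ s₁₃ x₁ x₅ b₂₈ b₆ b₂₄ x₁₃ →
                   (s₁₃ :* x₁₃) :* (s₆ :* (b₆ :* b₂₄)) :* (c :* ((s₁₀ :* (s₅ :* x₅)) :* (x₁ :* b₂₈)))
                   := (x₁₃ :* (b₆ :* b₂₄) :* x₁ :* b₂₈ :* x₅) :* (c :* (s₁₃ :* s₅ :* s₁₀ :* s₆)))
                   refl c₂ (s 5) (s 10) (s 6) (s 13) (b 1 * b 29) (b 5 * b 25) (b 28) (b 6) (b 24) (b 13 * b 17)))
               (solve 13 (λ b₂₆ b₁₂ c b₄ b₂₄ x₇ x₁₁ b₁₈ x₅ x₁ b₂₈ b₆ x₁₃ →
                 b₂₆ :* b₁₂ :* (c :* (b₄ :* b₂₄ :* (x₇ :* x₁₁ :* b₁₈ :* x₅ :* x₁ :* b₂₈ :* b₆ :* x₁₃)))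
                 := (x₁₃ :* (b₆ :* b₂₄) :* x₁ :* b₂₈ :* x₅) :* (c :* ((b₄ :* b₂₆) :* x₇ :* x₁₁ :* (b₁₂ :* b₁₈))))
                 refl (b 26) (b 12) c₃ (b 4) (b 24) (b 7 * b 23) (b 11 * b 19) (b 18) (b 5 * b 25) (b 1 * b 29) (b 28) (b 6) (b 13 * b 17)) ⟩
        m * (c₁ * (s 13 * s 1 * s 6 * s 2)) + m * (c₂ * (s 13 * s 5 * s 10 * s 6))
          + m * (c₃ * ((b 4 * b 26) * (b 7 * b 23) * (b 11 * b 19) * (b 12 * b 18)))
          ≈⟨ trans (distribˡ _ _ _) (+-congʳ (distribˡ _ _ _)) ⟨
        m * (c₁ * (s 13 * s 1 * s 6 * s 2) + c₂ * (s 13 * s 5 * s 10 * s 6)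
          + c₃ * ((b 4 * b 26) * (b 7 * b 23) * (b 11 * b 19) * (b 12 * b 18)))
          ≈⟨ trans (*-congˡ relation₃) (zeroʳ m) ⟩
        0#
          ≈⟨ zeroʳ _ ⟨
        b 26 * b 12 * 0# ∎)
        where
        m = b 13 * b 17 * (b 6 * b 24) * (b 1 * b 29) * b 28 * (b 5 * b 25)

    -- Both of the first two relations have a term containing [3] [16]. Multiplying them by r₂ [28]
    -- [29] and p₂ [4] [25] and subtracting removes these terms. The last terms then combine to [8]
    -- [20] [21] times a combination of [4] [5] [25] and [1] [28] [29], which the conditions on `μ`
    -- make a multiple of the left part of `relation₃′`.
    elimination : r₂ * p₁ * (b 5 * b 17 * b 28 * b 29) - p₂ * r₁ * (b 8 * b 11 * b 23 * b 25)
                  ≈ - (μ * c₃) * (b 8 * b 20 * b 21 * rest)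
    elimination = unit-cancel units (begin
      b 4 * b 24 * (r₂ * p₁ * (b 5 * b 17 * b 28 * b 29) - p₂ * r₁ * (b 8 * b 11 * b 23 * b 25))
        ≈⟨ solve 21 (λ b₁ b₃ b₄ b₅ b₈ b₁₁ b₁₆ b₁₇ b₂₀ b₂₁ b₂₃ b₂₄ b₂₅ b₂₈ b₂₉ p₁ p₂ p₃ r₁ r₂ r₃ →
             b₄ :* b₂₄ :* (r₂ :* p₁ :* (b₅ :* b₁₇ :* b₂₈ :* b₂₉) :- p₂ :* r₁ :* (b₈ :* b₁₁ :* b₂₃ :* b₂₅))
             := r₂ :* (b₂₈ :* b₂₉) :* (p₁ :* (b₄ :* b₅ :* b₁₇ :* b₂₄) :+ p₂ :* (b₃ :* b₄ :* b₁₆ :* b₂₅) :+ p₃ :* (b₁ :* b₈ :* b₂₀ :* b₂₁))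
                :- p₂ :* (b₄ :* b₂₅) :* (r₁ :* (b₈ :* b₁₁ :* b₂₃ :* b₂₄) :+ r₂ :* (b₃ :* b₁₆ :* b₂₈ :* b₂₉) :+ r₃ :* (b₅ :* b₈ :* b₂₀ :* b₂₁))
                :+ b₈ :* b₂₀ :* b₂₁ :* (p₂ :* r₃ :* (b₄ :* (b₅ :* b₂₅)) :- r₂ :* p₃ :* (b₁ :* b₂₉ :* b₂₈)))
             refl (b 1) (b 3) (b 4) (b 5) (b 8) (b 11) (b 16) (b 17) (b 20) (b 21) (b 23) (b 24) (b 25) (b 28) (b 29) p₁ p₂ p₃ r₁ r₂ r₃ ⟩
      r₂ * (b 28 * b 29) * (p₁ * (b 4 * b 5 * b 17 * b 24) + p₂ * (b 3 * b 4 * b 16 * b 25) + p₃ * (b 1 * b 8 * b 20 * b 21))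
        - p₂ * (b 4 * b 25) * (r₁ * (b 8 * b 11 * b 23 * b 24) + r₂ * (b 3 * b 16 * b 28 * b 29) + r₃ * (b 5 * b 8 * b 20 * b 21))
        + b 8 * b 20 * b 21 * (p₂ * r₃ * x - r₂ * p₃ * y)
        ≈⟨ +-cong (+-cong (*-congˡ relation₁) (-‿cong (*-congˡ relation₂))) (*-congˡ (+-cong (*-congʳ μc₁) (-‿cong (*-congʳ μc₂)))) ⟩
      r₂ * (b 28 * b 29) * 0# - p₂ * (b 4 * b 25) * 0# + b 8 * b 20 * b 21 * (μ * c₁ * x - - (μ * c₂) * y)
        ≈⟨ solve 10 (λ u v t μ c₁ c₂ c₃ x y z →
             u :* con 0ℤ :- v :* con 0ℤ :+ t :* (μ :* c₁ :* x :- :- (μ :* c₂) :* y)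
             := t :* (μ :* (c₁ :* x :+ c₂ :* y :+ c₃ :* z)) :+ t :* (:- (μ :* c₃) :* z))
             refl _ _ (b 8 * b 20 * b 21) μ c₁ c₂ c₃ x y z ⟩
      b 8 * b 20 * b 21 * (μ * (c₁ * x + c₂ * y + c₃ * z)) + b 8 * b 20 * b 21 * (- (μ * c₃) * z)
        ≈⟨ +-congʳ (trans (*-congˡ (trans (*-congˡ relation₃′) (zeroʳ μ))) (zeroʳ _)) ⟩
      0# + b 8 * b 20 * b 21 * (- (μ * c₃) * z)
        ≈⟨ solve 4 (λ t u b r → con 0ℤ :+ t :* (u :* (b :* r)) := b :* (u :* (t :* r))) refl (b 8 * b 20 * b 21) (- (μ * c₃)) (b 4 * b 24) rest ⟩
      b 4 * b 24 * (- (μ * c₃) * (b 8 * b 20 * b 21 * rest)) ∎)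
      where
      x = b 4 * (b 5 * b 25)
      y = b 1 * b 29 * b 28
      z = b 4 * b 24 * rest

-- Products over lists of residues, compared through a normal form

insert : ℕ → List ℕ → List ℕ
insert x []       = x ∷ []
insert x (y ∷ ys) = if x ≤ᵇ y then x ∷ y ∷ ys else y ∷ insert x ys

sort : List ℕ → List ℕ
sort []       = []
sort (x ∷ xs) = insert x (sort xs)

-- The representative of {r , M - r} in [0 , M/2].
fold± : ℕ → ℕ → ℕ
fold± M r = if r ℕ.+ r ≤ᵇ M then r else M ∸ r

module ListProduct {κ ℓ} (R : CommutativeRing κ ℓ) where
  open CommutativeRing R
  open import Relation.Binary.Reasoning.Setoid setoid
  open import Algebra.Properties.CommutativeSemigroup *-commutativeSemigroup using (x∙yz≈y∙xz)
  open IntegerSolver R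

  listProduct : (ℕ → Carrier) → List ℕ → Carrier
  listProduct f []       = 1#
  listProduct f (r ∷ rs) = f r * listProduct f rs

  listProduct-++ : ∀ f rs ss → listProduct f (rs ++ ss) ≈ listProduct f rs * listProduct f ss
  listProduct-++ f []       ss = sym (*-identityˡ _)
  listProduct-++ f (r ∷ rs) ss = trans (*-congˡ (listProduct-++ f rs ss)) (sym (*-assoc _ _ _))

  listProduct₄ : ∀ f r s t u → listProduct f (r ∷ s ∷ t ∷ u ∷ []) ≈ f r * f s * f t * f u
  listProduct₄ f r s t u = solve 4 (λ r s t u → r :* (s :* (t :* (u :* con 1ℤ))) := r :* s :* t :* u) refl _ _ _ _

  insert-product : ∀ f x rs → listProduct f (insert x rs) ≈ f x * listProduct f rs
  insert-product f x []       = refl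
  insert-product f x (r ∷ rs) with x ≤ᵇ r
  ... | true  = refl
  ... | false = trans (*-congˡ (insert-product f x rs)) (x∙yz≈y∙xz _ _ _)

  sort-product : ∀ f rs → listProduct f (sort rs) ≈ listProduct f rs
  sort-product f []       = refl
  sort-product f (r ∷ rs) = trans (insert-product f r (sort rs)) (*-congˡ (sort-product f rs))

  private
    fold±-product : ∀ {f M} → (∀ r → r ≤ M → f r ≈ f (M ∸ r)) →
                    ∀ rs → T (all (_≤ᵇ M) rs) → listProduct f (map (fold± M) rs) ≈ listProduct f rs
    fold±-product reflect []       _    = refl
    fold±-product {f} {M} reflect (r ∷ rs) r≤M with Equivalence.to T-∧ r≤M
    ... | r≤M , rs≤M = *-cong step (fold±-product reflect rs rs≤M)
      where
      step : f (fold± M r) ≈ f r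
      step with r ℕ.+ r ≤ᵇ M
      ... | true  = refl
      ... | false = sym (reflect r (ℕₚ.≤ᵇ⇒≤ r M r≤M))

  -- The order of the factors and the symmetry r ↦ M - r are removed by computation: for closed
  -- lists the hypothesis on the sorted forms is `≡.refl`.
  listProduct-≈ : ∀ {f M} → (∀ r → r ≤ M → f r ≈ f (M ∸ r)) → ∀ rs ss →
                  {_ : T (all (_≤ᵇ M) rs)} {_ : T (all (_≤ᵇ M) ss)} →
                  sort (map (fold± M) rs) ≡ sort (map (fold± M) ss) → listProduct f rs ≈ listProduct f ss
  listProduct-≈ {f} {M} reflect rs ss {rs≤} {ss≤} eq = begin
    listProduct f rs                          ≈⟨ canonical rs rs≤ ⟨
    listProduct f (sort (map (fold± M) rs))   ≡⟨ ≡.cong (listProduct f) eq ⟩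
    listProduct f (sort (map (fold± M) ss))   ≈⟨ canonical ss ss≤ ⟩
    listProduct f ss                          ∎
    where
    canonical : ∀ rs → T (all (_≤ᵇ M) rs) → listProduct f (sort (map (fold± M) rs)) ≈ listProduct f rs
    canonical rs rs≤ = trans (sort-product f (map (fold± M) rs)) (fold±-product reflect rs rs≤)

-- Brackets modulo 60 and modulo 30

module Brackets {κ ℓ} (R : CommutativeRing κ ℓ) where
  open CommutativeRing R
  open import Algebra.Properties.Semiring.Exp semiring using (_^_; ^-homo-*; ^-congʳ; ^-assocʳ)
  open import Algebra.Properties.Ring ring using (-0#≈0#)
  open import Relation.Binary.Reasoning.Setoid setoid
  open import Algebra.Properties.CommutativeSemigroup *-commutativeSemigroup using (interchange)
  open IntegerSolver R
  open Summation R
  open Sum using () renaming (fold to sum)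
  open Product using () renaming (fold to product)
  open Elimination R
  open ListProduct R

  sgn : Sign → Carrier
  sgn Sign.+ = 1#
  sgn Sign.- = - 1#

  sgn-* : ∀ σ τ → sgn σ * sgn τ ≈ sgn (σ Sign.* τ)
  sgn-* Sign.+ τ      = *-identityˡ _
  sgn-* Sign.- Sign.+ = *-identityʳ _
  sgn-* Sign.- Sign.- = solve 0 (:- con 1ℤ :* :- con 1ℤ := con 1ℤ) refl

  isUnit-cong : ∀ {x y} → x ≈ y → IsUnit x → IsUnit y
  isUnit-cong x≈y (z , zx≈1) = z , trans (*-congˡ (sym x≈y)) zx≈1

  isUnit-* : ∀ {x y} → IsUnit x → IsUnit y → IsUnit (x * y)
  isUnit-* (x⁻¹ , p) (y⁻¹ , r) = x⁻¹ * y⁻¹ , trans (interchange _ _ _ _) (trans (*-cong p r) (*-identityˡ 1#))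

  isUnit-product : ∀ {f} n → (∀ k → IsUnit (f k)) → IsUnit (product f n)
  isUnit-product zero    u = 1# , *-identityˡ 1#
  isUnit-product (suc n) u = isUnit-* (isUnit-product n u) (u n)

  geometric : ∀ x n → sum (x ^_) n * (1# - x) ≈ 1# - x ^ n
  geometric x zero    = trans (zeroˡ _) (sym (-‿inverseʳ 1#))
  geometric x (suc n) = begin
    (sum (x ^_) n + x ^ n) * (1# - x)            ≈⟨ distribʳ _ _ _ ⟩
    sum (x ^_) n * (1# - x) + x ^ n * (1# - x)   ≈⟨ +-congʳ (geometric x n) ⟩
    1# - x ^ n + x ^ n * (1# - x)
      ≈⟨ solve 2 (λ x y → con 1ℤ :- y :+ y :* (con 1ℤ :- x) := con 1ℤ :- x :* y) refl x (x ^ n) ⟩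
    1# - x ^ suc n                               ∎

  module Truncated (q : Carrier) (N : ℕ) (q^-zero : ∀ m → N ≤ m → q ^ m ≈ 0#) (K : ℕ) (2N≤K : N ℕ.+ N ≤ K) where
    open ThetaFunctions.Truncated R q N q^-zero K 2N≤K using (IsSign; θ; weierstrass)

    -- The geometric series in q^m breaks off, since q is nilpotent and m ≥ 1.
    1-q^-unit : ∀ m → 1 ≤ m → IsUnit (1# - q ^ m)
    1-q^-unit m 1≤m = sum ((q ^ m) ^_) N , (begin
      sum ((q ^ m) ^_) N * (1# - q ^ m)   ≈⟨ geometric (q ^ m) N ⟩
      1# - (q ^ m) ^ N                    ≈⟨ +-congˡ (-‿cong (trans (^-assocʳ q m N) (q^-zero (m ℕ.* N)
                                               (ℕₚ.≤-trans (ℕₚ.≤-reflexive (≡.sym (ℕₚ.*-identityˡ N))) (ℕₚ.*-monoˡ-≤ N 1≤m))))) ⟩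
      1# - 0#                             ≈⟨ trans (+-congˡ -0#≈0#) (+-identityʳ 1#) ⟩
      1#                                  ∎)

    θ-cong : ∀ {ε ε′} H r → ε ≈ ε′ → θ ε H r ≈ θ ε′ H r
    θ-cong H r ε≈ε′ = Product.fold-cong K λ n → *-cong (side _ n) (side _ n)
      where
      side : ∀ x n → 1# - _ * x * _ ≈ 1# - _ * x * _
      side x n = +-congˡ (-‿cong (*-congʳ (*-congʳ ε≈ε′)))

    θ-reflect : ∀ ε H r → r ≤ H ℕ.+ H → θ ε H r ≈ θ ε H (H ℕ.+ H ∸ r)
    θ-reflect ε H r r≤2H = Product.fold-cong K λ n → trans (*-comm _ _)
      (*-congˡ (+-congˡ (-‿cong (*-congʳ (*-congˡ (^-congʳ q (≡.sym (ℕₚ.m∸[m∸n]≡n r≤2H))))))))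

    ϑ : Sign → ℕ → ℕ → Carrier
    ϑ σ = θ (sgn σ)

    ϑ-factor : ∀ H r n → 1# * q ^ r * (q ^ (H ℕ.+ H)) ^ n ≈ q ^ (r ℕ.+ (H ℕ.+ H) ℕ.* n)
    ϑ-factor H r n = trans (*-cong (*-identityˡ _) (^-assocʳ q (H ℕ.+ H) n)) (sym (^-homo-* q r _))

    ϑ-unit : ∀ H r → 1 ≤ r → r < H ℕ.+ H → IsUnit (ϑ Sign.+ H r)
    ϑ-unit H r 1≤r r<2H = isUnit-product K λ n → isUnit-* (factor r 1≤r n) (factor _ (ℕₚ.m<n⇒0<n∸m r<2H) n)
      where
      factor : ∀ s → 1 ≤ s → ∀ n → IsUnit (1# - 1# * q ^ s * (q ^ (H ℕ.+ H)) ^ n)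
      factor s 1≤s n = isUnit-cong (+-congˡ (-‿cong (sym (ϑ-factor H s n))))
        (1-q^-unit (s ℕ.+ (H ℕ.+ H) ℕ.* n) (ℕₚ.≤-trans 1≤s (ℕₚ.m≤m+n s _)))

    [_]₆₀ [_]₃₀ [_]₃₀⁻ : ℕ → Carrier
    [ r ]₆₀  = ϑ Sign.+ 30 r
    [ r ]₃₀  = ϑ Sign.+ 15 r
    [ r ]₃₀⁻ = ϑ Sign.- 15 r

    -- Factor by factor this is (1 + x) (1 - x) = 1 - x²; in terms of theta functions, θ(-z; Q) θ(z;
    -- Q) = θ(z²; Q²) with Q = q^30.
    double : ∀ r → r ≤ 30 → [ r ]₃₀⁻ * [ r ]₃₀ ≈ [ r ℕ.+ r ]₆₀
    double r r≤30 = trans (sym (Product.fold-∙ _ _ K)) (Product.fold-cong K λ n → begin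
      (1# - - 1# * q ^ r * (q ^ 30) ^ n) * (1# - - 1# * q ^ r′ * (q ^ 30) ^ n)
        * ((1# - 1# * q ^ r * (q ^ 30) ^ n) * (1# - 1# * q ^ r′ * (q ^ 30) ^ n))
        ≈⟨ solve 3 (λ x y z → let 𝟙 = con 1ℤ in
             (𝟙 :- :- 𝟙 :* x :* z) :* (𝟙 :- :- 𝟙 :* y :* z) :* ((𝟙 :- 𝟙 :* x :* z) :* (𝟙 :- 𝟙 :* y :* z))
             := (𝟙 :- 𝟙 :* (x :* x) :* (z :* z)) :* (𝟙 :- 𝟙 :* (y :* y) :* (z :* z))) refl (q ^ r) (q ^ r′) ((q ^ 30) ^ n) ⟩
      (1# - 1# * (q ^ r * q ^ r) * ((q ^ 30) ^ n * (q ^ 30) ^ n))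
        * (1# - 1# * (q ^ r′ * q ^ r′) * ((q ^ 30) ^ n * (q ^ 30) ^ n))
        ≈⟨ *-cong (square r (r ℕ.+ r) ≡.refl n) (square r′ (60 ∸ (r ℕ.+ r)) r′+r′ n) ⟩
      (1# - 1# * q ^ (r ℕ.+ r) * (q ^ 60) ^ n) * (1# - 1# * q ^ (60 ∸ (r ℕ.+ r)) * (q ^ 60) ^ n) ∎)
      where
      r′ = 30 ∸ r
      r′+r′ : r′ ℕ.+ r′ ≡ 60 ∸ (r ℕ.+ r)
      r′+r′ = ℕₚ.+-cancelˡ-≡ (r ℕ.+ r) _ _ (≡.trans (shuffle r r′)
        (≡.trans (≡.cong₂ ℕ._+_ (ℕₚ.m+[n∸m]≡n r≤30) (ℕₚ.m+[n∸m]≡n r≤30)) (≡.sym (ℕₚ.m+[n∸m]≡n (ℕₚ.+-mono-≤ r≤30 r≤30)))))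
        where
        open import Algebra.Properties.CommutativeSemigroup ℕₚ.+-commutativeSemigroup using () renaming (interchange to +-interchange)
        shuffle : ∀ r s → r ℕ.+ r ℕ.+ (s ℕ.+ s) ≡ r ℕ.+ s ℕ.+ (r ℕ.+ s)
        shuffle r s = +-interchange r r s s
      square : ∀ r s → r ℕ.+ r ≡ s → ∀ n → 1# - 1# * (q ^ r * q ^ r) * ((q ^ 30) ^ n * (q ^ 30) ^ n) ≈ 1# - 1# * q ^ s * (q ^ 60) ^ n
      square r s ≡.refl n = +-congˡ (-‿cong (*-cong (*-congˡ (sym (^-homo-* q r r))) (begin
        (q ^ 30) ^ n * (q ^ 30) ^ n                 ≈⟨ *-cong (^-assocʳ q 30 n) (^-assocʳ q 30 n) ⟩
        q ^ (30 ℕ.* n) * q ^ (30 ℕ.* n)             ≈⟨ ^-homo-* q (30 ℕ.* n) (30 ℕ.* n) ⟨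
        q ^ (30 ℕ.* n ℕ.+ 30 ℕ.* n)                 ≡⟨ ≡.cong (q ^_) (ℕₚ.*-distribʳ-+ n 30 30) ⟨
        q ^ (60 ℕ.* n)                              ≈⟨ ^-assocʳ q 60 n ⟨
        (q ^ 60) ^ n                                ∎)))

    -- The factors with even n have residues r and 30 - r modulo 60, those with odd n have 30 + r
    -- and 60 - r; r pairs with 60 - r, and 30 - r with 30 + r.
    dissection : ∀ r → r ≤ 30 → [ r ]₃₀ ≈ [ r ]₆₀ * [ 30 ∸ r ]₆₀
    dissection r r≤30 = begin
      product f K
        -- K factors of modulus 60 correspond to 2K factors of modulus 30; those from K on are 1
        -- because q^(30 k) vanishes.
        ≈⟨ Product.fold-stable f (ℕₚ.m≤m*n K 2) vanish ⟨
      product f (K ℕ.* 2)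
        ≈⟨ Product.fold-pairs f K ⟩
      product (λ n → f (n ℕ.* 2) * f (suc (n ℕ.* 2))) K
        ≈⟨ Product.fold-cong K (λ n → trans (*-cong (*-cong (even r n) (even r′ n)) (*-cong (odd r n) (odd r′ n)))
             (solve 4 (λ x y z w → x :* y :* (z :* w) := x :* w :* (y :* z)) refl _ _ _ _)) ⟩
      product (λ n → g r n * g (30 ℕ.+ r′) n * (g r′ n * g (30 ℕ.+ r) n)) K
        ≈⟨ Product.fold-∙ _ _ K ⟩
      product (λ n → g r n * g (30 ℕ.+ r′) n) K * product (λ n → g r′ n * g (30 ℕ.+ r) n) K
        ≡⟨ ≡.cong₂ (λ s t → product (λ n → g r n * g s n) K * product (λ n → g r′ n * g t n) K)
             (≡.sym (ℕₚ.+-∸-assoc 30 r≤30))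
             (≡.trans (≡.cong (30 ℕ.+_) (≡.sym (ℕₚ.m∸[m∸n]≡n r≤30))) (≡.sym (ℕₚ.+-∸-assoc 30 (ℕₚ.m∸n≤m 30 r)))) ⟩
      [ r ]₆₀ * [ r′ ]₆₀ ∎
      where
      r′ = 30 ∸ r
      h g : ℕ → ℕ → Carrier
      h s n = 1# - 1# * q ^ s * (q ^ 30) ^ n
      g s n = 1# - 1# * q ^ s * (q ^ 60) ^ n
      f : ℕ → Carrier
      f n = h r n * h r′ n
      q^30·2 : ∀ n → (q ^ 30) ^ (n ℕ.* 2) ≈ (q ^ 60) ^ n
      q^30·2 n = begin
        (q ^ 30) ^ (n ℕ.* 2)   ≈⟨ ^-assocʳ q 30 (n ℕ.* 2) ⟩
        q ^ (30 ℕ.* (n ℕ.* 2)) ≡⟨ ≡.cong (q ^_) (≡.trans (≡.cong (30 ℕ.*_) (ℕₚ.*-comm n 2)) (≡.sym (ℕₚ.*-assoc 30 2 n))) ⟩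
        q ^ (60 ℕ.* n)         ≈⟨ ^-assocʳ q 60 n ⟨
        (q ^ 60) ^ n           ∎
      even : ∀ s n → h s (n ℕ.* 2) ≈ g s n
      even s n = +-congˡ (-‿cong (*-congˡ (q^30·2 n)))
      odd : ∀ s n → h s (suc (n ℕ.* 2)) ≈ g (30 ℕ.+ s) n
      odd s n = +-congˡ (-‿cong (begin
        1# * q ^ s * (q ^ 30 * (q ^ 30) ^ (n ℕ.* 2))   ≈⟨ *-congˡ (*-congˡ (q^30·2 n)) ⟩
        1# * q ^ s * (q ^ 30 * (q ^ 60) ^ n)
          ≈⟨ solve 4 (λ o x y z → o :* x :* (y :* z) := o :* (y :* x) :* z) refl 1# (q ^ s) (q ^ 30) _ ⟩
        1# * (q ^ 30 * q ^ s) * (q ^ 60) ^ n           ≈⟨ *-congʳ (*-congˡ (^-homo-* q 30 s)) ⟨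
        1# * q ^ (30 ℕ.+ s) * (q ^ 60) ^ n             ∎))
      vanish : ∀ k → K ≤ k → f k ≈ 1#
      vanish k K≤k = trans (*-cong (one r) (one r′)) (*-identityˡ 1#)
        where
        one : ∀ s → h s k ≈ 1#
        one s = trans (+-congˡ (trans (-‿cong (trans (*-congˡ (trans (^-assocʳ q 30 k) (q^-zero (30 ℕ.* k)
            (ℕₚ.≤-trans (ℕₚ.m≤m+n N N) (ℕₚ.≤-trans 2N≤K (ℕₚ.≤-trans K≤k (ℕₚ.m≤n*m k 30))))))) (zeroʳ _))) -0#≈0#))
          (+-identityʳ 1#)

    -- Expresses the twisted bracket through brackets modulo 60 alone, as the quotient [2r] / ([r]
    -- [30 - r]) in multiplied form.
    twist : ∀ r → r ≤ 30 → [ r ]₃₀⁻ * ([ r ]₆₀ * [ 30 ∸ r ]₆₀) ≈ [ r ℕ.+ r ]₆₀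
    twist r r≤30 = trans (*-congˡ (sym (dissection r r≤30))) (double r r≤30)

    private
      pairUp : ∀ f r s t u → f r * f s * (f t * f u) ≈ listProduct f (r ∷ s ∷ t ∷ u ∷ [])
      pairUp f r s t u = solve 4 (λ r s t u → r :* s :* (t :* u) := r :* (s :* (t :* (u :* con 1ℤ)))) refl _ _ _ _

    -- The sign of the fourth point is the product of the other three, so that the two factors
    -- θ(xy) θ(x/y) of each term carry the same sign.
    weierstrass± : ∀ σa σb σc H u v w d {_ : T (1 ≤ᵇ H)} {_ : T (u ℕ.+ (v ℕ.+ (w ℕ.+ d)) ≤ᵇ H)} →
      let c = w ℕ.+ d
          b = v ℕ.+ c
      in
      sgn (σb Sign.* σc) * q ^ v
        * listProduct (ϑ (σa Sign.* σb) H) (u ℕ.+ b ℕ.+ b ∷ u ∷ w ℕ.+ d ℕ.+ d ∷ w ∷ [])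
      - listProduct (ϑ (σa Sign.* σc) H) (u ℕ.+ v ℕ.+ c ℕ.+ c ∷ u ℕ.+ v ∷ v ℕ.+ w ℕ.+ d ℕ.+ d ∷ v ℕ.+ w ∷ [])
      + listProduct (ϑ (σb Sign.* σc) H) (u ℕ.+ v ℕ.+ w ℕ.+ d ℕ.+ d ∷ u ℕ.+ v ℕ.+ w ∷ v ℕ.+ c ℕ.+ c ∷ v ∷ []) ≈ 0#
    weierstrass± σa σb σc H u v w d {1≤H} {a≤H} = trans
      (+-cong (+-cong (*-cong (*-congʳ (sign σb σc ≡.refl))
          (quad σa σb σc σd ≡.refl cd (u ℕ.+ b ℕ.+ b) u (w ℕ.+ d ℕ.+ d) w))
        (-‿cong (quad σa σc σb σd ≡.refl bd (u ℕ.+ v ℕ.+ c ℕ.+ c) (u ℕ.+ v) (v ℕ.+ w ℕ.+ d ℕ.+ d) (v ℕ.+ w))))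
        (quad σa σd σb σc ad ≡.refl (u ℕ.+ v ℕ.+ w ℕ.+ d ℕ.+ d) (u ℕ.+ v ℕ.+ w) (v ℕ.+ c ℕ.+ c) v))
      (weierstrass H u v w d (isSign σa) (isSign σb) (isSign σc) (isSign σd) (ℕₚ.≤ᵇ⇒≤ 1 H 1≤H) (ℕₚ.≤ᵇ⇒≤ _ H a≤H))
      where
      c = w ℕ.+ d
      b = v ℕ.+ c
      σd = σa Sign.* (σb Sign.* σc)
      cancel : ∀ σ τ → σ Sign.* (σ Sign.* τ) ≡ τ
      cancel σ τ = ≡.trans (≡.sym (Signₚ.*-assoc σ σ τ)) (≡.cong (Sign._* τ) (Signₚ.s*s≡+ σ))
      ad : σa Sign.* σd ≡ σb Sign.* σc
      ad = cancel σa (σb Sign.* σc)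
      bd : σb Sign.* σd ≡ σa Sign.* σc
      bd = ≡.trans (≡.cong (σb Sign.*_) (x∙yz≈y∙xz′ σa σb σc)) (cancel σb (σa Sign.* σc))
        where open import Algebra.Properties.CommutativeSemigroup Signₚ.*-commutativeSemigroup
                using () renaming (x∙yz≈y∙xz to x∙yz≈y∙xz′)
      cd : σc Sign.* σd ≡ σa Sign.* σb
      cd = ≡.trans (≡.cong (σc Sign.*_) (x∙yz≈z∙xy σa σb σc)) (cancel σc (σa Sign.* σb))
        where open import Algebra.Properties.CommutativeSemigroup Signₚ.*-commutativeSemigroup using (x∙yz≈z∙xy)
      isSign : ∀ σ → IsSign (sgn σ)
      isSign Sign.+ = sgn-* Sign.+ Sign.+
      isSign Sign.- = sgn-* Sign.- Sign.-
      sign : ∀ σ τ {ρ} → σ Sign.* τ ≡ ρ → sgn ρ ≈ sgn σ * sgn τ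
      sign σ τ ≡.refl = sym (sgn-* σ τ)
      quad : ∀ σ τ σ′ τ′ {ρ} → σ Sign.* τ ≡ ρ → σ′ Sign.* τ′ ≡ ρ → ∀ r s t u →
             listProduct (ϑ ρ H) (r ∷ s ∷ t ∷ u ∷ []) ≈
             θ (sgn σ * sgn τ) H r * θ (sgn σ * sgn τ) H s * (θ (sgn σ′ * sgn τ′) H t * θ (sgn σ′ * sgn τ′) H u)
      quad σ τ σ′ τ′ {ρ} eq eq′ r s t u = trans (sym (pairUp (ϑ ρ H) r s t u))
        (*-cong (*-cong (θ-cong H r (sign σ τ eq)) (θ-cong H s (sign σ τ eq)))
                (*-cong (θ-cong H t (sign σ′ τ′ eq′)) (θ-cong H u (sign σ′ τ′ eq′))))

-- The four product identities

S₁ T₁ S₂ T₂ S₃ T₃ S₄ T₄ : List ℕ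
S₁ = 1 ∷ 6 ∷ 7 ∷ 8 ∷ 11 ∷ 13 ∷ 18 ∷ 19 ∷ 20 ∷ 21 ∷ 23 ∷ 25 ∷ []
T₁ = 1 ∷ 5 ∷ 6 ∷ 7 ∷ 13 ∷ 17 ∷ 18 ∷ 19 ∷ 20 ∷ 21 ∷ 28 ∷ 29 ∷ []
S₂ = 4 ∷ 5 ∷ 6 ∷ 7 ∷ 11 ∷ 13 ∷ 17 ∷ 18 ∷ 19 ∷ 20 ∷ 27 ∷ 29 ∷ []
T₂ = 1 ∷ 6 ∷ 7 ∷ 11 ∷ 13 ∷ 16 ∷ 18 ∷ 20 ∷ 23 ∷ 25 ∷ 27 ∷ 29 ∷ []
S₃ = 5 ∷ 6 ∷ 7 ∷ 8 ∷ 9 ∷ 11 ∷ 17 ∷ 18 ∷ 19 ∷ 20 ∷ 23 ∷ 29 ∷ []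
T₃ = 1 ∷ 6 ∷ 9 ∷ 11 ∷ 13 ∷ 17 ∷ 18 ∷ 20 ∷ 23 ∷ 25 ∷ 28 ∷ 29 ∷ []
S₄ = 1 ∷ 3 ∷ 4 ∷ 6 ∷ 11 ∷ 13 ∷ 17 ∷ 18 ∷ 19 ∷ 20 ∷ 23 ∷ 25 ∷ []
T₄ = 1 ∷ 3 ∷ 5 ∷ 6 ∷ 7 ∷ 16 ∷ 17 ∷ 18 ∷ 19 ∷ 20 ∷ 23 ∷ 29 ∷ []

module Identities {κ ℓ} (R : CommutativeRing κ ℓ) where
  open CommutativeRing R
  open import Algebra.Properties.Semiring.Exp semiring using (_^_)
  open import Relation.Binary.Reasoning.Setoid setoid
  open IntegerSolver R
  open Elimination R
  open ListProduct R
  open Brackets R using (isUnit-*)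

  module Truncated (q : Carrier) (N : ℕ) (q^-zero : ∀ m → N ≤ m → q ^ m ≈ 0#) (K : ℕ) (2N≤K : N ℕ.+ N ≤ K) where
    open Brackets.Truncated R q N q^-zero K 2N≤K

    [_]′₆₀ : List ℕ → Carrier
    [_]′₆₀ = listProduct [_]₆₀

    reflect₆₀ : ∀ r → r ≤ 60 → [ r ]₆₀ ≈ [ 60 ∸ r ]₆₀
    reflect₆₀ = θ-reflect 1# 30

    same : ∀ rs ss → {_ : T (all (_≤ᵇ 60) rs)} {_ : T (all (_≤ᵇ 60) ss)} →
           sort (map (fold± 60) rs) ≡ sort (map (fold± 60) ss) → [ rs ]′₆₀ ≈ [ ss ]′₆₀
    same rs ss {p} {r} = listProduct-≈ reflect₆₀ rs ss {p} {r}

    unit₆₀ : ∀ r → {_ : T (1 ≤ᵇ r)} {_ : T (r <ᵇ 60)} → IsUnit [ r ]₆₀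
    unit₆₀ r {p} {l} = ϑ-unit 30 r (ℕₚ.≤ᵇ⇒≤ 1 r p) (ℕₚ.<ᵇ⇒< r 60 l)

    private
      single : ∀ f r → listProduct f (r ∷ []) ≈ f r
      single f r = *-identityʳ (f r)

      both : ∀ f r s → listProduct f (r ∷ s ∷ []) ≈ f r * f s
      both f r s = *-congˡ (*-identityʳ (f s))

      signed : ∀ {t x y z} → t * x - y + z ≈ 0# → t * x + - 1# * y + 1# * z ≈ 0#
      signed {t} {x} {y} {z} = trans (solve 3 (λ x y z → x :+ :- con 1ℤ :* y :+ con 1ℤ :* z := x :- y :+ z) refl (t * x) y z)

      swap₁₂ : ∀ {x y z} → x + y + z ≈ 0# → y + x + z ≈ 0#
      swap₁₂ = trans (+-congʳ (+-comm _ _))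

      swap₂₃ : ∀ {x y z} → x + y + z ≈ 0# → x + z + y ≈ 0#
      swap₂₃ = trans (solve 3 (λ x y z → x :+ z :+ y := x :+ y :+ z) refl _ _ _)

      replace : ∀ {p₁ p₂ p₃ x₁ x₂ x₃ y₁ y₂ y₃} → p₁ * x₁ + p₂ * x₂ + p₃ * x₃ ≈ 0# →
                y₁ ≈ x₁ → y₂ ≈ x₂ → y₃ ≈ x₃ → p₁ * y₁ + p₂ * y₂ + p₃ * y₃ ≈ 0#
      replace h e₁ e₂ e₃ = trans (+-cong (+-cong (*-congˡ e₁) (*-congˡ e₂)) (*-congˡ e₃)) h

      𝟙 : ∀ {n} → Polynomial n
      𝟙 = con 1ℤ

    module Multiple (k : ℕ) where
      -- The representatives of ±jk in [0, 30] modulo 60 and in [0, 15] modulo 30. The indices j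
      -- always refer to the case k = 1; multiplication by k happens only here.
      label label₃₀ : ℕ → ℕ
      label j   = fold± 60 (k ℕ.* j % 60)
      label₃₀ j = fold± 30 (k ℕ.* j % 30)

      b s : ℕ → Carrier
      b j = [ label j ]₆₀
      s j = [ label₃₀ j ]₃₀⁻

      four : ∀ i j l m rs → {_ : T (all (_≤ᵇ 60) (map label (i ∷ j ∷ l ∷ m ∷ [])))} {_ : T (all (_≤ᵇ 60) rs)} →
             sort (map (fold± 60) (map label (i ∷ j ∷ l ∷ m ∷ []))) ≡ sort (map (fold± 60) rs) →
             b i * b j * b l * b m ≈ [ rs ]′₆₀
      four i j l m rs {p} {r} eq = trans
        (sym (listProduct₄ [_]₆₀ (label i) (label j) (label l) (label m)))
        (same (map label (i ∷ j ∷ l ∷ m ∷ [])) rs {p} {r} eq)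

      four⁻ : ∀ i j l m rs → {_ : T (all (_≤ᵇ 30) (map label₃₀ (i ∷ j ∷ l ∷ m ∷ [])))} {_ : T (all (_≤ᵇ 30) rs)} →
             sort (map (fold± 30) (map label₃₀ (i ∷ j ∷ l ∷ m ∷ []))) ≡ sort (map (fold± 30) rs) →
             s i * s j * s l * s m ≈ listProduct [_]₃₀⁻ rs
      four⁻ i j l m rs {p} {r} eq = trans (sym (listProduct₄ [_]₃₀⁻ (label₃₀ i) (label₃₀ j) (label₃₀ l) (label₃₀ m)))
        (listProduct-≈ (θ-reflect (- 1#) 15) (map label₃₀ (i ∷ j ∷ l ∷ m ∷ [])) rs {p} {r} eq)

      -- In one term of the relation with Q = q^30 the signs of the points cancel, so its theta
      -- factors are untwisted; `dissection` splits each of them into two brackets modulo 60.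
      eight : ∀ x y z w →
        {_ : T (x ≤ᵇ 30)} {_ : T (y ≤ᵇ 30)} {_ : T (z ≤ᵇ 30)} {_ : T (w ≤ᵇ 30)} →
        let js = map label (4 ∷ 26 ∷ 7 ∷ 23 ∷ 11 ∷ 19 ∷ 12 ∷ 18 ∷ [])
            rs = x ∷ 30 ∸ x ∷ y ∷ 30 ∸ y ∷ z ∷ 30 ∸ z ∷ w ∷ 30 ∸ w ∷ []
        in {_ : T (all (_≤ᵇ 60) js)} {_ : T (all (_≤ᵇ 60) rs)} →
        sort (map (fold± 60) js) ≡ sort (map (fold± 60) rs) →
        (b 4 * b 26) * (b 7 * b 23) * (b 11 * b 19) * (b 12 * b 18) ≈ listProduct [_]₃₀ (x ∷ y ∷ z ∷ w ∷ [])
      eight x y z w {x≤} {y≤} {z≤} {w≤} {p} {r} eq = begin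
        (b 4 * b 26) * (b 7 * b 23) * (b 11 * b 19) * (b 12 * b 18)
          ≈⟨ nested (b 4) (b 26) (b 7) (b 23) (b 11) (b 19) (b 12) (b 18) ⟩
        [ map label (4 ∷ 26 ∷ 7 ∷ 23 ∷ 11 ∷ 19 ∷ 12 ∷ 18 ∷ []) ]′₆₀
          ≈⟨ same (map label (4 ∷ 26 ∷ 7 ∷ 23 ∷ 11 ∷ 19 ∷ 12 ∷ 18 ∷ []))
               (x ∷ 30 ∸ x ∷ y ∷ 30 ∸ y ∷ z ∷ 30 ∸ z ∷ w ∷ 30 ∸ w ∷ []) {p} {r} eq ⟩
        [ x ∷ 30 ∸ x ∷ y ∷ 30 ∸ y ∷ z ∷ 30 ∸ z ∷ w ∷ 30 ∸ w ∷ [] ]′₆₀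
          ≈⟨ nested [ x ]₆₀ [ 30 ∸ x ]₆₀ [ y ]₆₀ [ 30 ∸ y ]₆₀ [ z ]₆₀ [ 30 ∸ z ]₆₀ [ w ]₆₀ [ 30 ∸ w ]₆₀ ⟨
        ([ x ]₆₀ * [ 30 ∸ x ]₆₀) * ([ y ]₆₀ * [ 30 ∸ y ]₆₀) * ([ z ]₆₀ * [ 30 ∸ z ]₆₀) * ([ w ]₆₀ * [ 30 ∸ w ]₆₀)
          ≈⟨ *-cong (*-cong (*-cong (dissection x (ℕₚ.≤ᵇ⇒≤ x 30 x≤)) (dissection y (ℕₚ.≤ᵇ⇒≤ y 30 y≤)))
               (dissection z (ℕₚ.≤ᵇ⇒≤ z 30 z≤))) (dissection w (ℕₚ.≤ᵇ⇒≤ w 30 w≤)) ⟨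
        [ x ]₃₀ * [ y ]₃₀ * [ z ]₃₀ * [ w ]₃₀
          ≈⟨ listProduct₄ [_]₃₀ x y z w ⟨
        listProduct [_]₃₀ (x ∷ y ∷ z ∷ w ∷ []) ∎
        where
        nested : ∀ a b c d e f g h → (a * b) * (c * d) * (e * f) * (g * h) ≈ a * (b * (c * (d * (e * (f * (g * (h * 1#)))))))
        nested = solve 8 (λ a b c d e f g h → (a :* b) :* (c :* d) :* (e :* f) :* (g :* h)
          := a :* (b :* (c :* (d :* (e :* (f :* (g :* (h :* con 1ℤ)))))))) refl

      -- Put r = `label₃₀ j`. For odd k the brackets [jk] and [(30 - j)k] are [r] and [30 - r] in
      -- one order or the other, and 2jk ≡ ±2r modulo 60; this is why unordered pairs are compared.
      twisted : ∀ j → {_ : T (label₃₀ j ≤ᵇ 30)} →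
        {_ : T (all (_≤ᵇ 60) (map label (j ∷ 30 ∸ j ∷ [])))} {_ : T (all (_≤ᵇ 60) (label₃₀ j ∷ 30 ∸ label₃₀ j ∷ []))}
        {_ : T (all (_≤ᵇ 60) (map label (j ℕ.+ j ∷ [])))} {_ : T (all (_≤ᵇ 60) (label₃₀ j ℕ.+ label₃₀ j ∷ []))} →
        sort (map (fold± 60) (map label (j ∷ 30 ∸ j ∷ []))) ≡ sort (map (fold± 60) (label₃₀ j ∷ 30 ∸ label₃₀ j ∷ [])) →
        sort (map (fold± 60) (label₃₀ j ℕ.+ label₃₀ j ∷ [])) ≡ sort (map (fold± 60) (map label (j ℕ.+ j ∷ []))) →
        s j * (b j * b (30 ∸ j)) ≈ b (j ℕ.+ j)
      twisted j {j≤} {p₁} {p₂} {p₃} {p₄} eq eq′ = begin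
        s j * (b j * b (30 ∸ j))
          ≈⟨ *-congˡ (trans (sym (both [_]₆₀ (label j) (label (30 ∸ j))))
               (trans (same (map label (j ∷ 30 ∸ j ∷ [])) (r ∷ 30 ∸ r ∷ []) {p₁} {p₂} eq) (both [_]₆₀ r (30 ∸ r)))) ⟩
        s j * ([ r ]₆₀ * [ 30 ∸ r ]₆₀)   ≈⟨ twist r (ℕₚ.≤ᵇ⇒≤ r 30 j≤) ⟩
        [ r ℕ.+ r ]₆₀
          ≈⟨ trans (sym (single [_]₆₀ (r ℕ.+ r))) (trans (same (r ℕ.+ r ∷ []) (map label (j ℕ.+ j ∷ [])) {p₄} {p₃} eq′)
               (single [_]₆₀ (label (j ℕ.+ j)))) ⟩
        b (j ℕ.+ j)                      ∎
        where r = label₃₀ j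

      A B C : List ℕ
      A = map label (5 ∷ 17 ∷ 28 ∷ 29 ∷ [])
      B = map label (8 ∷ 11 ∷ 23 ∷ 25 ∷ [])
      C = map label (1 ∷ 6 ∷ 7 ∷ 13 ∷ 18 ∷ 19 ∷ 20 ∷ 21 ∷ [])

      private
        cofactor : Carrier
        cofactor = b 8 * b 20 * b 21
          * ((b 7 * b 23) * (b 11 * b 19) * b 18 * (b 5 * b 25) * (b 1 * b 29) * b 28 * b 6 * (b 13 * b 17))

        -- The sixteen brackets are those of `C`, `A` and `B`, each once. One further factor [C]
        -- then produces [S] [U] on the right.
        regroup : ∀ b₁ b₅ b₆ b₇ b₈ b₁₁ b₁₃ b₁₇ b₁₈ b₁₉ b₂₀ b₂₁ b₂₃ b₂₅ b₂₈ b₂₉ →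
          b₈ * b₂₀ * b₂₁ * ((b₇ * b₂₃) * (b₁₁ * b₁₉) * b₁₈ * (b₅ * b₂₅) * (b₁ * b₂₉) * b₂₈ * b₆ * (b₁₃ * b₁₇))
          ≈ (b₁ * (b₆ * (b₇ * (b₁₃ * (b₁₈ * (b₁₉ * (b₂₀ * (b₂₁ * 1#))))))))
            * ((b₅ * (b₁₇ * (b₂₈ * (b₂₉ * 1#)))) * (b₈ * (b₁₁ * (b₂₃ * (b₂₅ * 1#)))))
        regroup = solve 16 (λ b₁ b₅ b₆ b₇ b₈ b₁₁ b₁₃ b₁₇ b₁₈ b₁₉ b₂₀ b₂₁ b₂₃ b₂₅ b₂₈ b₂₉ → let 𝟙 = con 1ℤ in
          b₈ :* b₂₀ :* b₂₁ :* ((b₇ :* b₂₃) :* (b₁₁ :* b₁₉) :* b₁₈ :* (b₅ :* b₂₅) :* (b₁ :* b₂₉) :* b₂₈ :* b₆ :* (b₁₃ :* b₁₇))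
          := (b₁ :* (b₆ :* (b₇ :* (b₁₃ :* (b₁₈ :* (b₁₉ :* (b₂₀ :* (b₂₁ :* 𝟙))))))))
            :* ((b₅ :* (b₁₇ :* (b₂₈ :* (b₂₉ :* 𝟙)))) :* (b₈ :* (b₁₁ :* (b₂₃ :* (b₂₅ :* 𝟙)))))) refl

      -- [S] and [U] have the common part [C], and their cofactors are [B] and [A].
      conclude : ∀ S U a e {x y z} σ → σ * x ≈ 1# → σ * y ≈ q ^ a → σ * z ≈ q ^ e →
                 {S≤ : T (all (_≤ᵇ 60) S)} {U≤ : T (all (_≤ᵇ 60) U)}
                 {CB≤ : T (all (_≤ᵇ 60) (C ++ B))} {CA≤ : T (all (_≤ᵇ 60) (C ++ A))} →
                 sort (map (fold± 60) S) ≡ sort (map (fold± 60) (C ++ B)) →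
                 sort (map (fold± 60) U) ≡ sort (map (fold± 60) (C ++ A)) →
                 x * (b 5 * b 17 * b 28 * b 29) - y * (b 8 * b 11 * b 23 * b 25) ≈ z * cofactor →
                 [ U ]′₆₀ - q ^ a * [ S ]′₆₀ ≈ q ^ e * ([ S ]′₆₀ * [ U ]′₆₀)
      conclude S U a e {x} {y} {z} σ σx σy σz {S≤} {U≤} {CB≤} {CA≤} S≡ U≡ h = begin
        [ U ]′₆₀ - q ^ a * [ S ]′₆₀
          ≈⟨ +-cong (trans (sym (*-identityˡ _)) (*-cong (sym σx) U≈)) (-‿cong (*-cong (sym σy) S≈)) ⟩
        σ * x * ([ C ]′₆₀ * [ A ]′₆₀) - σ * y * ([ C ]′₆₀ * [ B ]′₆₀)
          ≈⟨ solve 6 (λ σ x y c a b → σ :* x :* (c :* a) :- σ :* y :* (c :* b) := σ :* c :* (x :* a :- y :* b))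
               refl σ x y [ C ]′₆₀ [ A ]′₆₀ [ B ]′₆₀ ⟩
        σ * [ C ]′₆₀ * (x * [ A ]′₆₀ - y * [ B ]′₆₀)
          ≈⟨ *-congˡ (trans (+-cong (*-congˡ (listProduct₄ [_]₆₀ (label 5) (label 17) (label 28) (label 29)))
               (-‿cong (*-congˡ (listProduct₄ [_]₆₀ (label 8) (label 11) (label 23) (label 25))))) h) ⟩
        σ * [ C ]′₆₀ * (z * cofactor)
          ≈⟨ *-congˡ (*-congˡ (regroup (b 1) (b 5) (b 6) (b 7) (b 8) (b 11) (b 13) (b 17)
               (b 18) (b 19) (b 20) (b 21) (b 23) (b 25) (b 28) (b 29))) ⟩
        σ * [ C ]′₆₀ * (z * ([ C ]′₆₀ * ([ A ]′₆₀ * [ B ]′₆₀)))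
          ≈⟨ solve 5 (λ σ z c a b → σ :* c :* (z :* (c :* (a :* b))) := σ :* z :* ((c :* b) :* (c :* a)))
               refl σ z [ C ]′₆₀ [ A ]′₆₀ [ B ]′₆₀ ⟩
        σ * z * (([ C ]′₆₀ * [ B ]′₆₀) * ([ C ]′₆₀ * [ A ]′₆₀))
          ≈⟨ *-cong σz (*-cong (sym S≈) (sym U≈)) ⟩
        q ^ e * ([ S ]′₆₀ * [ U ]′₆₀) ∎
        where
        S≈ : [ S ]′₆₀ ≈ [ C ]′₆₀ * [ B ]′₆₀
        S≈ = trans (same S (C ++ B) {S≤} {CB≤} S≡) (listProduct-++ [_]₆₀ C B)
        U≈ : [ U ]′₆₀ ≈ [ C ]′₆₀ * [ A ]′₆₀
        U≈ = trans (same U (C ++ A) {U≤} {CA≤} U≡) (listProduct-++ [_]₆₀ C A)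

      units₁ : {_ : T (1 ≤ᵇ label 4)} {_ : T (label 4 <ᵇ 60)} {_ : T (1 ≤ᵇ label 24)} {_ : T (label 24 <ᵇ 60)} →
               IsUnit (b 4 * b 24)
      units₁ {p} {p′} {r} {r′} = isUnit-* (unit₆₀ (label 4) {p} {p′}) (unit₆₀ (label 24) {r} {r′})

      units₂ : {_ : T (1 ≤ᵇ label 26)} {_ : T (label 26 <ᵇ 60)} {_ : T (1 ≤ᵇ label 12)} {_ : T (label 12 <ᵇ 60)} →
               IsUnit (b 26 * b 12)
      units₂ {p} {p′} {r} {r′} = isUnit-* (unit₆₀ (label 26) {p} {p′}) (unit₆₀ (label 12) {r} {r′})

    -- The numbers after the half modulus are three gaps and the least exponent: 3 1 4 6 encodes 14,
    -- 11, 10, 6. The swaps put the terms into the order that `elimination` expects.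
    identity₁ : [ T₁ ]′₆₀ - q ^ 1 * [ S₁ ]′₆₀ ≈ q ^ 0 * ([ S₁ ]′₆₀ * [ T₁ ]′₆₀)
    identity₁ = conclude S₁ T₁ 1 0 (- 1#)
      (solve 1 (λ q → :- 𝟙 :* (𝟙 :* (:- 𝟙)) := 𝟙) refl q)
      (solve 1 (λ q → :- 𝟙 :* ((𝟙 :* q :^ 1) :* (:- 𝟙)) := q :^ 1) refl q)
      (solve 1 (λ q → :- 𝟙 :* :- (𝟙 :* 𝟙) := q :^ 0) refl q)
      ≡.refl ≡.refl
      (elimination b s units₁ units₂ (unit₆₀ (label 20))
        (replace (swap₁₂ (signed (weierstrass± Sign.+ Sign.+ Sign.+ 30 3 1 4 6)))
          (four 4 5 17 24 (24 ∷ 4 ∷ 17 ∷ 5 ∷ []) ≡.refl)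
          (four 3 4 16 25 (25 ∷ 3 ∷ 16 ∷ 4 ∷ []) ≡.refl)
          (four 1 8 20 21 (20 ∷ 8 ∷ 21 ∷ 1 ∷ []) ≡.refl))
        (replace (swap₂₃ (swap₁₂ (signed (weierstrass± Sign.+ Sign.+ Sign.+ 30 5 3 8 6))))
          (four 8 11 23 24 (36 ∷ 8 ∷ 23 ∷ 11 ∷ []) ≡.refl)
          (four 3 16 28 29 (28 ∷ 16 ∷ 31 ∷ 3 ∷ []) ≡.refl)
          (four 5 8 20 21 (39 ∷ 5 ∷ 20 ∷ 8 ∷ []) ≡.refl))
        (replace (signed (weierstrass± Sign.+ Sign.- Sign.- 15 1 4 2 2))
          (four⁻ 13 1 6 2 (17 ∷ 1 ∷ 6 ∷ 2 ∷ []) ≡.refl)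
          (four⁻ 13 5 10 6 (13 ∷ 5 ∷ 10 ∷ 6 ∷ []) ≡.refl)
          (eight 11 7 12 4 ≡.refl))
        (twisted 1 ≡.refl ≡.refl) (twisted 2 ≡.refl ≡.refl) (twisted 5 ≡.refl ≡.refl)
        (twisted 6 ≡.refl ≡.refl) (twisted 10 ≡.refl ≡.refl) (twisted 13 ≡.refl ≡.refl)
        -- Here μ = 1: p₂ r₃ = q · q³ = c₁ and r₂ p₃ = 1 = -c₂.
        (solve 1 (λ q → (𝟙 :* q :^ 1) :* (𝟙 :* q :^ 3) := 𝟙 :* (𝟙 :* q :^ 4)) refl q)
        (solve 1 (λ q → 𝟙 :* 𝟙 := :- (𝟙 :* (:- 𝟙))) refl q))
      where open Multiple 1

    -- The exponents are 7 times those for k = 1, reduced up to sign: 6, 10, 11, 14 become 18, 10,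
    -- 17, 22 and 6, 14, 17, 22 become 18, 22, 1, 26 modulo 60; 2, 4, 8, 9 become 14, 2, 4, 3 modulo
    -- 30, each keeping its sign as a point.
    identity₂ : [ T₂ ]′₆₀ - q ^ 4 * [ S₂ ]′₆₀ ≈ q ^ 0 * ([ S₂ ]′₆₀ * [ T₂ ]′₆₀)
    identity₂ = conclude S₂ T₂ 4 0 (- 1#)
      (solve 1 (λ q → :- 𝟙 :* ((:- 𝟙) :* 𝟙) := 𝟙) refl q)
      (solve 1 (λ q → :- 𝟙 :* ((:- 𝟙) :* (𝟙 :* q :^ 4)) := q :^ 4) refl q)
      (solve 1 (λ q → :- 𝟙 :* :- ((:- 𝟙) :* (:- 𝟙)) := q :^ 0) refl q)
      ≡.refl ≡.refl
      (elimination b s units₁ units₂ (unit₆₀ (label 20))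
        (replace (swap₁₂ (swap₂₃ (swap₁₂ (signed (weierstrass± Sign.+ Sign.+ Sign.+ 30 4 1 7 10)))))
          (four 4 5 17 24 (32 ∷ 12 ∷ 35 ∷ 1 ∷ []) ≡.refl)
          (four 3 4 16 25 (39 ∷ 5 ∷ 28 ∷ 8 ∷ []) ≡.refl)
          (four 1 8 20 21 (40 ∷ 4 ∷ 27 ∷ 7 ∷ []) ≡.refl))
        (replace (signed (weierstrass± Sign.+ Sign.+ Sign.+ 30 4 4 17 1))
          (four 8 11 23 24 (48 ∷ 4 ∷ 19 ∷ 17 ∷ []) ≡.refl)
          (four 3 16 28 29 (44 ∷ 8 ∷ 23 ∷ 21 ∷ []) ≡.refl)
          (four 5 8 20 21 (27 ∷ 25 ∷ 40 ∷ 4 ∷ []) ≡.refl))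
        (replace (swap₁₂ (swap₂₃ (signed (weierstrass± Sign.+ Sign.- Sign.+ 15 10 1 1 2))))
          (four⁻ 13 1 6 2 (16 ∷ 12 ∷ 7 ∷ 1 ∷ []) ≡.refl)
          (four⁻ 13 5 10 6 (18 ∷ 10 ∷ 5 ∷ 1 ∷ []) ≡.refl)
          (eight 17 11 6 2 ≡.refl))
        (twisted 1 ≡.refl ≡.refl) (twisted 2 ≡.refl ≡.refl) (twisted 5 ≡.refl ≡.refl)
        (twisted 6 ≡.refl ≡.refl) (twisted 10 ≡.refl ≡.refl) (twisted 13 ≡.refl ≡.refl)
        (solve 1 (λ q → (:- 𝟙) :* 𝟙 := (:- 𝟙) :* 𝟙) refl q)
        (solve 1 (λ q → (:- 𝟙) :* (𝟙 :* q :^ 1) := :- ((:- 𝟙) :* (:- 𝟙 :* q :^ 1))) refl q))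
      where open Multiple 7

    -- Multiplication by 29 fixes the even exponents up to sign and sends 11 to 19 and 17 to 13. As
    -- 29 ≡ -1 modulo 30, the third relation is that of `identity₁`.
    identity₃ : [ T₃ ]′₆₀ - q ^ 5 * [ S₃ ]′₆₀ ≈ q ^ 0 * ([ S₃ ]′₆₀ * [ T₃ ]′₆₀)
    identity₃ = conclude S₃ T₃ 5 0 1#
      (solve 1 (λ q → 𝟙 :* (𝟙 :* 𝟙) := 𝟙) refl q)
      (solve 1 (λ q → 𝟙 :* ((𝟙 :* q :^ 4) :* (𝟙 :* q :^ 1)) := q :^ 5) refl q)
      (solve 1 (λ q → 𝟙 :* :- ((:- 𝟙) :* 𝟙) := q :^ 0) refl q)
      ≡.refl ≡.refl
      (elimination b s units₁ units₂ (unit₆₀ (label 20))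
        (replace (swap₁₂ (swap₂₃ (signed (weierstrass± Sign.+ Sign.+ Sign.+ 30 5 4 4 6))))
          (four 4 5 17 24 (25 ∷ 13 ∷ 24 ∷ 4 ∷ []) ≡.refl)
          (four 3 4 16 25 (33 ∷ 5 ∷ 16 ∷ 4 ∷ []) ≡.refl)
          (four 1 8 20 21 (29 ∷ 9 ∷ 20 ∷ 8 ∷ []) ≡.refl))
        (replace (swap₂₃ (signed (weierstrass± Sign.+ Sign.+ Sign.+ 30 8 1 7 6)))
          (four 8 11 23 24 (36 ∷ 8 ∷ 19 ∷ 7 ∷ []) ≡.refl)
          (four 3 16 28 29 (28 ∷ 16 ∷ 27 ∷ 1 ∷ []) ≡.refl)
          (four 5 8 20 21 (35 ∷ 9 ∷ 20 ∷ 8 ∷ []) ≡.refl))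
        (replace (signed (weierstrass± Sign.+ Sign.- Sign.- 15 1 4 2 2))
          (four⁻ 13 1 6 2 (17 ∷ 1 ∷ 6 ∷ 2 ∷ []) ≡.refl)
          (four⁻ 13 5 10 6 (13 ∷ 5 ∷ 10 ∷ 6 ∷ []) ≡.refl)
          (eight 11 7 12 4 ≡.refl))
        (twisted 1 ≡.refl ≡.refl) (twisted 2 ≡.refl ≡.refl) (twisted 5 ≡.refl ≡.refl)
        (twisted 6 ≡.refl ≡.refl) (twisted 10 ≡.refl ≡.refl) (twisted 13 ≡.refl ≡.refl)
        (solve 1 (λ q → (𝟙 :* q :^ 4) :* (:- 𝟙) := (:- 𝟙) :* (𝟙 :* q :^ 4)) refl q)
        (solve 1 (λ q → 𝟙 :* (:- 𝟙) := :- ((:- 𝟙) :* (:- 𝟙))) refl q))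
      where open Multiple 29

    -- Multiplication by 23 gives 18, 10, 13, 22 and 18, 22, 29, 26 modulo 60. As 23 ≡ -7 modulo 30,
    -- the third relation is that of `identity₂`.
    identity₄ : [ T₄ ]′₆₀ - q ^ 0 * [ S₄ ]′₆₀ ≈ q ^ 4 * ([ S₄ ]′₆₀ * [ T₄ ]′₆₀)
    identity₄ = conclude S₄ T₄ 0 4 (- 1#)
      (solve 1 (λ q → :- 𝟙 :* ((:- 𝟙) :* 𝟙) := 𝟙) refl q)
      (solve 1 (λ q → :- 𝟙 :* ((:- 𝟙) :* 𝟙) := q :^ 0) refl q)
      -- Only in this case is μ more than a sign: μ = -q^4, and this is the origin of the
      -- exceptional n = 4.
      (solve 1 (λ q → :- 𝟙 :* :- ((:- q :^ 4) :* (:- 𝟙)) := q :^ 4) refl q)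
      ≡.refl ≡.refl
      (elimination b s units₁ units₂ (unit₆₀ (label 20))
        (replace (swap₁₂ (swap₂₃ (swap₁₂ (signed (weierstrass± Sign.+ Sign.+ Sign.+ 30 4 5 3 10)))))
          (four 4 5 17 24 (32 ∷ 12 ∷ 31 ∷ 5 ∷ []) ≡.refl)
          (four 3 4 16 25 (35 ∷ 9 ∷ 28 ∷ 8 ∷ []) ≡.refl)
          (four 1 8 20 21 (40 ∷ 4 ∷ 23 ∷ 3 ∷ []) ≡.refl))
        (replace (swap₁₂ (swap₂₃ (swap₁₂ (signed (weierstrass± Sign.+ Sign.+ Sign.+ 30 3 4 4 18)))))
          (four 8 11 23 24 (47 ∷ 11 ∷ 48 ∷ 4 ∷ []) ≡.refl)
          (four 3 16 28 29 (51 ∷ 7 ∷ 44 ∷ 8 ∷ []) ≡.refl)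
          (four 5 8 20 21 (55 ∷ 3 ∷ 40 ∷ 4 ∷ []) ≡.refl))
        (replace (swap₁₂ (swap₂₃ (signed (weierstrass± Sign.+ Sign.- Sign.+ 15 10 1 1 2))))
          (four⁻ 13 1 6 2 (16 ∷ 12 ∷ 7 ∷ 1 ∷ []) ≡.refl)
          (four⁻ 13 5 10 6 (18 ∷ 10 ∷ 5 ∷ 1 ∷ []) ≡.refl)
          (eight 17 11 6 2 ≡.refl))
        (twisted 1 ≡.refl ≡.refl) (twisted 2 ≡.refl ≡.refl) (twisted 5 ≡.refl ≡.refl)
        (twisted 6 ≡.refl ≡.refl) (twisted 10 ≡.refl ≡.refl) (twisted 13 ≡.refl ≡.refl)
        (solve 1 (λ q → (:- 𝟙) :* (𝟙 :* q :^ 4) := (:- q :^ 4) :* 𝟙) refl q)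
        (solve 1 (λ q → (:- 𝟙) :* (𝟙 :* q :^ 5) := :- ((:- q :^ 4) :* (:- 𝟙 :* q :^ 1))) refl q))
      where open Multiple 23

-- Integer power series modulo q^N

Series : Set
Series = ℕ → ℤ

infixl 6 _⊕_
infixl 7 _⊛_

_⊕_ _⊛_ : Series → Series → Series
(f ⊕ g) n = f n ℤ.+ g n
(f ⊛ g) zero    = f 0 ℤ.* g 0
(f ⊛ g) (suc n) = f 0 ℤ.* g (suc n) ℤ.+ (f ∘ suc ⊛ g) n

⊖_ : Series → Series
(⊖ f) n = ℤ.- f n

𝟘 𝟙 : Series
𝟘 n       = 0ℤ
𝟙 zero    = 1ℤ
𝟙 (suc n) = 0ℤ

⊛-cong : ∀ {f f′ g g′} n → (∀ i → i ≤ n → f i ≡ f′ i) → (∀ i → i ≤ n → g i ≡ g′ i) → (f ⊛ g) n ≡ (f′ ⊛ g′) n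
⊛-cong zero    f≡ g≡ = ≡.cong₂ ℤ._*_ (f≡ 0 z≤n) (g≡ 0 z≤n)
⊛-cong (suc n) f≡ g≡ = ≡.cong₂ ℤ._+_ (≡.cong₂ ℤ._*_ (f≡ 0 z≤n) (g≡ (suc n) ℕₚ.≤-refl))
  (⊛-cong n (λ i i≤n → f≡ (suc i) (s≤s i≤n)) (λ i i≤n → g≡ i (ℕₚ.m≤n⇒m≤1+n i≤n)))

⊛-zeroˡ : ∀ g n → (𝟘 ⊛ g) n ≡ 0ℤ
⊛-zeroˡ g zero    = ≡.refl
⊛-zeroˡ g (suc n) = ≡.trans (ℤₚ.+-identityˡ _) (⊛-zeroˡ g n)

⊛-identityˡ : ∀ g n → (𝟙 ⊛ g) n ≡ g n
⊛-identityˡ g zero    = ℤₚ.*-identityˡ _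
⊛-identityˡ g (suc n) = ≡.trans (≡.cong₂ ℤ._+_ (ℤₚ.*-identityˡ (g (suc n))) (⊛-zeroˡ g n)) (ℤₚ.+-identityʳ (g (suc n)))

-- The defining recursion splits off the constant term of f, this mirror image that of g; the two
-- together give commutativity.
⊛-suc : ∀ f g n → (f ⊛ g) (suc n) ≡ (f ⊛ g ∘ suc) n ℤ.+ f (suc n) ℤ.* g 0
⊛-suc f g zero    = ≡.refl
⊛-suc f g (suc n) = ≡.trans (≡.cong (λ x → f 0 ℤ.* g (suc (suc n)) ℤ.+ x) (⊛-suc (f ∘ suc) g n))
  (≡.sym (ℤₚ.+-assoc (f 0 ℤ.* g (suc (suc n))) ((f ∘ suc ⊛ g ∘ suc) n) (f (suc (suc n)) ℤ.* g 0)))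

⊛-comm : ∀ f g n → (f ⊛ g) n ≡ (g ⊛ f) n
⊛-comm f g zero    = ℤₚ.*-comm (f 0) (g 0)
⊛-comm f g (suc n) = begin
  f 0 ℤ.* g (suc n) ℤ.+ (f ∘ suc ⊛ g) n   ≡⟨ ≡.cong₂ ℤ._+_ (ℤₚ.*-comm (f 0) _) (⊛-comm (f ∘ suc) g n) ⟩
  g (suc n) ℤ.* f 0 ℤ.+ (g ⊛ f ∘ suc) n   ≡⟨ ℤₚ.+-comm (g (suc n) ℤ.* f 0) ((g ⊛ f ∘ suc) n) ⟩
  (g ⊛ f ∘ suc) n ℤ.+ g (suc n) ℤ.* f 0   ≡⟨ ⊛-suc g f n ⟨
  (g ⊛ f) (suc n)                         ∎
  where open ≡.≡-Reasoning

⊛-distribʳ : ∀ h f g n → ((f ⊕ g) ⊛ h) n ≡ (f ⊛ h) n ℤ.+ (g ⊛ h) n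
⊛-distribʳ h f g zero    = ℤₚ.*-distribʳ-+ (h 0) (f 0) (g 0)
⊛-distribʳ h f g (suc n) = ≡.trans (≡.cong (λ x → (f 0 ℤ.+ g 0) ℤ.* h (suc n) ℤ.+ x) (⊛-distribʳ h (f ∘ suc) (g ∘ suc) n))
  (eq (f 0) (g 0) (h (suc n)) _ _)
  where
  eq : ∀ a b c x y → (a ℤ.+ b) ℤ.* c ℤ.+ (x ℤ.+ y) ≡ (a ℤ.* c ℤ.+ x) ℤ.+ (b ℤ.* c ℤ.+ y)
  eq = solve-∀

⊛-scale : ∀ c f g n → ((λ k → c ℤ.* f k) ⊛ g) n ≡ c ℤ.* (f ⊛ g) n
⊛-scale c f g zero    = ℤₚ.*-assoc c (f 0) (g 0)
⊛-scale c f g (suc n) = ≡.trans (≡.cong (λ x → c ℤ.* f 0 ℤ.* g (suc n) ℤ.+ x) (⊛-scale c (f ∘ suc) g n)) (eq c (f 0) _ _)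
  where
  eq : ∀ c a b x → c ℤ.* a ℤ.* b ℤ.+ c ℤ.* x ≡ c ℤ.* (a ℤ.* b ℤ.+ x)
  eq = solve-∀

⊛-assoc : ∀ f g h n → ((f ⊛ g) ⊛ h) n ≡ (f ⊛ (g ⊛ h)) n
⊛-assoc f g h zero    = ℤₚ.*-assoc (f 0) (g 0) (h 0)
⊛-assoc f g h (suc n) = begin
  f 0 ℤ.* g 0 ℤ.* h (suc n) ℤ.+ (((λ k → f 0 ℤ.* g (suc k)) ⊕ (f ∘ suc ⊛ g)) ⊛ h) n
    ≡⟨ ≡.cong (λ x → f 0 ℤ.* g 0 ℤ.* h (suc n) ℤ.+ x) (⊛-distribʳ h (λ k → f 0 ℤ.* g (suc k)) (f ∘ suc ⊛ g) n) ⟩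
  f 0 ℤ.* g 0 ℤ.* h (suc n) ℤ.+ (((λ k → f 0 ℤ.* g (suc k)) ⊛ h) n ℤ.+ ((f ∘ suc ⊛ g) ⊛ h) n)
    ≡⟨ ≡.cong₂ (λ x y → f 0 ℤ.* g 0 ℤ.* h (suc n) ℤ.+ (x ℤ.+ y)) (⊛-scale (f 0) (g ∘ suc) h n) (⊛-assoc (f ∘ suc) g h n) ⟩
  f 0 ℤ.* g 0 ℤ.* h (suc n) ℤ.+ (f 0 ℤ.* (g ∘ suc ⊛ h) n ℤ.+ (f ∘ suc ⊛ (g ⊛ h)) n)
    ≡⟨ eq (f 0) (g 0) (h (suc n)) _ _ ⟩
  f 0 ℤ.* (g 0 ℤ.* h (suc n) ℤ.+ (g ∘ suc ⊛ h) n) ℤ.+ (f ∘ suc ⊛ (g ⊛ h)) n ∎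
  where
  open ≡.≡-Reasoning
  eq : ∀ a b c x y → a ℤ.* b ℤ.* c ℤ.+ (a ℤ.* x ℤ.+ y) ≡ a ℤ.* (b ℤ.* c ℤ.+ x) ℤ.+ y
  eq = solve-∀

-- ℤ[[q]] modulo q^N
truncatedSeries : ℕ → CommutativeRing 0ℓ 0ℓ
truncatedSeries N = record
  { Carrier = Series
  ; _≈_ = λ f g → ∀ n → n < N → f n ≡ g n
  ; _+_ = _⊕_
  ; _*_ = _⊛_
  ; -_ = ⊖_
  ; 0# = 𝟘
  ; 1# = 𝟙
  ; isCommutativeRing = record
    { isRing = record
      { +-isAbelianGroup = record
        { isGroup = record
          { isMonoid = record
            { isSemigroup = record
              { isMagma = record
                { isEquivalence = record
                  { refl = λ _ _ → ≡.refl
                  ; sym = λ p n n<N → ≡.sym (p n n<N)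
                  ; trans = λ p r n n<N → ≡.trans (p n n<N) (r n n<N)
                  }
                ; ∙-cong = λ p r n n<N → ≡.cong₂ ℤ._+_ (p n n<N) (r n n<N)
                }
              ; assoc = λ f g h n _ → ℤₚ.+-assoc (f n) (g n) (h n)
              }
            ; identity = (λ f n _ → ℤₚ.+-identityˡ (f n)) , (λ f n _ → ℤₚ.+-identityʳ (f n))
            }
          ; inverse = (λ f n _ → ℤₚ.+-inverseˡ (f n)) , (λ f n _ → ℤₚ.+-inverseʳ (f n))
          ; ⁻¹-cong = λ p n n<N → ≡.cong ℤ.-_ (p n n<N)
          }
        ; comm = λ f g n _ → ℤₚ.+-comm (f n) (g n)
        }
      ; *-cong = λ p r n n<N → ⊛-cong n (λ i i≤n → p i (ℕₚ.≤-<-trans i≤n n<N)) (λ i i≤n → r i (ℕₚ.≤-<-trans i≤n n<N))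
      ; *-assoc = λ f g h n _ → ⊛-assoc f g h n
      ; *-identity = (λ f n _ → ⊛-identityˡ f n) , (λ f n _ → ≡.trans (⊛-comm f 𝟙 n) (⊛-identityˡ f n))
      ; distrib = (λ f g h n _ → ≡.trans (⊛-comm f (g ⊕ h) n) (≡.trans (⊛-distribʳ f g h n) (≡.cong₂ ℤ._+_ (⊛-comm g f n) (⊛-comm h f n))))
                , (λ f g h n _ → ⊛-distribʳ f g h n)
      }
    ; *-comm = λ f g n _ → ⊛-comm f g n
    }
  }

q : Series
q 1 = 1ℤ
q _ = 0ℤ

private
  suc-q : ∀ n → q (suc n) ≡ 𝟙 n
  suc-q zero    = ≡.refl
  suc-q (suc n) = ≡.refl

q⊛-suc : ∀ f n → (q ⊛ f) (suc n) ≡ f n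
q⊛-suc f n = ≡.trans (ℤₚ.+-identityˡ _) (≡.trans (⊛-cong {g = f} n (λ i _ → suc-q i) (λ _ _ → ≡.refl)) (⊛-identityˡ f n))

module _ {N : ℕ} where
  open CommutativeRing (truncatedSeries N) using (semiring; _*_; _≈_; 0#)
  open import Algebra.Properties.Semiring.Exp semiring using (_^_)

  q^-shift : ∀ m f n → (q ^ m * f) (m ℕ.+ n) ≡ f n
  q^-shift zero    f n = ⊛-identityˡ f n
  q^-shift (suc m) f n = ≡.trans (⊛-assoc q (q ^ m) f (suc m ℕ.+ n)) (≡.trans (q⊛-suc (q ^ m * f) (m ℕ.+ n)) (q^-shift m f n))

  q^-below : ∀ m f n → n < m → (q ^ m * f) n ≡ 0ℤ
  q^-below (suc m) f zero    _         = ⊛-assoc q (q ^ m) f 0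
  q^-below (suc m) f (suc n) (s≤s n<m) = ≡.trans (⊛-assoc q (q ^ m) f (suc n)) (≡.trans (q⊛-suc (q ^ m * f) n) (q^-below m f n n<m))

  q^-zero : ∀ m → N ≤ m → q ^ m ≈ 0#
  q^-zero m N≤m n n<N = ≡.trans (≡.sym (≡.trans (⊛-comm (q ^ m) 𝟙 n) (⊛-identityˡ (q ^ m) n)))
    (q^-below m 𝟙 n (ℕₚ.<-≤-trans n<N N≤m))

-- Partition numbers and Euler's product

module _ (S : PosSet) where

  -- A unit of fuel is spent only in passing to n ∸ suc k, which is smaller than n unless n = 0, so
  -- any amount from n on is enough.
  partsF-fuel : ∀ k f f′ n → n ≤ f → n ≤ f′ → partsF S f k n ≡ partsF S f′ k n
  partsF-fuel zero    f       f′       zero    _  _   = ≡.refl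
  partsF-fuel zero    f       f′       (suc n) _  _   = ≡.refl
  partsF-fuel (suc k) zero    zero     n       _  _   = ≡.refl
  partsF-fuel (suc k) zero    (suc f′) zero    _  _   with S (suc k)
  ... | true  = ≡.sym (++-identityʳ _)
  ... | false = ≡.sym (++-identityʳ _)
  partsF-fuel (suc k) (suc f) zero     zero    n≤ n≤′ = ≡.sym (partsF-fuel (suc k) zero (suc f) zero n≤′ n≤)
  partsF-fuel (suc k) (suc f) (suc f′) n       n≤ n≤′ =
    ≡.cong (λ ps → partsF S n k n ++ (if S (suc k) ∧ (suc k ≤ᵇ n) then map (suc k ∷_) ps else []))
      (partsF-fuel (suc k) f f′ (n ∸ suc k) (below n≤) (below n≤′))
    where
    below : ∀ {g} → n ≤ suc g → n ∸ suc k ≤ g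
    below n≤ = ℕₚ.≤-trans (ℕₚ.∸-monoˡ-≤ (suc k) n≤) (ℕₚ.m∸n≤m _ k)

  count : ℕ → ℕ → ℕ
  count k n = length (partsF S n k n)

  private
    remainder : ℕ → ℕ → ℕ
    remainder k n = if S (suc k) ∧ (suc k ≤ᵇ n) then count (suc k) (n ∸ suc k) else 0

  count-suc : ∀ k n → count (suc k) n ≡ count k n ℕ.+ remainder k n
  count-suc k zero with S (suc k)
  ... | true  = ≡.sym (ℕₚ.+-identityʳ _)
  ... | false = ≡.sym (ℕₚ.+-identityʳ _)
  count-suc k (suc n) = ≡.trans (length-++ (partsF S (suc n) k (suc n))) (≡.cong (count k (suc n) ℕ.+_) rest)
    where
    rest : length (if S (suc k) ∧ (suc k ≤ᵇ suc n) then map (suc k ∷_) (partsF S n (suc k) (n ∸ k)) else [])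
           ≡ remainder k (suc n)
    rest with S (suc k) ∧ (suc k ≤ᵇ suc n)
    ... | true  = ≡.trans (length-map (suc k ∷_) (partsF S n (suc k) (n ∸ k)))
      (≡.cong length (partsF-fuel (suc k) n (n ∸ k) (n ∸ k) (ℕₚ.m∸n≤m n k) ℕₚ.≤-refl))
    ... | false = ≡.refl

  private
    >⇒≰ᵇ : ∀ {m n} → n < m → (m ≤ᵇ n) ≡ false
    >⇒≰ᵇ {m} {n} n<m with m ≤ᵇ n | ℕₚ.≤ᵇ⇒≤ m n
    ... | true  | m≤n = contradiction (m≤n _) (ℕₚ.<⇒≱ n<m)
    ... | false | _   = ≡.refl

    ≤⇒≤ᵇ : ∀ {m n} → m ≤ n → (m ≤ᵇ n) ≡ true
    ≤⇒≤ᵇ {m} {n} m≤n with m ≤ᵇ n | ℕₚ.≤⇒≤ᵇ m≤n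
    ... | true | _ = ≡.refl

    remainder-small : ∀ {k n} → n ≤ k → remainder k n ≡ 0
    remainder-small {k} {n} n≤k rewrite >⇒≰ᵇ (s≤s n≤k) with S (suc k)
    ... | true  = ≡.refl
    ... | false = ≡.refl

  count-stable : ∀ {k} n → n ≤ k → count k n ≡ p S n
  count-stable {k} n n≤k = ≡.trans (≡.cong (λ j → count j n) (≡.sym (ℕₚ.m∸n+n≡m n≤k))) (go (k ∸ n))
    where
    go : ∀ d → count (d ℕ.+ n) n ≡ count n n
    go zero    = ≡.refl
    go (suc d) = ≡.trans (count-suc (d ℕ.+ n) n)
      (≡.trans (≡.cong (count (d ℕ.+ n) n ℕ.+_) (remainder-small (ℕₚ.m≤n+m n d))) (≡.trans (ℕₚ.+-identityʳ _) (go d)))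

  module _ (N : ℕ) where
    private R = truncatedSeries N
    open CommutativeRing R
    open import Algebra.Properties.Semiring.Exp semiring using (_^_)
    open import Relation.Binary.Reasoning.Setoid setoid
    open import Algebra.Properties.Ring ring using (-‿distribˡ-*)
    open Summation R using (module Product)
    open Product using () renaming (fold to product)

    countSeries : ℕ → Series
    countSeries k n = + count k n

    factor : ℕ → Series
    factor j = if S j then 1# - q ^ j else 1#

    -- `count-suc` as an equation of series: if k + 1 lies in S, then C(k+1) = C(k) + q^(k+1)
    -- C(k+1), where C(k) counts partitions into parts at most k.
    factor-count : ∀ k → factor (suc k) * countSeries (suc k) ≈ countSeries k
    factor-count k with S (suc k) in S≡
    ... | false = trans (*-identityˡ _) λ n _ → ≡.cong +_ (≡.trans (count-suc k n)
                    (≡.trans (≡.cong (λ b → count k n ℕ.+ (if b ∧ (suc k ≤ᵇ n) then count (suc k) (n ∸ suc k) else 0)) S≡)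
                      (ℕₚ.+-identityʳ _)))
    ... | true  = begin
      (1# - q ^ suc k) * countSeries (suc k)
        ≈⟨ trans (distribʳ _ _ _) (+-cong (*-identityˡ _) (sym (-‿distribˡ-* _ _))) ⟩
      countSeries (suc k) - q ^ suc k * countSeries (suc k)
        ≈⟨ pointwise ⟩
      countSeries k ∎
      where
      subtract : ∀ a b c → a ≡ b ℕ.+ c → + a ℤ.- + c ≡ + b
      subtract a b c ≡.refl = ≡.trans (≡.cong (ℤ._- + c) (ℤₚ.pos-+ b c)) (cancel (+ b) (+ c))
        where
        cancel : ∀ x y → x ℤ.+ y ℤ.- y ≡ x
        cancel = solve-∀
      pointwise : countSeries (suc k) - q ^ suc k * countSeries (suc k) ≈ countSeries k
      pointwise n _ with suc k ℕₚ.≤? n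
      ... | yes k<n = ≡.trans (≡.cong (λ x → + count (suc k) n ℤ.- x) shifted)
              (subtract _ _ _ (≡.trans (count-suc k n) (≡.cong (count k n ℕ.+_)
                (≡.cong₂ (λ b b′ → if b ∧ b′ then count (suc k) (n ∸ suc k) else 0) S≡ (≤⇒≤ᵇ k<n)))))
        where
        shifted : (q ^ suc k * countSeries (suc k)) n ≡ + count (suc k) (n ∸ suc k)
        shifted = ≡.trans (≡.cong (q ^ suc k * countSeries (suc k)) (≡.sym (ℕₚ.m+[n∸m]≡n k<n)))
          (q^-shift {N} (suc k) (countSeries (suc k)) (n ∸ suc k))
      ... | no k≮n = ≡.trans (≡.cong (λ x → + count (suc k) n ℤ.- x) (q^-below {N} (suc k) (countSeries (suc k)) n n<))
              (subtract _ _ 0 (≡.trans (count-suc k n) (≡.cong (count k n ℕ.+_) (remainder-small (ℕₚ.≤-pred n<)))))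
        where
        n< : n < suc k
        n< = ℕₚ.≰⇒> k≮n

    -- Euler's product by telescoping, without inverses: each factor lowers the bound on the parts
    -- by one, and with no parts left only the empty partition counts.
    product-count : ∀ k → product (factor ∘ suc) k * countSeries k ≈ 1#
    product-count zero    = trans (*-identityˡ _) λ { zero _ → ≡.refl ; (suc n) _ → ≡.refl }
    product-count (suc k) = begin
      product (factor ∘ suc) k * factor (suc k) * countSeries (suc k)    ≈⟨ *-assoc _ _ _ ⟩
      product (factor ∘ suc) k * (factor (suc k) * countSeries (suc k))  ≈⟨ *-congˡ (factor-count k) ⟩
      product (factor ∘ suc) k * countSeries k                           ≈⟨ product-count k ⟩
      1#                                                                 ∎

    partitionSeries : Series
    partitionSeries n = + p S n

    product-partitions : ∀ k → N ≤ k → product (factor ∘ suc) k * partitionSeries ≈ 1#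
    product-partitions k N≤k = trans (*-congˡ λ n n<N →
      ≡.cong +_ (≡.sym (count-stable n (ℕₚ.≤-trans (ℕₚ.<⇒≤ n<N) N≤k)))) (product-count k)

-- Generating functions as inverses of bracket products

select : PosSet → ℕ → List ℕ
select S zero    = []
select S (suc n) = if S (suc n) then suc n ∷ select S n else select S n

pmResidues-periodic : ∀ rs i j → pmResidues 60 rs (suc (i ℕ.* 60 ℕ.+ j)) ≡ pmResidues 60 rs (suc j)
pmResidues-periodic []       i j = ≡.refl
pmResidues-periodic (r ∷ rs) i j = ≡.cong₂ _∨_
  (≡.cong₂ (λ x y → (x ≡ᵇ (r % 60)) ∨ (y ≡ᵇ 0))
    (≡.trans (≡.cong (λ m → suc m % 60) (ℕₚ.+-comm (i ℕ.* 60) j)) ([m+kn]%n≡m%n (suc j) i 60))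
    (≡.trans (≡.cong (λ m → suc m % 60) (rearrange (i ℕ.* 60) j r)) ([m+kn]%n≡m%n (suc (j ℕ.+ r)) i 60)))
  (pmResidues-periodic rs i j)
  where
  rearrange : ∀ a b c → a ℕ.+ b ℕ.+ c ≡ b ℕ.+ c ℕ.+ a
  rearrange a b c = ≡.trans (ℕₚ.+-assoc a b c) (ℕₚ.+-comm a (b ℕ.+ c))

module GeneratingFunctions (N : ℕ) where
  R = truncatedSeries N
  open CommutativeRing R
  open import Algebra.Properties.Semiring.Exp semiring using (_^_; ^-homo-*; ^-assocʳ)
  open import Relation.Binary.Reasoning.Setoid setoid
  open import Algebra.Properties.CommutativeSemigroup *-commutativeSemigroup using (interchange)
  open IntegerSolver R
  open Summation R using (module Product)
  open Product using () renaming (fold to product)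
  open ListProduct R

  K : ℕ
  K = N ℕ.+ N

  open Identities.Truncated R q N (q^-zero {N}) K ℕₚ.≤-refl public
    using ([_]′₆₀; identity₁; identity₂; identity₃; identity₄)

  product-select : ∀ S f n → product (λ j → if S (suc j) then f (suc j) else 1#) n ≈ listProduct f (select S n)
  product-select S f zero    = refl
  product-select S f (suc n) with S (suc n)
  ... | true  = trans (*-comm _ _) (*-congˡ (product-select S f n))
  ... | false = trans (*-identityʳ _) (product-select S f n)

  listProduct-map : ∀ f (g : ℕ → ℕ) rs → listProduct f (map g rs) ≈ listProduct (f ∘ g) rs
  listProduct-map f g []       = refl
  listProduct-map f g (r ∷ rs) = *-congˡ (listProduct-map f g rs)

  listProduct-* : ∀ f g rs → listProduct f rs * listProduct g rs ≈ listProduct (λ r → f r * g r) rs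
  listProduct-* f g []       = *-identityˡ 1#
  listProduct-* f g (r ∷ rs) = trans (interchange _ _ _ _) (*-congˡ (listProduct-* f g rs))

  product-listProduct : ∀ (f : ℕ → ℕ → Series) rs n →
                        product (λ i → listProduct (f i) rs) n ≈ listProduct (λ r → product (λ i → f i r) n) rs
  product-listProduct f []       n = Product.fold-ε n (λ _ _ → refl)
  product-listProduct f (r ∷ rs) n = trans (Product.fold-∙ _ _ n) (*-congˡ (product-listProduct f rs n))

  listProduct-cong : ∀ {f g} rs → (∀ r → f r ≈ g r) → listProduct f rs ≈ listProduct g rs
  listProduct-cong []       f≈g = refl
  listProduct-cong (r ∷ rs) f≈g = *-cong (f≈g r) (listProduct-cong rs f≈g)

  -- The set is periodic, so the product is cut into blocks of length 60. The hypothesis, checked by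
  -- computation, says that one period consists of all r and 60 - r, without repetition.
  product-factor : ∀ rs → sort (select (pmResidues 60 rs) 60) ≡ sort (rs ++ map (60 ∸_) rs) →
                   product (factor (pmResidues 60 rs) N ∘ suc) (K ℕ.* 60) ≈ [ rs ]′₆₀
  product-factor rs S≡ = begin
    product (factor S N ∘ suc) (K ℕ.* 60)
      ≈⟨ Product.fold-blocks (factor S N ∘ suc) K 60 ⟩
    product (λ i → product (λ j → factor S N (suc (i ℕ.* 60 ℕ.+ j))) 60) K
      ≈⟨ Product.fold-cong K (λ i → Product.fold-cong 60 λ j → reflexive
           (≡.cong (λ s → if s then 1# - q ^ suc (i ℕ.* 60 ℕ.+ j) else 1#) (pmResidues-periodic rs i j))) ⟩
    product (λ i → product (λ j → if S (suc j) then 1# - q ^ suc (i ℕ.* 60 ℕ.+ j) else 1#) 60) K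
      ≈⟨ Product.fold-cong K (λ i → Product.fold-cong 60 λ j → reflexive
           (≡.cong (λ m → if S (suc j) then 1# - q ^ m else 1#) (≡.sym (ℕₚ.+-suc (i ℕ.* 60) j)))) ⟩
    product (λ i → product (λ j → if S (suc j) then g i (suc j) else 1#) 60) K
      ≈⟨ Product.fold-cong K block ⟩
    product (λ i → listProduct (λ r → g i r * g i (60 ∸ r)) rs) K
      ≈⟨ product-listProduct (λ i r → g i r * g i (60 ∸ r)) rs K ⟩
    listProduct (λ r → product (λ i → g i r * g i (60 ∸ r)) K) rs
      ≈⟨ listProduct-cong rs (λ r → Product.fold-cong K λ i → *-cong (side i r) (side i (60 ∸ r))) ⟩
    [ rs ]′₆₀ ∎
    where
    S = pmResidues 60 rs
    g : ℕ → ℕ → Series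
    g i r = 1# - q ^ (i ℕ.* 60 ℕ.+ r)
    block : ∀ i → product (λ j → if S (suc j) then g i (suc j) else 1#) 60 ≈ listProduct (λ r → g i r * g i (60 ∸ r)) rs
    block i = begin
      product (λ j → if S (suc j) then g i (suc j) else 1#) 60   ≈⟨ product-select S (g i) 60 ⟩
      listProduct (g i) (select S 60)                            ≈⟨ sort-product (g i) (select S 60) ⟨
      listProduct (g i) (sort (select S 60))                     ≡⟨ ≡.cong (listProduct (g i)) S≡ ⟩
      listProduct (g i) (sort (rs ++ map (60 ∸_) rs))            ≈⟨ sort-product (g i) (rs ++ map (60 ∸_) rs) ⟩
      listProduct (g i) (rs ++ map (60 ∸_) rs)                   ≈⟨ listProduct-++ (g i) rs (map (60 ∸_) rs) ⟩
      listProduct (g i) rs * listProduct (g i) (map (60 ∸_) rs)  ≈⟨ *-congˡ (listProduct-map (g i) (60 ∸_) rs) ⟩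
      listProduct (g i) rs * listProduct (λ r → g i (60 ∸ r)) rs ≈⟨ listProduct-* (g i) (λ r → g i (60 ∸ r)) rs ⟩
      listProduct (λ r → g i r * g i (60 ∸ r)) rs                ∎
    side : ∀ i r → g i r ≈ 1# - 1# * q ^ r * (q ^ 60) ^ i
    side i r = +-congˡ {1#} (-‿cong (begin
      q ^ (i ℕ.* 60 ℕ.+ r)        ≈⟨ ^-homo-* q (i ℕ.* 60) r ⟩
      q ^ (i ℕ.* 60) * q ^ r    ≈⟨ *-comm _ _ ⟩
      q ^ r * q ^ (i ℕ.* 60)    ≡⟨ ≡.cong (λ m → q ^ r * q ^ m) (ℕₚ.*-comm i 60) ⟩
      q ^ r * q ^ (60 ℕ.* i)    ≈⟨ *-cong (sym (*-identityˡ _)) (sym (^-assocʳ q 60 i)) ⟩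
      1# * q ^ r * (q ^ 60) ^ i ∎))

  bracket-inverse : ∀ rs → sort (select (pmResidues 60 rs) 60) ≡ sort (rs ++ map (60 ∸_) rs) →
                    [ rs ]′₆₀ * partitionSeries (pmResidues 60 rs) N ≈ 1#
  bracket-inverse rs S≡ = trans (*-congʳ (sym (product-factor rs S≡)))
    (product-partitions (pmResidues 60 rs) N (K ℕ.* 60) (ℕₚ.≤-trans (ℕₚ.m≤m+n N N) (ℕₚ.m≤m*n K 60)))

  -- P and V are inverse to [rs] and [us]; multiplying the identity by V P amounts to dividing it by
  -- [rs] [us].
  difference : ∀ rs us a e →
    sort (select (pmResidues 60 rs) 60) ≡ sort (rs ++ map (60 ∸_) rs) →
    sort (select (pmResidues 60 us) 60) ≡ sort (us ++ map (60 ∸_) us) →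
    [ us ]′₆₀ - q ^ a * [ rs ]′₆₀ ≈ q ^ e * ([ rs ]′₆₀ * [ us ]′₆₀) →
    partitionSeries (pmResidues 60 rs) N ≈
    q ^ e * 1# + q ^ a * partitionSeries (pmResidues 60 us) N
  difference rs us a e S≡ U≡ id = begin
    P
      ≈⟨ trans (sym (*-identityˡ P)) (*-congʳ (sym UV≈1)) ⟩
    ([ us ]′₆₀ * V) * P
      ≈⟨ solve 5 (λ U V P S x → (U :* V) :* P := (U :- x :* S) :* (V :* P) :+ x :* (S :* P) :* V) refl
           [ us ]′₆₀ V P [ rs ]′₆₀ (q ^ a) ⟩
    ([ us ]′₆₀ - q ^ a * [ rs ]′₆₀) * (V * P) + q ^ a * ([ rs ]′₆₀ * P) * V
      ≈⟨ +-cong (*-congʳ id) (*-congʳ (*-congˡ SP≈1)) ⟩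
    q ^ e * ([ rs ]′₆₀ * [ us ]′₆₀) * (V * P) + q ^ a * 1# * V
      ≈⟨ +-cong (solve 5 (λ U V P S x → x :* (S :* U) :* (V :* P) := x :* ((S :* P) :* (U :* V))) refl
           [ us ]′₆₀ V P [ rs ]′₆₀ (q ^ e)) (*-congʳ (*-identityʳ _)) ⟩
    q ^ e * (([ rs ]′₆₀ * P) * ([ us ]′₆₀ * V)) + q ^ a * V
      ≈⟨ +-congʳ (*-congˡ (trans (*-cong SP≈1 UV≈1) (*-identityˡ 1#))) ⟩
    q ^ e * 1# + q ^ a * V ∎
    where
    P = partitionSeries (pmResidues 60 rs) N
    V = partitionSeries (pmResidues 60 us) N
    SP≈1 = bracket-inverse rs S≡
    UV≈1 = bracket-inverse us U≡

  private
    monomial-≢ : ∀ e n → n ≢ e → (q ^ e * 1#) n ≡ 0ℤ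
    monomial-≢ e n n≢e with ℕₚ.<-cmp n e
    ... | tri< n<e _ _ = q^-below {N} e 1# n n<e
    ... | tri≈ _ n≡e _ = contradiction n≡e n≢e
    ... | tri> _ _ e<n = ≡.trans (≡.cong (q ^ e * 1#) (≡.sym (≡.trans (ℕₚ.+-suc e (n ∸ suc e)) (ℕₚ.m+[n∸m]≡n e<n))))
                           (q^-shift {N} e 1# (suc (n ∸ suc e)))

  -- Comparison of the coefficients of q^n in `difference`; q^e contributes only at n = e.
  shifted-partitions : ∀ rs us a e →
    sort (select (pmResidues 60 rs) 60) ≡ sort (rs ++ map (60 ∸_) rs) →
    sort (select (pmResidues 60 us) 60) ≡ sort (us ++ map (60 ∸_) us) →
    [ us ]′₆₀ - q ^ a * [ rs ]′₆₀ ≈ q ^ e * ([ rs ]′₆₀ * [ us ]′₆₀) →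
    ∀ n → n < N → a ≤ n → n ≢ e → p (pmResidues 60 rs) n ≡ p (pmResidues 60 us) (n ∸ a)
  shifted-partitions rs us a e S≡ U≡ id n n<N a≤n n≢e = ℤₚ.+-injective (≡.trans (difference rs us a e S≡ U≡ id n n<N)
    (≡.trans (≡.cong₂ ℤ._+_ (monomial-≢ e n n≢e)
        (≡.trans (≡.cong (q ^ a * V) (≡.sym (ℕₚ.m+[n∸m]≡n a≤n))) (q^-shift {N} a V (n ∸ a))))
      (ℤₚ.+-identityˡ _)))
    where V = partitionSeries (pmResidues 60 us) N

theorem12p8 : ((n : ℕ) → 1 ≤ n →
    p (pmResidues 60 (1 ∷ 6 ∷ 7 ∷ 8 ∷ 11 ∷ 13 ∷ 18 ∷ 19 ∷ 20 ∷ 21 ∷ 23 ∷ 25 ∷ [])) n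
    ≡ p (pmResidues 60 (1 ∷ 5 ∷ 6 ∷ 7 ∷ 13 ∷ 17 ∷ 18 ∷ 19 ∷ 20 ∷ 21 ∷ 28 ∷ 29 ∷ [])) (n ∸ 1))
    × ((n : ℕ) → 4 ≤ n →
    p (pmResidues 60 (4 ∷ 5 ∷ 6 ∷ 7 ∷ 11 ∷ 13 ∷ 17 ∷ 18 ∷ 19 ∷ 20 ∷ 27 ∷ 29 ∷ [])) n
    ≡ p (pmResidues 60 (1 ∷ 6 ∷ 7 ∷ 11 ∷ 13 ∷ 16 ∷ 18 ∷ 20 ∷ 23 ∷ 25 ∷ 27 ∷ 29 ∷ [])) (n ∸ 4))
    × ((n : ℕ) → 5 ≤ n →
    p (pmResidues 60 (5 ∷ 6 ∷ 7 ∷ 8 ∷ 9 ∷ 11 ∷ 17 ∷ 18 ∷ 19 ∷ 20 ∷ 23 ∷ 29 ∷ [])) n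
    ≡ p (pmResidues 60 (1 ∷ 6 ∷ 9 ∷ 11 ∷ 13 ∷ 17 ∷ 18 ∷ 20 ∷ 23 ∷ 25 ∷ 28 ∷ 29 ∷ [])) (n ∸ 5))
    × ((n : ℕ) → n ≢ 4 →
    p (pmResidues 60 (1 ∷ 3 ∷ 4 ∷ 6 ∷ 11 ∷ 13 ∷ 17 ∷ 18 ∷ 19 ∷ 20 ∷ 23 ∷ 25 ∷ [])) n
    ≡ p (pmResidues 60 (1 ∷ 3 ∷ 5 ∷ 6 ∷ 7 ∷ 16 ∷ 17 ∷ 18 ∷ 19 ∷ 20 ∷ 23 ∷ 29 ∷ [])) n)
theorem12p8 =
    -- Precision N = n + 1 just reaches the coefficient of q^n. In the first three cases e = 0, and
    -- the lower bound on n excludes n = 0.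
    (λ n 1≤n → shifted-partitions (suc n) S₁ T₁ 1 0 ≡.refl ≡.refl (identity₁ (suc n)) n ℕₚ.≤-refl 1≤n (ℕₚ.>⇒≢ 1≤n))
  , (λ n 4≤n → shifted-partitions (suc n) S₂ T₂ 4 0 ≡.refl ≡.refl (identity₂ (suc n)) n ℕₚ.≤-refl 4≤n (ℕₚ.m<n⇒n≢0 4≤n))
  , (λ n 5≤n → shifted-partitions (suc n) S₃ T₃ 5 0 ≡.refl ≡.refl (identity₃ (suc n)) n ℕₚ.≤-refl 5≤n (ℕₚ.m<n⇒n≢0 5≤n))
  , (λ n n≢4 → shifted-partitions (suc n) S₄ T₄ 0 4 ≡.refl ≡.refl (identity₄ (suc n)) n ℕₚ.≤-refl z≤n n≢4)
  where open GeneratingFunctions
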